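{- Let $G$ be a connected graph of order at least three. Then the following statements are equivalent: (1) $G$ is a minimal DPDP-graph. (2) $G = S_2(H)$ for some connected graph $H$ (and some function $\alpha$), and either $(V^o_{S_2(H)}, V^n_{S_2(H)})$ is the unique DP-pair in $G$, or $G$ is a cycle of length $3$, $6$ or $9$. (3) $G = S_2(H)$ for some connected graph $H$ (and some function $\alpha$) that has neither an isolated vertex nor a good subgraph. (4) $G = S_2(H)$ for some connected graph $H$ (and some function $\alpha$), and no proper spanning subgraph of $G$ without isolated vertices is a 2-subdivided graph.
   Context: Graphs are finite and may have multiple edges and loops. A leaf is a vertex of degree one; a support vertex is a vertex adjacent to a leaf. A set $D\subseteq V(G)$ is a dominating set if every vertex outside $D$ has a neighbor in $D$; a set $P$ is a paired-dominating set if it is dominating and the subgraph induced by $P$ has a perfect matching. A DP-pair of $G$ is a pair $(D,P)$ of disjoint sets with $V(G)=D\cup P$, $D$ dominating and $P$ paired-dominating. A DPDP-graph is a graph having a DP-pair. A minimal DPDP-graph is a DPDP-graph no proper spanning subgraph of which (same vertex set, proper subset of the edges) is a DPDP-graph. 2-subdivision graph: Let $H$ be a graph with no isolated vertex, $L_H$ its set of leaves, and $\alpha:L_H\to\mathbb{N}=\{1,2,\dots\}$. The graph $S_2(H)$ (with respect to $\alpha$) has vertex set $V^o_{S_2(H)}\cup V^n_{S_2(H)}$, where $V^o_{S_2(H)}=(V_H\setminus L_H)\cup\{(v,i): v\in L_H,\ i\in\{1,\dots,\alpha(v)\}\}$ and $V^n_{S_2(H)}$ consists of two new vertices for each edge $e$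 of $H$: if $e$ joins $u\neq v$ they are $u_e,v_e$; if $e$ is a loop at $v$ they are $v_e^1,v_e^2$. Its edges are: for every edge $e$ of $H$, the edge joining its two new vertices; for every $v\in V_H\setminus L_H$, the edges $vv_e$ for each non-loop edge $e$ incident with $v$, and $vv_e^1, vv_e^2$ for each loop $e$ at $v$; for every $v\in L_H$ with incident edge $e$, the edges $v_e(v,i)$ for $i\in\{1,\dots,\alpha(v)\}$. (So every edge becomes a path of length three, every loop a triangle, and every leaf $v$ is replaced by $\alpha(v)$ leaves.) A graph is a 2-subdivided graph (2-subdivision graph) if it is isomorphic to $S_2(H')$ for some graph $H'$ without isolated vertices and some such $\alpha$. Good subgraph: Let $Q$ be a subgraph of $H$ without isolated vertices, and $E_Q^-$ the set of edges of $H$ not in $Q$ incident with at least one vertex of $Q$. $Q$ is a good subgraph of $H$ if there exist a set of edges $E$ with $E_Q^-\subseteq E\subseteq E_H\setminus E_Q$ and an orientation $A_E$ of the edges of $E$ (giving a partially oriented graph $H(A_E)$, where $d^+(x)$, $d^-(x)$ denote the numbers of arcs of $A_E$ leaving, resp. entering $x$, and $d_H(x)$ is the degree in $H$) such that the arcs of $A_E$ form a family $\mathcal P=\{P_x: x\in V_Q\}$ of oriented paths indexed by the vertices of $Q$ with: (i) every vertex $v$ of $Q$ is the initial vertex of exactly one path of $\mathcal P$, namely $P_v$, and $d^+(v)=1$, $d^-(v)=d_H(v)-d_Q(v)-1$; (ii) if $x$ is an inner vertex of a path of $\mathcal P$, then $d^+(x)=1$ and $d^-(x)=d_H(x)-1$;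 (iii) if $x$ is an end vertex of a path of $\mathcal P$, then $d^-(x)<d_H(x)$.
   Formalization: In the definition of a good subgraph, Q is required to be nonempty and an oriented path may return to its initial vertex at its end (closed path); with strictly open paths (3)⇒(1) fails for H a single vertex with two loops. -}

module Defs where

open import Data.Bool using (Bool; true; false; not; _∧_; T)
open import Data.Fin using (Fin; toℕ; _≟_)
open import Data.Fin.Subset using (∣_∣)
open import Data.List using (List; []; _∷_; map; drop)
open import Data.List.Membership.Propositional using () renaming (_∈_ to _∈ˡ_)
open import Data.List.Relation.Unary.Unique.Propositional using (Unique)
open import Data.Nat using (ℕ; suc; _+_; _≤_; _<_; NonZero)
open import Data.Nat.DivMod using (_mod_)
open import Data.Product using (Σ; ∃; ∃₂; ∃!; _×_; _,_; proj₁)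
open import Data.Sum using (_⊎_)
open import Data.Vec using (tabulate)
open import Function.Bundles using (_↔_; Inverse)
open import Relation.Binary.Construct.Closure.ReflexiveTransitive using (Star)
open import Relation.Binary.PropositionalEquality using (_≡_)
open import Relation.Nullary using (¬_)
open import Relation.Nullary.Decidable using (⌊_⌋)

-- Subsets are Boolean-valued, hence decidable.

Sub : Set → Set
Sub A = A → Bool

infix 4 _∈_ _∉_ _⊆_ _≐_

_∈_ _∉_ : {A : Set} → A → Sub A → Set
x ∈ S = T (S x)
x ∉ S = ¬ (x ∈ S)

_⊆_ _≐_ : {A : Set} → Sub A → Sub A → Set
S ⊆ S′ = ∀ x → x ∈ S → x ∈ S′
S ≐ S′ = S ⊆ S′ × S′ ⊆ S

everything : {A : Set} → Sub A
everything _ = true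

#_ : ∀ {k} → Sub (Fin k) → ℕ
# S = ∣ tabulate S ∣

-- Graphs with loops and multiple edges.  The labels false/true of the two
-- ends of an edge carry no meaning (isomorphisms may swap them, edge by
-- edge); a loop is an edge both of whose ends are the same vertex.

record Multigraph : Set₁ where
  field
    V   : Set
    E   : Set
    end : E → Bool → V

record FinGraph : Set where
  field
    order : ℕ
    size  : ℕ
    end   : Fin size → Bool → Fin order

⟦_⟧ : FinGraph → Multigraph
⟦ G ⟧ = record { V = Fin order ; E = Fin size ; end = end }
  where open FinGraph G

module _ (G : Multigraph) where
  open Multigraph G

  Incident : E → V → Set
  Incident e v = ∃ λ s → end e s ≡ v

  Adjacent : V → V → Set
  Adjacent u v = ∃₂ λ e s → end e s ≡ u × end e (not s) ≡ v

  Loop : E → Set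
  Loop e = end e false ≡ end e true

  Connected : Set
  Connected = ∀ u v → Star Adjacent u v

  NoIsolatedVertex : Set
  NoIsolatedVertex = ∀ v → ∃ λ e → Incident e v

  spanning : Sub E → Multigraph
  spanning F = record
    { V   = V
    ; E   = Σ E (_∈ F)
    ; end = λ e → end (proj₁ e)
    }

  Proper : Sub E → Set
  Proper F = ∃ λ e → e ∉ F

  Dominating : Sub V → Set
  Dominating D = ∀ v → v ∉ D → ∃ λ u → u ∈ D × Adjacent v u

  -- M is a perfect matching of the subgraph induced by P.
  PerfectMatchingOf : Sub V → Sub E → Set
  PerfectMatchingOf P M =
      (∀ e → e ∈ M → (∀ s → end e s ∈ P) × ¬ Loop e)
    × (∀ v → v ∈ P → ∃! _≡_ λ e → e ∈ M × Incident e v)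

  PairedDominating : Sub V → Set
  PairedDominating P = Dominating P × ∃ (PerfectMatchingOf P)

  DPPair : Sub V → Sub V → Set
  DPPair D P =
      (∀ v → ¬ (v ∈ D × v ∈ P))
    × (∀ v → v ∈ D ⊎ v ∈ P)
    × Dominating D
    × PairedDominating P

  UniqueDPPair : Sub V → Sub V → Set
  UniqueDPPair D P =
    DPPair D P × (∀ D′ P′ → DPPair D′ P′ → D′ ≐ D × P′ ≐ P)

  DPDP : Set
  DPDP = ∃₂ DPPair

MinimalDPDP : Multigraph → Set
MinimalDPDP G = DPDP G × (∀ F → Proper G F → ¬ DPDP (spanning G F))

infix 4 _≅_

record _≅_ (G G′ : Multigraph) : Set where
  private
    module G  = Multigraph G
    module G′ = Multigraph G′
  field
    onV : G.V ↔ G′.V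
    onE : G.E ↔ G′.E
    preserves-ends : ∀ e →
        (∀ s → G′.end (Inverse.to onE e) s ≡ Inverse.to onV (G.end e s))
      ⊎ (∀ s → G′.end (Inverse.to onE e) s ≡ Inverse.to onV (G.end e (not s)))

cycle : (k : ℕ) → .{{NonZero k}} → Multigraph
cycle k = record
  { V   = Fin k
  ; E   = Fin k
  ; end = λ { i false → i ; i true → suc (toℕ i) mod k }
  }

module _ (H : FinGraph) where
  open FinGraph H

  -- A loop contributes 2.
  degreeIn : Sub (Fin size) → Fin order → ℕ
  degreeIn F v = # (λ e → F e ∧ ⌊ end e false ≟ v ⌋)
               + # (λ e → F e ∧ ⌊ end e true  ≟ v ⌋)

  degree : Fin order → ℕ
  degree = degreeIn everything

  Leaf : Fin order → Set
  Leaf v = degree v ≡ 1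

  LeafFunction : Set
  LeafFunction = ∀ v → .(Leaf v) → ∃ λ k → 1 ≤ k

  -- new e s is the new vertex on e next to its end s: with v = end e s it is
  -- v_e when e is not a loop, and one of v_e¹, v_e² when e is a loop.
  data S₂-Vertex (α : LeafFunction) : Set where
    old  : ∀ v → .(¬ Leaf v) → S₂-Vertex α
    copy : ∀ v → .(ℓ : Leaf v) → Fin (proj₁ (α v ℓ)) → S₂-Vertex α
    new  : Fin size → Bool → S₂-Vertex α

  data S₂-Edge (α : LeafFunction) : Set where
    middle  : Fin size → S₂-Edge α
    outer   : ∀ e s → .(¬ Leaf (end e s)) → S₂-Edge α
    pendant : ∀ e s → .(ℓ : Leaf (end e s)) → Fin (proj₁ (α (end e s) ℓ)) →
              S₂-Edge α

  S₂ : LeafFunction → Multigraph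
  S₂ α = record { V = S₂-Vertex α ; E = S₂-Edge α ; end = ends }
    where
    ends : S₂-Edge α → Bool → S₂-Vertex α
    ends (middle e)        s     = new e s
    ends (outer e s _)     false = new e s
    ends (outer e s ¬ℓ)    true  = old (end e s) ¬ℓ
    ends (pendant e s _ _) false = new e s
    ends (pendant e s ℓ i) true  = copy (end e s) ℓ i

  Vⁿ Vᵒ : (α : LeafFunction) → Sub (S₂-Vertex α)
  Vⁿ α (old _ _)    = false
  Vⁿ α (copy _ _ _) = false
  Vⁿ α (new _ _)    = true
  Vᵒ α x = not (Vⁿ α x)

TwoSubdivided : Multigraph → Set
TwoSubdivided K =
  ∃ λ H → NoIsolatedVertex ⟦ H ⟧ × ∃ λ (α : LeafFunction H) → K ≅ S₂ H α

module _ (H : FinGraph) where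
  open FinGraph H

  record Subgraph : Set where
    field
      VQ     : Sub (Fin order)
      EQ     : Sub (Fin size)
      closed : ∀ e → e ∈ EQ → ∀ s → end e s ∈ VQ

  -- The arc of e leads from end e (o e) to end e (not (o e)); o is irrelevant
  -- outside F.
  module Oriented (F : Sub (Fin size)) (o : Fin size → Bool) where

    tail head : Fin size → Fin order
    tail e = end e (o e)
    head e = end e (not (o e))

    d⁺ d⁻ : Fin order → ℕ
    d⁺ v = # (λ e → F e ∧ ⌊ tail e ≟ v ⌋)
    d⁻ v = # (λ e → F e ∧ ⌊ head e ≟ v ⌋)

    DirectedWalk : Fin order → List (Fin size) → Fin order → Set
    DirectedWalk u []       w = u ≡ w
    DirectedWalk u (e ∷ es) w = e ∈ F × tail e ≡ u × DirectedWalk (head e) es w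

    -- No vertex is left twice and none is entered twice, i.e. the vertices are
    -- pairwise distinct except that the path may return to its initial vertex
    -- at its end.  The closed case is needed: at a single vertex with two
    -- loops, one loop is a good subgraph and the other one is the path.
    record OrientedPathFrom (u : Fin order) : Set where
      field
        arcs         : List (Fin size)
        final        : Fin order
        walk         : DirectedWalk u arcs final
        unique-tails : Unique (map tail arcs)
        unique-heads : Unique (map head arcs)

      Inner : Fin order → Set
      Inner x = x ∈ˡ drop 1 (map tail arcs)

  record Good (Q : Subgraph) : Set where
    open Subgraph Q
    field
      nonempty    : ∃ λ v → v ∈ VQ
      no-isolated : ∀ v → v ∈ VQ → ∃ λ e → e ∈ EQ × Incident ⟦ H ⟧ e v

      F        : Sub (Fin size)
      F-lower  : ∀ e → e ∉ EQ → (∃ λ v → v ∈ VQ × Incident ⟦ H ⟧ e v) → e ∈ F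
      F-upper  : ∀ e → e ∈ F → e ∉ EQ
      o        : Fin size → Bool

    open Oriented F o public
    open OrientedPathFrom public

    field
      path : (x : Σ (Fin order) (_∈ VQ)) → OrientedPathFrom (proj₁ x)

      partition : ∀ e → e ∈ F → ∃! _≡_ λ x → e ∈ˡ arcs (path x)

      initial-d⁺ : ∀ v → v ∈ VQ → d⁺ v ≡ 1
      initial-d⁻ : ∀ v → v ∈ VQ → d⁻ v + degreeIn H EQ v + 1 ≡ degree H v

      inner-d⁺ : ∀ x y → Inner (path y) x → d⁺ x ≡ 1
      inner-d⁻ : ∀ x y → Inner (path y) x → d⁻ x + 1 ≡ degree H x

      final-d⁻ : ∀ y → d⁻ (final (path y)) < degree H (final (path y))

  HasGoodSubgraph : Set
  HasGoodSubgraph = ∃ Good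

{-# OPTIONS --safe #-}
-- A DP-pair of a spanning subgraph of S₂(H) amounts to a labelling of the darts (edge-ends) and
-- vertices of H.  The original pair labels all darts true.  An edge labelled false at both ends
-- has a superfluous middle edge in S₂(H); such edges form a good subgraph, the edges with two
-- different labels being its arcs, and conversely a good subgraph prescribes such a labelling.
-- If no edge is false at both ends, a pigeonhole argument shows that the vertices whose label
-- differs from the original one lie on directed cycles that are whole components of H and that no
-- edge of S₂(H) can be spared.  So S₂(H) is minimal exactly when H has no good subgraph, and then
-- a second DP-pair exists only if the connected graph H is a cycle, of length at most three since
-- the middle edge of a path on four vertices of a longer cycle is a good subgraph.
-- Finally, in a DP-pair with an inclusion-minimal edge set the edges between D and P form stars;
-- contracting the stars exhibits the graph as an S₂(H).
module Submission where

open import Data.Bool using (Bool; true; false; not; _∧_; _∨_; _xor_; T; if_then_else_)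
open import Data.Bool.Properties using (T-irrelevant; not-involutive; T?; ¬-not) renaming (_≟_ to _≟ᵇ_)
open import Data.Empty using (⊥; ⊥-elim)
open import Data.Fin using (Fin; zero; suc; toℕ; fromℕ<; remQuot; _≟_)
open import Data.Fin.Properties using (any?; all?; injective⇒≤; +↔⊎; *↔×; toℕ<n; toℕ-injective; toℕ-fromℕ<)
open import Data.List using (List; []; _∷_; map; drop)
open import Data.List.Membership.Propositional using () renaming (_∈_ to _∈ˡ_)
open import Data.List.Membership.Propositional.Properties using (∈-map⁺)
open import Data.List.Relation.Unary.Any using (here; there)
open import Data.List.Relation.Unary.AllPairs using ([]; _∷_)
open import Data.List.Relation.Unary.Unique.Propositional using (Unique)
open import Data.Nat using (ℕ; zero; suc; _+_; _*_; _≤_; _<_; z≤n; s≤s; NonZero)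
open import Data.Nat.DivMod using (_mod_)
open import Data.Product using (Σ; ∃; ∃₂; ∃!; _×_; _,_; proj₁; proj₂)
open import Data.Product.Properties using (≡-dec; ,-injective)
open import Data.Sum using (_⊎_; inj₁; inj₂; [_,_]′)
open import Data.Sum.Function.Propositional using (_⊎-cong_)
open import Data.Unit using (⊤; tt)
open import Function using (_∘_; id; case_of_)
open import Function.Bundles using (_↔_; Inverse; _⇔_; mk⇔; mk↔ₛ′; mk⤖)
open import Function.Construct.Composition using (_↔-∘_)
open import Function.Construct.Identity using (↔-id)
open import Function.Construct.Symmetry using (↔-sym)
open import Function.Definitions using (Injective)
open import Function.Properties.Bijection using (⤖⇒↔)
open import Relation.Binary.Construct.Closure.ReflexiveTransitive using (Star; ε; _◅_)
open import Relation.Binary.PropositionalEquality using (_≡_; _≢_; refl; sym; trans; cong; cong₂; subst)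
open import Relation.Nullary using (¬_; Dec; yes; no; recompute)
open import Relation.Nullary.Decidable using (⌊_⌋; toWitness; fromWitness; decidable-stable; _×-dec_; _⊎-dec_; ¬?)
import Data.Empty.Irrelevant as Irr
import Data.List.Relation.Unary.All as All
import Data.Nat.Properties as ℕ
open import Defs

-- Labels suffice because a new vertex of S₂(H) has two sides: the middle edge, and the old vertex
-- or the copies at its end of the edge. A new vertex in the paired-dominating set finds its partner
-- on one side and its dominator on the other, so every condition on a DP-pair becomes local to one
-- edge or one vertex of H.
--
-- The delicate construction is to cut the arcs into paths starting in Q. A vertex is left by at
-- most one arc but may be entered by several, so arcs merge, and a directed cycle avoiding Q might
-- be covered by no path from Q. Restricting to arcs from which Q can be reached excludes such
-- cycles: each step back along a selected arc increases the forward distance to Q, which is bounded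
-- by the number of vertices, so the search backwards must end in Q.
--
-- Stars arise because an edge between D and P can be deleted as soon as each of its two ends has
-- another such edge.

-- Booleans, bijections and counting

T⇒≡ : ∀ {b} → T b → b ≡ true
T⇒≡ {true} _ = refl

≡⇒T : ∀ {b} → b ≡ true → T b
≡⇒T refl = tt

¬T⇒≡ : ∀ {b} → ¬ T b → b ≡ false
¬T⇒≡ {false} _ = refl
¬T⇒≡ {true}  f = ⊥-elim (f tt)

≡⇒¬T : ∀ {b} → b ≡ false → ¬ T b
≡⇒¬T refl ()

true≢false : ∀ {b} → b ≡ true → b ≡ false → ⊥
true≢false refl ()

true⊎false : ∀ b → b ≡ true ⊎ b ≡ false
true⊎false true  = inj₁ refl
true⊎false false = inj₂ refl

≡⊎≡not : ∀ s t → s ≡ t ⊎ s ≡ not t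
≡⊎≡not false false = inj₁ refl
≡⊎≡not false true  = inj₂ refl
≡⊎≡not true  false = inj₂ refl
≡⊎≡not true  true  = inj₁ refl

not-true : ∀ {b} → not b ≡ true → b ≡ false
not-true {false} _ = refl

s≢not-s : ∀ s → s ≢ not s
s≢not-s false ()
s≢not-s true  ()

∧-split : ∀ {a b} → a ∧ b ≡ true → a ≡ true × b ≡ true
∧-split {true} {true} _ = refl , refl

∧-join : ∀ {a b} → a ≡ true → b ≡ true → a ∧ b ≡ true
∧-join refl refl = refl

⌊⌋⇒ : ∀ {A : Set} (a? : Dec A) → ⌊ a? ⌋ ≡ true → A
⌊⌋⇒ a? eq = toWitness {a? = a?} (≡⇒T eq)

⇒⌊⌋ : ∀ {A : Set} (a? : Dec A) → A → ⌊ a? ⌋ ≡ true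
⇒⌊⌋ a? a = T⇒≡ (fromWitness {a? = a?} a)

⇒⌊⌋-no : ∀ {A : Set} (a? : Dec A) → ¬ A → ⌊ a? ⌋ ≡ false
⇒⌊⌋-no a? ¬a = ¬T⇒≡ (¬a ∘ toWitness {a? = a?})

uip : ∀ {A : Set} {x y : A} (p q : x ≡ y) → p ≡ q
uip refl refl = refl

bijective : ∀ {A B : Set} (f : A → B) → (∀ {x y} → f x ≡ f y → x ≡ y) →
            (∀ y → ∃ λ x → f x ≡ y) → A ↔ B
bijective f inj surj = ⤖⇒↔ (mk⤖ (inj , λ y → proj₁ (surj y) , λ { refl → proj₂ (surj y) }))

to-injective : ∀ {A B : Set} (f : A ↔ B) {x y : A} → Inverse.to f x ≡ Inverse.to f y → x ≡ y
to-injective f eq = trans (sym (Inverse.strictlyInverseʳ f _))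
  (trans (cong (Inverse.from f) eq) (Inverse.strictlyInverseʳ f _))

from-injective : ∀ {A B : Set} (f : A ↔ B) {x y : B} → Inverse.from f x ≡ Inverse.from f y → x ≡ y
from-injective f eq = trans (sym (Inverse.strictlyInverseˡ f _))
  (trans (cong (Inverse.to f) eq) (Inverse.strictlyInverseˡ f _))

card-≤ : ∀ {m n} {A B : Set} → Fin m ↔ A → Fin n ↔ B →
         (f : A → B) → (∀ {x y} → f x ≡ f y → x ≡ y) → m ≤ n
card-≤ a b f inj = injective⇒≤ {f = λ i → Inverse.from b (f (Inverse.to a i))} λ eq →
  to-injective a (inj (from-injective b eq))

card-≡ : ∀ {m n} {A B : Set} → Fin m ↔ A → Fin n ↔ B → A ↔ B → m ≡ n
card-≡ a b f = ℕ.≤-antisym (card-≤ a b (Inverse.to f) (to-injective f))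
                           (card-≤ b a (Inverse.from f) (from-injective f))

Fin1↔⊤ : Fin 1 ↔ ⊤
Fin1↔⊤ = mk↔ₛ′ (λ _ → tt) (λ _ → zero) (λ _ → refl) λ { zero → refl }

card-⊎ : ∀ {m n} {A B : Set} → Fin m ↔ A → Fin n ↔ B → Fin (m + n) ↔ (A ⊎ B)
card-⊎ a b = (a ⊎-cong b) ↔-∘ +↔⊎

card-1 : ∀ {n} {A : Set} → Fin n ↔ A → (a : A) → (∀ b → b ≡ a) → n ≡ 1
card-1 i a u = card-≡ i Fin1↔⊤ (mk↔ₛ′ (λ _ → tt) (λ _ → a) (λ _ → refl) (λ b → sym (u b)))

card-1⇒element : ∀ {n} {A : Set} → Fin n ↔ A → n ≡ 1 → A
card-1⇒element i refl = Inverse.to i zero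

card-1⇒unique : ∀ {n} {A : Set} → Fin n ↔ A → n ≡ 1 → (a b : A) → a ≡ b
card-1⇒unique i refl a b = from-injective i (Fin1-unique _ _)
  where
  Fin1-unique : (x y : Fin 1) → x ≡ y
  Fin1-unique zero zero = refl

-- A missed value `y`, adjoined as the image of a new point, would give an injection of
-- `Fin (suc n)` into `Fin n`.
injective⇒surjective : ∀ {n} (f : Fin n → Fin n) → (∀ {x y} → f x ≡ f y → x ≡ y) →
                       ∀ y → ∃ λ x → f x ≡ y
injective⇒surjective {n} f inj y with any? (λ x → f x ≟ y)
... | yes p = p
... | no ¬p = ⊥-elim (ℕ.1+n≰n (injective⇒≤ {f = g} g-inj))
  where
  g : Fin (suc n) → Fin n
  g zero    = y
  g (suc x) = f x
  g-inj : Injective _≡_ _≡_ g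
  g-inj {zero}  {zero}  _  = refl
  g-inj {zero}  {suc j} eq = ⊥-elim (¬p (j , sym eq))
  g-inj {suc i} {zero}  eq = ⊥-elim (¬p (i , eq))
  g-inj {suc i} {suc j} eq = cong suc (inj eq)

-- Turns statements about `#_` into statements about types: degrees and arc counts are compared
-- below by injections and bijections, with hardly any arithmetic.
count↔ : ∀ {n} (S : Sub (Fin n)) → Fin (# S) ↔ ∃ λ i → S i ≡ true
count↔ {zero}  S = mk↔ₛ′ (λ ()) (λ ()) (λ ()) (λ ())
count↔ {suc n} S with S zero in S₀ | count↔ (S ∘ suc)
... | false | c = mk↔ₛ′ f g f∘g λ i → Inverse.strictlyInverseʳ c i
  where
  f : Fin (# (S ∘ suc)) → ∃ λ i → S i ≡ true
  f i = suc (proj₁ (Inverse.to c i)) , proj₂ (Inverse.to c i)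
  g : (∃ λ i → S i ≡ true) → Fin (# (S ∘ suc))
  g (zero  , p) = ⊥-elim (true≢false p S₀)
  g (suc i , p) = Inverse.from c (i , p)
  f∘g : ∀ x → f (g x) ≡ x
  f∘g (zero  , p) = ⊥-elim (true≢false p S₀)
  f∘g (suc i , p) rewrite Inverse.strictlyInverseˡ c (i , p) = refl
... | true  | c = mk↔ₛ′ f g f∘g g∘f
  where
  f : Fin (suc (# (S ∘ suc))) → ∃ λ i → S i ≡ true
  f zero    = zero , S₀
  f (suc i) = suc (proj₁ (Inverse.to c i)) , proj₂ (Inverse.to c i)
  g : (∃ λ i → S i ≡ true) → Fin (suc (# (S ∘ suc)))
  g (zero  , p) = zero
  g (suc i , p) = suc (Inverse.from c (i , p))
  f∘g : ∀ x → f (g x) ≡ x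
  f∘g (zero  , p) = cong (zero ,_) (uip _ _)
  f∘g (suc i , p) rewrite Inverse.strictlyInverseˡ c (i , p) = refl
  g∘f : ∀ x → g (f x) ≡ x
  g∘f zero    = refl
  g∘f (suc i) = cong suc (Inverse.strictlyInverseʳ c i)

∃true-≡ : ∀ {A : Set} {S : Sub A} {x y : ∃ λ i → S i ≡ true} → proj₁ x ≡ proj₁ y → x ≡ y
∃true-≡ {x = i , p} {y = .i , q} refl = cong (i ,_) (uip p q)

Σ-T-≡ : ∀ {A : Set} {S : Sub A} {x y : A} {p : x ∈ S} {q : y ∈ S} → x ≡ y → (x , p) ≡ (y , q)
Σ-T-≡ {x = x} refl = cong (x ,_) (T-irrelevant _ _)

#-strict : ∀ {n} (S S′ : Sub (Fin n)) → (∀ i → S i ≡ true → S′ i ≡ true) →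
           ∀ j → S j ≡ false → S′ j ≡ true → # S < # S′
#-strict S S′ sub j ¬Sj S′j = subst (_≤ # S′) (ℕ.+-comm (# S) 1)
  (card-≤ (card-⊎ (count↔ S) Fin1↔⊤) (count↔ S′) f f-inj)
  where
  f : (∃ λ i → S i ≡ true) ⊎ ⊤ → ∃ λ i → S′ i ≡ true
  f (inj₁ (i , p)) = i , sub i p
  f (inj₂ _)       = j , S′j
  f-inj : ∀ {x y} → f x ≡ f y → x ≡ y
  f-inj {inj₁ _} {inj₁ _} eq = cong inj₁ (∃true-≡ (cong proj₁ eq))
  f-inj {inj₁ (i , p)} {inj₂ _} eq = ⊥-elim (true≢false p (trans (cong (S ∘ proj₁) eq) ¬Sj))
  f-inj {inj₂ _} {inj₁ (i , p)} eq = ⊥-elim (true≢false p (trans (cong (S ∘ proj₁) (sym eq)) ¬Sj))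
  f-inj {inj₂ _} {inj₂ _} eq = refl

-- Darts and degrees

module _ (H : FinGraph) where
  open FinGraph H

  -- Edge-ends rather than edges are collected, so a loop has two darts at its vertex and
  -- contributes 2 to the degree.
  Dart : Sub (Fin size) → Fin order → Set
  Dart F v = ∃₂ λ e s → F e ≡ true × end e s ≡ v

  dart-≡ : ∀ {F v} {d d′ : Dart F v} → proj₁ d ≡ proj₁ d′ → proj₁ (proj₂ d) ≡ proj₁ (proj₂ d′) →
           d ≡ d′
  dart-≡ {d = e , s , p , q} {.e , .s , p′ , q′} refl refl =
    cong₂ (λ p q → e , s , p , q) (uip p p′) (uip q q′)

  degreeIn↔ : ∀ F v → Fin (degreeIn H F v) ↔ Dart F v
  degreeIn↔ F v = mk↔ₛ′ to from to∘from from∘to ↔-∘ card-⊎ (count↔ _) (count↔ _)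
    where
    at : Bool → Sub (Fin size)
    at s e = F e ∧ ⌊ end e s ≟ v ⌋
    to : (∃ λ e → at false e ≡ true) ⊎ (∃ λ e → at true e ≡ true) → Dart F v
    to (inj₁ (e , p)) = e , false , proj₁ (∧-split p) , ⌊⌋⇒ (_ ≟ _) (proj₂ (∧-split {F e} p))
    to (inj₂ (e , p)) = e , true  , proj₁ (∧-split p) , ⌊⌋⇒ (_ ≟ _) (proj₂ (∧-split {F e} p))
    from : Dart F v → (∃ λ e → at false e ≡ true) ⊎ (∃ λ e → at true e ≡ true)
    from (e , false , p , q) = inj₁ (e , ∧-join p (⇒⌊⌋ (_ ≟ _) q))
    from (e , true  , p , q) = inj₂ (e , ∧-join p (⇒⌊⌋ (_ ≟ _) q))
    to∘from : ∀ d → to (from d) ≡ d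
    to∘from (e , false , p , q) = dart-≡ refl refl
    to∘from (e , true  , p , q) = dart-≡ refl refl
    from∘to : ∀ x → from (to x) ≡ x
    from∘to (inj₁ _) = cong inj₁ (∃true-≡ refl)
    from∘to (inj₂ _) = cong inj₂ (∃true-≡ refl)

  degree↔ : ∀ v → Fin (degree H v) ↔ Dart everything v
  degree↔ = degreeIn↔ everything

  leaf⇒unique-dart : ∀ {v} → Leaf H v → ∀ {e s e′ s′} → end e s ≡ v → end e′ s′ ≡ v →
                     e ≡ e′ × s ≡ s′
  leaf⇒unique-dart {v} ℓ {e} {s} {e′} {s′} p q
    with card-1⇒unique (degree↔ v) ℓ (e , s , refl , p) (e′ , s′ , refl , q)
  ... | refl = refl , refl

  -- The given dart excludes degree zero, and degree one would follow if no entry of the enumeration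
  -- of darts differed from it.
  ¬leaf⇒other-dart : ∀ {v} → ¬ Leaf H v → ∀ e s → end e s ≡ v →
                     ∃₂ λ e′ s′ → end e′ s′ ≡ v × ¬ (e′ ≡ e × s′ ≡ s)
  ¬leaf⇒other-dart {v} ¬ℓ e s p
    with any? (λ i → let e′ , s′ , _ = Inverse.to (degree↔ v) i in ¬? (e′ ≟ e ×-dec s′ ≟ᵇ s))
  ... | yes (i , q) with Inverse.to (degree↔ v) i
  ...   | e′ , s′ , _ , p′ = e′ , s′ , p′ , q
  ¬leaf⇒other-dart {v} ¬ℓ e s p | no none = ⊥-elim (¬ℓ (card-1 (degree↔ v) (e , s , refl , p) same))
    where
    same : (b : Dart everything v) → b ≡ (e , s , refl , p)
    same b with proj₁ b ≟ e ×-dec proj₁ (proj₂ b) ≟ᵇ s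
    ... | yes (x , y) = dart-≡ x y
    ... | no ¬xy = ⊥-elim (none (Inverse.from (degree↔ v) b ,
      subst (λ d → ¬ (proj₁ d ≡ e × proj₁ (proj₂ d) ≡ s)) (sym (Inverse.strictlyInverseˡ (degree↔ v) b)) ¬xy))

  dart? : (B : Fin size → Bool → Bool) → ∀ v →
          (∃₂ λ e s → end e s ≡ v × B e s ≡ true) ⊎ (∀ e s → end e s ≡ v → B e s ≡ false)
  dart? B v with any? (λ e → (end e false ≟ v ×-dec B e false ≟ᵇ true)
                         ⊎-dec (end e true ≟ v ×-dec B e true ≟ᵇ true))
  ... | yes (e , inj₁ (p , q)) = inj₁ (e , false , p , q)
  ... | yes (e , inj₂ (p , q)) = inj₁ (e , true  , p , q)
  ... | no none = inj₂ λ
    { e false p → ¬-not λ q → none (e , inj₁ (p , q))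
    ; e true  p → ¬-not λ q → none (e , inj₂ (p , q)) }

-- DP-pairs as Boolean splits over an edge set

-- (V ∖ P, P) is a DP-pair of the spanning subgraph with edge set F.
record DPSplit (G : Multigraph) (F : Sub (Multigraph.E G)) (P : Sub (Multigraph.V G)) : Set where
  open Multigraph G
  field
    dominatedᴰ : ∀ v → P v ≡ true →
                 ∃₂ λ e s → F e ≡ true × end e s ≡ v × P (end e (not s)) ≡ false
    dominatedᴾ : ∀ v → P v ≡ false →
                 ∃₂ λ e s → F e ≡ true × end e s ≡ v × P (end e (not s)) ≡ true
    M          : Sub E
    M⊆F        : ∀ e → M e ≡ true → F e ≡ true
    M-ends     : ∀ e → M e ≡ true → ∀ s → P (end e s) ≡ true
    M-loopless : ∀ e → M e ≡ true → ¬ Loop G e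
    M-covers   : ∀ v → P v ≡ true → ∃₂ λ e s → M e ≡ true × end e s ≡ v
    M-unique   : ∀ e e′ s s′ → M e ≡ true → M e′ ≡ true → end e s ≡ end e′ s′ → e ≡ e′

-- Disjointness and covering determine `D` from `P`, which is why `DPSplit` records `P` alone.
DPPair⇒complement : ∀ {G D P} → DPPair G D P → ∀ v → D v ≡ not (P v)
DPPair⇒complement {P = P} (disj , cover , _) v with P v in Pv
... | true  = ¬T⇒≡ λ d → disj v (d , ≡⇒T Pv)
... | false = T⇒≡ ([ id , (λ p → ⊥-elim (≡⇒¬T Pv p)) ]′ (cover v))

DPPair⇒DPSplit : ∀ {G D P} → DPPair G D P → DPSplit G everything P
DPPair⇒DPSplit {G} {D} {P} dp@(_ , _ , domD , domP , M , M-in , M-cov) = record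
  { dominatedᴰ = λ v Pv → case domD v (≡⇒¬T (trans (D≡ v) (cong not Pv))) of
      λ { (u , Du , e , s , p , q) → e , s , refl , p ,
          trans (cong P q) (not-true (trans (sym (D≡ u)) (T⇒≡ Du))) }
  ; dominatedᴾ = λ v Pv → case domP v (≡⇒¬T Pv) of
      λ { (u , Pu , e , s , p , q) → e , s , refl , p , trans (cong P q) (T⇒≡ Pu) }
  ; M          = M
  ; M⊆F        = λ _ _ → refl
  ; M-ends     = λ e m s → T⇒≡ (proj₁ (M-in e (≡⇒T m)) s)
  ; M-loopless = λ e m → proj₂ (M-in e (≡⇒T m))
  ; M-covers   = λ v Pv → case M-cov v (≡⇒T Pv) of
      λ { (e , (m , s , p) , _) → e , s , T⇒≡ m , p }
  ; M-unique   = λ e e′ s s′ m m′ eq → case M-cov (end e s) (proj₁ (M-in e (≡⇒T m)) s) of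
      λ { (_ , _ , u) → trans (sym (u (≡⇒T m , s , refl))) (u (≡⇒T m′ , s′ , sym eq)) }
  }
  where
  open Multigraph G
  D≡ = DPPair⇒complement dp

DPSplit⇒DPPair : ∀ {G P} → DPSplit G everything P → DPPair G (not ∘ P) P
DPSplit⇒DPPair {G} {P} sp = disj , cover , domD , domP , M , M-in , M-cov
  where
  open Multigraph G
  open DPSplit sp
  disj : ∀ v → ¬ (T (not (P v)) × T (P v))
  disj v with P v
  ... | true  = proj₁
  ... | false = proj₂
  cover : ∀ v → T (not (P v)) ⊎ T (P v)
  cover v with P v
  ... | true  = inj₂ tt
  ... | false = inj₁ tt
  ∉⇒ : ∀ v → v ∉ not ∘ P → P v ≡ true
  ∉⇒ v n with P v
  ... | true  = refl
  ... | false = ⊥-elim (n tt)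
  domD : Dominating G (not ∘ P)
  domD v v∉ with dominatedᴰ v (∉⇒ v v∉)
  ... | e , s , _ , p , q = end e (not s) , ≡⇒T (cong not q) , e , s , p , refl
  domP : Dominating G P
  domP v v∉ with dominatedᴾ v (¬T⇒≡ v∉)
  ... | e , s , _ , p , q = end e (not s) , ≡⇒T q , e , s , p , refl
  M-in : ∀ e → e ∈ M → (∀ s → end e s ∈ P) × ¬ Loop G e
  M-in e m = (λ s → ≡⇒T (M-ends e (T⇒≡ m) s)) , M-loopless e (T⇒≡ m)
  M-cov : ∀ v → v ∈ P → ∃! _≡_ λ e → e ∈ M × Incident G e v
  M-cov v p with M-covers v (T⇒≡ p)
  ... | e , s , m , q = e , (≡⇒T m , s , q) ,
    λ { (m′ , s′ , q′) → M-unique e _ s s′ m (T⇒≡ m′) (trans q (sym q′)) }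

spanning-DPSplit⇒ : ∀ {G F P} → DPSplit (spanning G F) everything P → DPSplit G F P
spanning-DPSplit⇒ {G} {F} {P} sp = record
  { dominatedᴰ = λ v Pv → case S.dominatedᴰ v Pv of
      λ { ((e , f) , s , _ , p , q) → e , s , T⇒≡ f , p , q }
  ; dominatedᴾ = λ v Pv → case S.dominatedᴾ v Pv of
      λ { ((e , f) , s , _ , p , q) → e , s , T⇒≡ f , p , q }
  ; M          = M′
  ; M⊆F        = λ e m → T⇒≡ (proj₁ (M′⇒ e m))
  ; M-ends     = λ e m → S.M-ends _ (proj₂ (M′⇒ e m))
  ; M-loopless = λ e m → S.M-loopless _ (proj₂ (M′⇒ e m))
  ; M-covers   = λ v Pv → case S.M-covers v Pv of
      λ { ((e , f) , s , m , p) → e , s , ⇒M′ e f m , p }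
  ; M-unique   = λ e e′ s s′ m m′ eq →
      cong proj₁ (S.M-unique _ _ s s′ (proj₂ (M′⇒ e m)) (proj₂ (M′⇒ e′ m′)) eq)
  }
  where
  open Multigraph G
  module S = DPSplit sp
  -- The given matching lives on edges paired with a proof of membership in `F`; it is extended by
  -- false outside `F`.
  M′ : Sub E
  M′ e with T? (F e)
  ... | yes f = S.M (e , f)
  ... | no  _ = false
  M′⇒ : ∀ e → M′ e ≡ true → Σ (e ∈ F) λ f → S.M (e , f) ≡ true
  M′⇒ e m with T? (F e)
  ... | yes f = f , m
  ⇒M′ : ∀ e (f : e ∈ F) → S.M (e , f) ≡ true → M′ e ≡ true
  ⇒M′ e f m with T? (F e)
  ... | yes f′ = subst (λ f → S.M (e , f) ≡ true) (T-irrelevant f f′) m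
  ... | no ¬f  = ⊥-elim (¬f f)

⇒spanning-DPSplit : ∀ {G F P} → DPSplit G F P → DPSplit (spanning G F) everything P
⇒spanning-DPSplit {G} {F} {P} sp = record
  { dominatedᴰ = λ v Pv → case dominatedᴰ v Pv of
      λ { (e , s , f , p , q) → (e , ≡⇒T f) , s , refl , p , q }
  ; dominatedᴾ = λ v Pv → case dominatedᴾ v Pv of
      λ { (e , s , f , p , q) → (e , ≡⇒T f) , s , refl , p , q }
  ; M          = M ∘ proj₁
  ; M⊆F        = λ _ _ → refl
  ; M-ends     = λ e → M-ends (proj₁ e)
  ; M-loopless = λ e → M-loopless (proj₁ e)
  ; M-covers   = λ v Pv → case M-covers v Pv of
      λ { (e , s , m , p) → (e , ≡⇒T (M⊆F e m)) , s , m , p }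
  ; M-unique   = λ { (e , f) (e′ , f′) s s′ m m′ eq → case M-unique e e′ s s′ m m′ eq of
      λ { refl → cong (e ,_) (T-irrelevant f f′) } }
  }
  where open DPSplit sp

weaken-DPSplit : ∀ {G F F′ P} → (∀ e → F e ≡ true → F′ e ≡ true) → DPSplit G F P → DPSplit G F′ P
weaken-DPSplit sub sp = record
  { dominatedᴰ = λ v Pv → case dominatedᴰ v Pv of
      λ { (e , s , f , p , q) → e , s , sub e f , p , q }
  ; dominatedᴾ = λ v Pv → case dominatedᴾ v Pv of
      λ { (e , s , f , p , q) → e , s , sub e f , p , q }
  ; M = M ; M⊆F = λ e m → sub e (M⊆F e m) ; M-ends = M-ends
  ; M-loopless = M-loopless ; M-covers = M-covers ; M-unique = M-unique
  }
  where open DPSplit sp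

DPPair-spanning⇒DPSplit : ∀ {G F D P} → DPPair (spanning G F) D P → DPSplit G F P
DPPair-spanning⇒DPSplit = spanning-DPSplit⇒ ∘ DPPair⇒DPSplit

DPSplit⇒DPDP-spanning : ∀ {G F P} → DPSplit G F P → DPDP (spanning G F)
DPSplit⇒DPDP-spanning sp = _ , _ , DPSplit⇒DPPair (⇒spanning-DPSplit sp)

-- Isomorphisms and transport of DP-pairs

≅-sym : ∀ {G G′} → G ≅ G′ → G′ ≅ G
≅-sym {G} {G′} φ = record
  { onV = ↔-sym onV
  ; onE = ↔-sym onE
  ; preserves-ends = λ e → pe e (preserves-ends (Inverse.from onE e))
  }
  where
  open _≅_ φ
  module G  = Multigraph G
  module G′ = Multigraph G′
  toE   = Inverse.to onE
  fromE = Inverse.from onE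
  toV   = Inverse.to onV
  fromV = Inverse.from onV
  back : ∀ e {s x} → G′.end (toE (fromE e)) s ≡ toV x → x ≡ fromV (G′.end e s)
  back e {s} {x} eq = trans (sym (Inverse.strictlyInverseʳ onV x))
    (cong fromV (trans (sym eq) (cong (λ e → G′.end e s) (Inverse.strictlyInverseˡ onE e))))
  pe : ∀ e →
       (∀ s → G′.end (toE (fromE e)) s ≡ toV (G.end (fromE e) s)) ⊎
       (∀ s → G′.end (toE (fromE e)) s ≡ toV (G.end (fromE e) (not s))) →
       (∀ s → G.end (fromE e) s ≡ fromV (G′.end e s)) ⊎
       (∀ s → G.end (fromE e) s ≡ fromV (G′.end e (not s)))
  pe e (inj₁ f) = inj₁ λ s → back e (f s)
  pe e (inj₂ f) = inj₂ λ s →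
    back e (trans (f (not s)) (cong (toV ∘ G.end (fromE e)) (not-involutive s)))

≅-trans : ∀ {G G′ G″} → G ≅ G′ → G′ ≅ G″ → G ≅ G″
≅-trans {G} {G′} {G″} φ ψ = record
  { onV = ψ.onV ↔-∘ φ.onV
  ; onE = ψ.onE ↔-∘ φ.onE
  ; preserves-ends = λ e → pe e (φ.preserves-ends e) (ψ.preserves-ends (Inverse.to φ.onE e))
  }
  where
  module φ = _≅_ φ
  module ψ = _≅_ ψ
  module G  = Multigraph G
  module G′ = Multigraph G′
  module G″ = Multigraph G″
  toV₁ = Inverse.to φ.onV
  toV₂ = Inverse.to ψ.onV
  toE₁ = Inverse.to φ.onE
  toE₂ = Inverse.to ψ.onE
  pe : ∀ e →
       (∀ s → G′.end (toE₁ e) s ≡ toV₁ (G.end e s)) ⊎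
       (∀ s → G′.end (toE₁ e) s ≡ toV₁ (G.end e (not s))) →
       (∀ s → G″.end (toE₂ (toE₁ e)) s ≡ toV₂ (G′.end (toE₁ e) s)) ⊎
       (∀ s → G″.end (toE₂ (toE₁ e)) s ≡ toV₂ (G′.end (toE₁ e) (not s))) →
       (∀ s → G″.end (toE₂ (toE₁ e)) s ≡ toV₂ (toV₁ (G.end e s))) ⊎
       (∀ s → G″.end (toE₂ (toE₁ e)) s ≡ toV₂ (toV₁ (G.end e (not s))))
  pe e (inj₁ f) (inj₁ g) = inj₁ λ s → trans (g s) (cong toV₂ (f s))
  pe e (inj₂ f) (inj₁ g) = inj₂ λ s → trans (g s) (cong toV₂ (f s))
  pe e (inj₁ f) (inj₂ g) = inj₂ λ s → trans (g s) (cong toV₂ (f (not s)))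
  pe e (inj₂ f) (inj₂ g) = inj₁ λ s → trans (g s) (cong toV₂ (trans (f (not s))
    (cong (toV₁ ∘ G.end e) (not-involutive s))))

≅-spanning-everything : ∀ {G} → G ≅ spanning G everything
≅-spanning-everything = record
  { onV = ↔-id _
  ; onE = mk↔ₛ′ (_, tt) proj₁ (λ _ → refl) (λ _ → refl)
  ; preserves-ends = λ _ → inj₁ λ _ → refl
  }

module _ {G G′ : Multigraph} (φ : G ≅ G′) where
  open _≅_ φ
  private
    module G  = Multigraph G
    module G′ = Multigraph G′

  -- An isomorphism may exchange the ends of an edge, so side `s` corresponds to some side `s′` of
  -- the image, found by cases.
  ≅-dart : ∀ e s → ∃ λ s′ → G′.end (Inverse.to onE e) s′ ≡ Inverse.to onV (G.end e s)
                          × G′.end (Inverse.to onE e) (not s′) ≡ Inverse.to onV (G.end e (not s))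
  ≅-dart e s with preserves-ends e
  ... | inj₁ f = s , f s , f (not s)
  ... | inj₂ f = not s , trans (f (not s)) (cong (Inverse.to onV ∘ G.end e) (not-involutive s)) ,
    trans (f (not (not s))) (cong (Inverse.to onV ∘ G.end e) (not-involutive (not s)))

  ≅-connected : Connected G → Connected G′
  ≅-connected con u v = subst₂′ (Inverse.strictlyInverseˡ onV u) (Inverse.strictlyInverseˡ onV v)
    (image (con (Inverse.from onV u) (Inverse.from onV v)))
    where
    subst₂′ : ∀ {a b c d} → a ≡ b → c ≡ d → Star (Adjacent G′) a c → Star (Adjacent G′) b d
    subst₂′ refl refl p = p
    image : ∀ {x y} → Star (Adjacent G) x y → Star (Adjacent G′) (Inverse.to onV x) (Inverse.to onV y)
    image ε = ε
    image ((e , s , refl , refl) ◅ p) with ≅-dart e s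
    ... | s′ , q , q′ = (Inverse.to onE e , s′ , q , q′) ◅ image p

module _ {G G′ : Multigraph} (φ : G ≅ G′) where
  open _≅_ φ
  private
    module G  = Multigraph G
    module G′ = Multigraph G′
    toV   = Inverse.to onV
    fromV = Inverse.from onV
    toE   = Inverse.to onE
    fromE = Inverse.from onE

  ≅-DPSplit : ∀ {F P} → DPSplit G F P → DPSplit G′ (F ∘ fromE) (P ∘ fromV)
  ≅-DPSplit {F} {P} sp = record
    { dominatedᴰ = λ v Pv → move v false (dominatedᴰ (fromV v) Pv)
    ; dominatedᴾ = λ v Pv → move v true (dominatedᴾ (fromV v) Pv)
    ; M          = M ∘ fromE
    ; M⊆F        = λ e → M⊆F (fromE e)
    ; M-ends     = λ e m s → case ≅-dart (≅-sym φ) e s of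
        λ { (s′ , q , _) → trans (cong P (sym q)) (M-ends (fromE e) m s′) }
    ; M-loopless = λ e m ℓ → M-loopless (fromE e) m (loop e ℓ)
    ; M-covers   = cov
    ; M-unique   = λ e e′ s s′ m m′ eq → case ≅-dart (≅-sym φ) e s of
        λ { (t , q , _) → case ≅-dart (≅-sym φ) e′ s′ of
        λ { (t′ , q′ , _) → from-injective onE (M-unique (fromE e) (fromE e′) t t′ m m′
              (trans q (trans (cong fromV eq) (sym q′)))) } }
    }
    where
    open DPSplit sp
    move : ∀ v b → (∃₂ λ e s → F e ≡ true × G.end e s ≡ fromV v × P (G.end e (not s)) ≡ b) →
           ∃₂ λ e s → F (fromE e) ≡ true × G′.end e s ≡ v × P (fromV (G′.end e (not s))) ≡ b
    move v b (e , s , f , p , q) with ≅-dart φ e s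
    ... | s′ , r , r′ = toE e , s′ , trans (cong F (Inverse.strictlyInverseʳ onE e)) f ,
      trans r (trans (cong toV p) (Inverse.strictlyInverseˡ onV v)) ,
      trans (cong (P ∘ fromV) r′) (trans (cong P (Inverse.strictlyInverseʳ onV _)) q)
    cov : ∀ v → P (fromV v) ≡ true → ∃₂ λ e s → M (fromE e) ≡ true × G′.end e s ≡ v
    cov v Pv with M-covers (fromV v) Pv
    ... | e , s , m , p with ≅-dart φ e s
    ...   | s′ , r , _ = toE e , s′ , trans (cong M (Inverse.strictlyInverseʳ onE e)) m ,
      trans r (trans (cong toV p) (Inverse.strictlyInverseˡ onV v))
    loop : ∀ e → Loop G′ e → Loop G (fromE e)
    loop e ℓ with ≅-dart (≅-sym φ) e false
    ... | false , q , q′ = trans q (trans (cong fromV ℓ) (sym q′))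
    ... | true  , q , q′ = trans q′ (trans (cong fromV (sym ℓ)) (sym q))

-- Minimality relative to an edge set of a fixed graph, with the missing edge named: smaller and
-- smaller edge sets can be compared without nesting `spanning`, whose edges are pairs.
MinimalSplit : (G : Multigraph) → Sub (Multigraph.E G) → Set
MinimalSplit G F = ∀ F′ → (∀ e → F′ e ≡ true → F e ≡ true) →
  ∀ e → F e ≡ true → F′ e ≡ false → ∀ P → ¬ DPSplit G F′ P

minimalDPDP⇒minimalSplit : ∀ {G} → MinimalDPDP G → MinimalSplit G everything
minimalDPDP⇒minimalSplit (_ , min) F′ _ e _ ¬f P sp =
  min F′ (e , ≡⇒¬T ¬f) (DPSplit⇒DPDP-spanning sp)

minimalSplit⇒minimalDPDP : ∀ {G P} → DPSplit G everything P → MinimalSplit G everything → MinimalDPDP G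
minimalSplit⇒minimalDPDP sp min = (_ , _ , DPSplit⇒DPPair sp) ,
  λ { F (e , e∉F) (_ , P , dp) →
      min F (λ _ _ → refl) e refl (¬T⇒≡ e∉F) P (DPPair-spanning⇒DPSplit dp) }

≅-minimalSplit : ∀ {G G′} → G ≅ G′ → MinimalSplit G everything → MinimalSplit G′ everything
≅-minimalSplit φ min F′ _ e _ ¬f P sp =
  min (F′ ∘ Inverse.to onE) (λ _ _ → refl) (Inverse.from onE e) refl
    (trans (cong F′ (Inverse.strictlyInverseˡ onE e)) ¬f) _ (≅-DPSplit (≅-sym φ) sp)
  where open _≅_ φ

-- Labellings of H and DP-pairs of S₂(H)

-- A paired-dominating set of S₂(H) with dominating complement, read on H: N e s says that
-- new e s belongs to it, X v that old v does.
record Labelling (H : FinGraph) : Set where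
  open FinGraph H
  field
    N : Fin size → Bool → Bool
    X : Fin order → Bool
    true-dart   : ∀ v → ∃₂ λ e s → end e s ≡ v × N e s ≡ true
    -- By `edge-true` a true dart at a vertex of `X` has a false far end, so its new vertex can only
    -- be matched with the old vertex, which has one partner.
    true-unique : ∀ e s e′ s′ → X (end e s) ≡ true → end e s ≡ end e′ s′ →
                  N e s ≡ true → N e′ s′ ≡ true → e ≡ e′ × s ≡ s′
    false-dart  : ∀ v → X v ≡ true → ∃₂ λ e s → end e s ≡ v × N e s ≡ false
    -- Of partner and dominator, one lies across the middle edge and the other towards `end e s`. At
    -- a leaf the latter is a copy, and `X` is false there by `X⇒¬leaf`.
    edge-true   : ∀ e s → N e s ≡ true → N e (not s) ≡ not (X (end e s))
    -- When both new vertices of an edge are outside the set, each can be dominated only by the old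
    -- vertex next to it.
    edge-false  : ∀ e s → N e s ≡ false → N e (not s) ≡ false → X (end e s) ≡ true

  mixed⇒X : ∀ e s → N e s ≡ true → N e (not s) ≡ false → X (end e s) ≡ true
  mixed⇒X e s p q with X (end e s) | edge-true e s p
  ... | true  | _ = refl
  ... | false | r = ⊥-elim (true≢false r q)

  X⇒mixed : ∀ e s → X (end e s) ≡ true → N e s ≡ true → N e (not s) ≡ false
  X⇒mixed e s x p = trans (edge-true e s p) (cong not x)

  -- A vertex of `X` has a true and a false dart, hence two darts.
  X⇒¬leaf : ∀ {v} → X v ≡ true → ¬ Leaf H v
  X⇒¬leaf {v} x ℓ with true-dart v | false-dart v x
  ... | e , s , p , n | e′ , s′ , p′ , n′ with leaf⇒unique-dart H ℓ {e} {s} {e′} {s′} p p′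
  ...   | refl , refl = true≢false n n′

HasFalseEdge : ∀ {H} → Labelling H → Set
HasFalseEdge L = ∃ λ e → ∀ s → Labelling.N L e s ≡ false

leaf? : (H : FinGraph) → ∀ v → Dec (Leaf H v)
leaf? H v = degree H v ℕ.≟ 1

first : ∀ {k} → 1 ≤ k → Fin k
first (s≤s _) = zero

module _ {H : FinGraph} (α : LeafFunction H) where
  open FinGraph H
  private module G = Multigraph (S₂ H α)

  projection : S₂-Vertex H α → Fin order
  projection (old v _)    = v
  projection (copy v _ _) = v
  projection (new e s)    = end e s

  -- Old vertices and copies are pairwise nonadjacent: every edge at one of them leads to a new
  -- vertex, whose dart of `H` is returned.
  old-edge : ∀ x t {y} → G.end x t ≡ y → Vⁿ H α y ≡ false →
             ∃₂ λ e s → end e s ≡ projection y × G.end x (not t) ≡ new e s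
  old-edge (outer e s _)     true refl _ = e , s , refl , refl
  old-edge (pendant e s _ _) true refl _ = e , s , refl , refl
  old-edge (outer e s _)     false refl ()
  old-edge (pendant e s _ _) false refl ()

  same-edge : ∀ x y t → G.end x t ≡ G.end y true → G.end x (not t) ≡ G.end y false →
              Vⁿ H α (G.end y true) ≡ false → x ≡ y
  same-edge (outer _ _ _)     (outer _ _ _)     true  _    refl _ = refl
  same-edge (outer _ _ _)     (outer _ _ _)     false ()
  same-edge (outer _ _ _)     (pendant _ _ _ _) true  ()
  same-edge (outer _ _ _)     (pendant _ _ _ _) false ()
  same-edge (pendant _ _ _ _) (outer _ _ _)     true  ()
  same-edge (pendant _ _ _ _) (outer _ _ _)     false ()
  same-edge (pendant _ _ _ _) (pendant _ _ _ _) true  refl refl _ = refl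
  same-edge (pendant _ _ _ _) (pendant _ _ _ _) false ()

  module _ (L : Labelling H) where
    open Labelling L

    labelled : Sub (S₂-Vertex H α)
    labelled (old v _)    = X v
    labelled (copy _ _ _) = false
    labelled (new e s)    = N e s

    -- A middle edge with both ends outside the set lies inside the dominating part, where it
    -- neither matches nor dominates.
    needed : Sub (S₂-Edge H α)
    needed (middle e)        = N e false ∨ N e true
    needed (outer _ _ _)     = true
    needed (pendant _ _ _ _) = true

    private
      -- A new vertex in the set is matched along its middle edge if the far end is in the set too,
      -- and otherwise with the old vertex at its own end.
      matched : Sub (S₂-Edge H α)
      matched (middle e)        = N e false ∧ N e true
      matched (outer e s _)     = N e s ∧ not (N e (not s))
      matched (pendant _ _ _ _) = false

      needed-middle : ∀ e s → N e s ≡ true → needed (middle e) ≡ true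
      needed-middle e false p rewrite p = refl
      needed-middle e true  p with N e false
      ... | true  = refl
      ... | false = p

      matched-middle : ∀ e s → N e s ≡ true → N e (not s) ≡ true → matched (middle e) ≡ true
      matched-middle e false p q = ∧-join p q
      matched-middle e true  p q = ∧-join q p

      matched-middle⇒ : ∀ e → matched (middle e) ≡ true → ∀ s → N e s ≡ true
      matched-middle⇒ e m false = proj₁ (∧-split m)
      matched-middle⇒ e m true  = proj₂ (∧-split {N e false} m)

      matched-outer⇒ : ∀ e s → N e s ∧ not (N e (not s)) ≡ true →
                       N e s ≡ true × N e (not s) ≡ false
      matched-outer⇒ e s m with N e s | N e (not s)
      ... | true | false = refl , refl

      domᴰ : ∀ x → labelled x ≡ true →
             ∃₂ λ e s → needed e ≡ true × G.end e s ≡ x × labelled (G.end e (not s)) ≡ false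
      domᴰ (old v n) x with false-dart v x
      ... | e , s , refl , q = outer e s n , true , refl , refl , q
      domᴰ (new e s) p with X (end e s) in x
      ... | true  = middle e , s , needed-middle e s p , refl , X⇒mixed e s x p
      ... | false with leaf? H (end e s)
      -- `α` is positive, so the leaf has a copy, and copies are outside the set.
      ...   | yes ℓ = pendant e s ℓ (first (proj₂ (α (end e s) ℓ))) , false , refl , refl , refl
      ...   | no ¬ℓ = outer e s ¬ℓ , false , refl , refl , x

      domᴾ : ∀ x → labelled x ≡ false →
             ∃₂ λ e s → needed e ≡ true × G.end e s ≡ x × labelled (G.end e (not s)) ≡ true
      domᴾ (old v n) _ with true-dart v
      ... | e , s , refl , q = outer e s n , true , refl , refl , q
      domᴾ (copy v ℓ i) _ with true-dart v
      ... | e , s , refl , q = pendant e s ℓ i , true , refl , refl , q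
      domᴾ (new e s) p with N e (not s) in q
      ... | true  = middle e , s , needed-middle e (not s) q , refl , q
      ... | false = outer e s (X⇒¬leaf x) , false , refl , refl , x
        where x = edge-false e s p q

      covers : ∀ x → labelled x ≡ true → ∃₂ λ e s → matched e ≡ true × G.end e s ≡ x
      covers (old v n) x with true-dart v
      ... | e , s , refl , q = outer e s n , true , ∧-join q (cong not (X⇒mixed e s x q)) , refl
      covers (new e s) p with X (end e s) in x
      ... | true  = outer e s (X⇒¬leaf x) , false , ∧-join p (cong not (X⇒mixed e s x p)) , refl
      ... | false = middle e , s , matched-middle e s p (trans (edge-true e s p) (cong not x)) , refl

      unique : ∀ e e′ s s′ → matched e ≡ true → matched e′ ≡ true → G.end e s ≡ G.end e′ s′ → e ≡ e′
      unique (middle e) (middle .e) s .s m m′ refl = refl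
      unique (middle e) (outer .e s _) .s false m m′ refl =
        ⊥-elim (true≢false (matched-middle⇒ e m (not s)) (proj₂ (matched-outer⇒ e s m′)))
      unique (outer e s _) (middle .e) false .s m m′ refl =
        ⊥-elim (true≢false (matched-middle⇒ e m′ (not s)) (proj₂ (matched-outer⇒ e s m)))
      unique (outer e s _) (outer .e .s _) false false m m′ refl = refl
      unique (outer e s n) (outer e′ s′ _) true true m m′ eq = same (cong projection eq)
        where
        same : end e s ≡ end e′ s′ → outer e s _ ≡ outer e′ s′ _
        same p with true-unique e s e′ s′ (mixed⇒X e s (proj₁ (matched-outer⇒ e s m)) (proj₂ (matched-outer⇒ e s m)))
                      p (proj₁ (matched-outer⇒ e s m)) (proj₁ (matched-outer⇒ e′ s′ m′))
        ... | refl , refl = refl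

    labelling⇒DPSplit : DPSplit (S₂ H α) needed labelled
    labelling⇒DPSplit = record
      { dominatedᴰ = domᴰ
      ; dominatedᴾ = domᴾ
      ; M          = matched
      ; M⊆F        = λ { (middle e) m → needed-middle e false (proj₁ (∧-split m))
                       ; (outer _ _ _) _ → refl ; (pendant _ _ _ _) _ → refl }
      ; M-ends     = λ { (middle e) m s → matched-middle⇒ e m s
                       ; (outer e s _) m false → proj₁ (matched-outer⇒ e s m)
                       ; (outer e s _) m true → mixed⇒X e s (proj₁ (matched-outer⇒ e s m)) (proj₂ (matched-outer⇒ e s m)) }
      ; M-loopless = λ { (middle _) _ () ; (outer _ _ _) _ () ; (pendant _ _ _ _) () }
      ; M-covers   = covers
      ; M-unique   = unique
      }

  false-edge⇒¬minimal : (L : Labelling H) → HasFalseEdge L → ¬ MinimalSplit (S₂ H α) everything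
  false-edge⇒¬minimal L (e , f) min = min (needed L) (λ _ _ → refl) (middle e) refl
    (unneeded (f false) (f true)) _ (labelling⇒DPSplit L)
    where
    unneeded : ∀ {a b} → a ≡ false → b ≡ false → a ∨ b ≡ false
    unneeded refl refl = refl

  module _ {F : Sub (S₂-Edge H α)} {P : Sub (S₂-Vertex H α)} (sp : DPSplit (S₂ H α) F P) where
    open DPSplit sp
    private
      N : Fin size → Bool → Bool
      N e s = P (new e s)

      -- A leaf has no old vertex to read off; false is the right value there because its copies are
      -- never in `P` (`copy∉P`).
      X : Fin order → Bool
      X v with leaf? H v
      ... | yes _ = false
      ... | no n  = P (old v n)

      X-old : ∀ {v} .(n : ¬ Leaf H v) → X v ≡ P (old v n)
      X-old {v} n with leaf? H v
      ... | yes ℓ = Irr.⊥-elim (n ℓ)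
      ... | no _  = refl

      X-leaf : ∀ {v} → Leaf H v → X v ≡ false
      X-leaf {v} ℓ with leaf? H v
      ... | yes _ = refl
      ... | no n  = ⊥-elim (n ℓ)

      X⇒¬ℓ : ∀ {v} → X v ≡ true → ¬ Leaf H v
      X⇒¬ℓ x ℓ = true≢false x (X-leaf ℓ)

      -- A copy has a single neighbour, which would have to be its partner in `P` and its dominator
      -- outside `P` at once.
      copy∉P : ∀ v .(ℓ : Leaf H v) i → P (copy v ℓ i) ≡ false
      copy∉P v ℓ i with P (copy v ℓ i) in c
      ... | false = refl
      ... | true  with M-covers _ c | dominatedᴰ _ c
      ...   | x , t , m , eq | x′ , t′ , _ , eq′ , n with old-edge x t eq refl | old-edge x′ t′ eq′ refl
      ...     | e , s , p , q | e′ , s′ , p′ , q′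
        with leaf⇒unique-dart H (recompute (leaf? H _) ℓ) {e} {s} {e′} {s′} p p′
      ...       | refl , refl = ⊥-elim (true≢false (M-ends _ m (not t))
        (trans (cong P (trans q (sym q′))) n))

      old-neighbour : ∀ y b → Vⁿ H α y ≡ false →
        (∃₂ λ x t → F x ≡ true × G.end x t ≡ y × P (G.end x (not t)) ≡ b) →
        ∃₂ λ e s → end e s ≡ projection y × N e s ≡ b
      old-neighbour y b o (x , t , _ , eq , n) with old-edge x t eq o
      ... | e , s , p , q = e , s , p , trans (cong P (sym q)) n

      -- All neighbours of an old vertex or a copy are new: one of them dominates it if it is
      -- outside `P` and is its partner if it is inside.
      true-dart′ : ∀ v → ∃₂ λ e s → end e s ≡ v × N e s ≡ true
      true-dart′ v with leaf? H v
      ... | yes ℓ = old-neighbour _ true refl (dominatedᴾ (copy v ℓ (first (proj₂ (α v ℓ)))) (copy∉P _ _ _))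
      ... | no ¬ℓ with P (old v ¬ℓ) in p
      ...   | false = old-neighbour (old v ¬ℓ) true refl (dominatedᴾ _ p)
      ...   | true with M-covers _ p
      ...     | x , t , m , eq = old-neighbour (old v ¬ℓ) true refl (x , t , M⊆F _ m , eq , M-ends _ m (not t))

      edge-true′ : ∀ e s → N e s ≡ true → N e (not s) ≡ not (X (end e s))
      edge-true′ e s n with M-covers _ n | dominatedᴰ _ n
      ... | middle _ , _ , m , refl | middle _ , _ , _ , refl , d =
        ⊥-elim (true≢false (M-ends _ m (not s)) d)
      ... | middle _ , _ , m , refl | outer _ _ ¬ℓ , false , _ , refl , d =
        trans (M-ends _ m (not s)) (sym (cong not (trans (X-old ¬ℓ) d)))
      ... | middle _ , _ , m , refl | pendant _ _ ℓ _ , false , _ , refl , _ =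
        trans (M-ends _ m (not s)) (sym (cong not (X-leaf (recompute (leaf? H _) ℓ))))
      ... | outer _ _ ¬ℓ , false , m , refl | middle _ , _ , _ , refl , d =
        trans d (sym (cong not (trans (X-old ¬ℓ) (M-ends _ m true))))
      ... | outer _ _ _ , false , m , refl | outer _ _ _ , false , _ , refl , d =
        ⊥-elim (true≢false (M-ends _ m true) d)
      ... | outer _ _ ¬ℓ , false , m , refl | pendant _ _ ℓ _ , false , _ , refl , _ = Irr.⊥-elim (¬ℓ ℓ)
      ... | pendant _ _ ℓ i , false , m , refl | _ = ⊥-elim (true≢false (M-ends _ m true) (copy∉P _ ℓ i))

      edge-false′ : ∀ e s → N e s ≡ false → N e (not s) ≡ false → X (end e s) ≡ true
      edge-false′ e s n n′ with dominatedᴾ _ n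
      ... | middle _ , _ , _ , refl , q = ⊥-elim (true≢false q n′)
      ... | outer _ _ ¬ℓ , false , _ , refl , q = trans (X-old ¬ℓ) q
      ... | pendant _ _ ℓ i , false , _ , refl , q = ⊥-elim (true≢false q (copy∉P _ ℓ i))

      outer∈M : ∀ e s .(n : ¬ Leaf H (end e s)) → X (end e s) ≡ true → N e s ≡ true →
                M (outer e s n) ≡ true
      outer∈M e s n x p with M-covers _ p
      ... | middle _ , _ , m , refl =
        ⊥-elim (true≢false (M-ends _ m (not s)) (trans (edge-true′ e s p) (cong not x)))
      ... | outer _ _ _ , false , m , refl = m
      ... | pendant _ _ ℓ i , false , m , refl = ⊥-elim (true≢false (M-ends _ m true) (copy∉P _ ℓ i))

      true-unique′ : ∀ e s e′ s′ → X (end e s) ≡ true → end e s ≡ end e′ s′ →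
                     N e s ≡ true → N e′ s′ ≡ true → e ≡ e′ × s ≡ s′
      true-unique′ e s e′ s′ x eq n n′ = outer-injective (M-unique _ _ true true
          (outer∈M e s (X⇒¬ℓ x) x n) (outer∈M e′ s′ (X⇒¬ℓ x′) x′ n′) (old-cong eq))
        where
        x′ = trans (cong X (sym eq)) x
        old-cong : ∀ {v w} .{p : ¬ Leaf H v} .{q : ¬ Leaf H w} → v ≡ w → old {H = H} {α = α} v p ≡ old w q
        old-cong refl = refl
        outer-injective : ∀ {e s e′ s′} .{p : ¬ Leaf H (end e s)} .{q : ¬ Leaf H (end e′ s′)} → outer {H = H} {α = α} e s p ≡ outer e′ s′ q → e ≡ e′ × s ≡ s′
        outer-injective refl = refl , refl

      false-dart′ : ∀ v → X v ≡ true → ∃₂ λ e s → end e s ≡ v × N e s ≡ false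
      false-dart′ v x = old-neighbour (old v (X⇒¬ℓ x)) false refl
        (dominatedᴰ _ (trans (sym (X-old (X⇒¬ℓ x))) x))

    DPSplit⇒labelling : Labelling H
    DPSplit⇒labelling = record
      { N = N ; X = X ; true-dart = true-dart′ ; true-unique = true-unique′
      ; false-dart = false-dart′ ; edge-true = edge-true′ ; edge-false = edge-false′ }

    labelling-X : ∀ {v} .(n : ¬ Leaf H v) → Labelling.X DPSplit⇒labelling v ≡ P (old v n)
    labelling-X = X-old

    labelling-copy : ∀ v .(ℓ : Leaf H v) i → P (copy v ℓ i) ≡ false
    labelling-copy = copy∉P

    -- A new vertex in `P` uses both its sides, one for its partner and one for its dominator. If
    -- `new e s` is outside, the far end accounts for the middle edge, and the old vertex next to
    -- `new e s`, being in `P`, must be dominated along its only false dart, which is this one. A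
    -- copy has only one edge.
    spans-everything :
      (∀ e s → N e s ≡ false → N e (not s) ≡ true) →
      (∀ e s → N e s ≡ false → X (end e s) ≡ true) →
      (∀ e s e′ s′ → end e s ≡ end e′ s′ → N e s ≡ false → N e′ s′ ≡ false → e ≡ e′ × s ≡ s′) →
      ∀ x → F x ≡ true
    spans-everything no-ff false⇒X false-unique = all
      where
      middle∈F : ∀ e s → N e s ≡ true → F (middle e) ≡ true
      middle∈F e s n with M-covers _ n | dominatedᴰ _ n
      ... | middle _ , _ , m , refl | _ = M⊆F _ m
      ... | outer _ _ _ , false , m , refl | middle _ , _ , f , refl , d = f
      ... | outer _ _ _ , false , m , refl | outer _ _ _ , false , _ , refl , d =
        ⊥-elim (true≢false (M-ends _ m true) d)
      ... | outer _ _ ¬ℓ , false , m , refl | pendant _ _ ℓ _ , false , _ , refl , d = Irr.⊥-elim (¬ℓ ℓ)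
      ... | pendant _ _ ℓ i , false , m , refl | _ = ⊥-elim (true≢false (M-ends _ m true) (copy∉P _ ℓ i))

      all : ∀ x → F x ≡ true
      all (middle e) with N e false in n
      ... | true  = middle∈F e false n
      ... | false = middle∈F e true (no-ff e false n)
      all (outer e s ¬ℓ) with N e s in n
      ... | true with M-covers _ n | dominatedᴰ _ n
      ...   | middle _ , _ , m , refl | middle _ , _ , _ , refl , d =
        ⊥-elim (true≢false (M-ends _ m (not s)) d)
      ...   | middle _ , _ , m , refl | outer _ _ _ , false , f , refl , d = f
      ...   | middle _ , _ , m , refl | pendant _ _ ℓ _ , false , _ , refl , _ = Irr.⊥-elim (¬ℓ ℓ)
      ...   | outer _ _ _ , false , m , refl | _ = M⊆F _ m
      ...   | pendant _ _ ℓ i , false , m , refl | _ = ⊥-elim (true≢false (M-ends _ m true) (copy∉P _ ℓ i))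
      all (outer e s ¬ℓ) | false with dominatedᴰ (old (end e s) ¬ℓ) (trans (sym (X-old ¬ℓ)) (false⇒X e s n))
      ...   | x , t , f , eq , n′ with old-edge x t eq refl
      ...     | e′ , s′ , p , q with false-unique e s e′ s′ (sym p) n (trans (cong P (sym q)) n′)
      ...       | refl , refl = trans (cong F (sym (same-edge x (outer e s ¬ℓ) t eq q refl))) f
      all (pendant e s ℓ i) with dominatedᴾ _ (copy∉P _ ℓ i)
      ... | x , t , f , eq , _ with old-edge x t eq refl
      ...   | e′ , s′ , p , q with leaf⇒unique-dart H (recompute (leaf? H _) ℓ) {e} {s} {e′} {s′} refl p
      ...     | refl , refl = trans (cong F (sym (same-edge x (pendant e s ℓ i) t eq q refl))) f

-- Labellings without an edge false at both ends

false-edge? : ∀ {H} (L : Labelling H) →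
              HasFalseEdge L ⊎ (∀ e s → Labelling.N L e s ≡ false → Labelling.N L e (not s) ≡ true)
false-edge? L with any? (λ e → N e false ≟ᵇ false ×-dec N e true ≟ᵇ false)
  where open Labelling L
... | yes (e , p , q) = inj₁ (e , λ { false → p ; true → q })
... | no none = inj₂ no-ff
  where
  open Labelling L
  no-ff : ∀ e s → N e s ≡ false → N e (not s) ≡ true
  no-ff e false p = ¬-not λ q → none (e , p , q)
  no-ff e true  p = ¬-not λ q → none (e , q , p)

module _ {H : FinGraph} (L : Labelling H)
         (no-ff : ∀ e s → Labelling.N L e s ≡ false → Labelling.N L e (not s) ≡ true) where
  open FinGraph H
  open Labelling L

  private
    tail-X : ∀ e s → N e s ≡ false → X (end e (not s)) ≡ true
    tail-X e s n = mixed⇒X e (not s) (no-ff e s n) (trans (cong (N e) (not-involutive s)) n)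

    -- Outside `X` the value is `v` itself, so that `pred` is a map on all vertices and the
    -- pigeonhole principle applies. The value of `X v` and its equation are arguments, which lets
    -- `pred-X` evaluate `pred` at any proof of `X v ≡ true`.
    entry : ∀ v b → X v ≡ b → Fin order
    entry v true  x = let e , s , _ = false-dart v x in end e (not s)
    entry v false _ = v

    pred : Fin order → Fin order
    pred v = entry v (X v) refl

    pred-X : ∀ v (x : X v ≡ true) → pred v ≡ entry v true x
    pred-X v x = go (X v) refl
      where
      go : ∀ b (y : X v ≡ b) → entry v b y ≡ entry v true x
      go true  y = cong (entry v true) (uip y x)
      go false y = ⊥-elim (true≢false x y)

    pred-¬X : ∀ v → X v ≡ false → pred v ≡ v
    pred-¬X v x = go (X v) refl
      where
      go : ∀ b (y : X v ≡ b) → entry v b y ≡ v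
      go false y = refl
      go true  y = ⊥-elim (true≢false y x)

    X-entry : ∀ v (x : X v ≡ true) → X (entry v true x) ≡ true
    X-entry v x with false-dart v x
    ... | e , s , _ , n = tail-X e s n

    -- The far end of a false dart is in `X` and labelled true, and `true-unique` allows only one
    -- true dart there.
    tail-unique : ∀ e s e′ s′ → N e s ≡ false → N e′ s′ ≡ false → end e (not s) ≡ end e′ (not s′) →
                  e ≡ e′ × s ≡ s′
    tail-unique e s e′ s′ n n′ eq
      with true-unique e (not s) e′ (not s′) (tail-X e s n) eq (no-ff e s n) (no-ff e′ s′ n′)
    ... | refl , q = refl , trans (sym (not-involutive s)) (trans (cong not q) (not-involutive s′))

    entry-injective : ∀ v w x y → entry v true x ≡ entry w true y → v ≡ w
    entry-injective v w x y eq with false-dart v x | false-dart w y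
    ... | e , s , p , n | e′ , s′ , p′ , n′ with tail-unique e s e′ s′ n n′ eq
    ...   | refl , refl = trans (sym p) p′

    pred-injective : ∀ {v w} → pred v ≡ pred w → v ≡ w
    pred-injective {v} {w} eq with true⊎false (X v) | true⊎false (X w)
    ... | inj₁ x | inj₁ y = entry-injective v w x y
                            (trans (sym (pred-X v x)) (trans eq (pred-X w y)))
    ... | inj₁ x | inj₂ y = ⊥-elim (true≢false (X-entry v x)
                            (trans (cong X (trans (sym (pred-X v x)) (trans eq (pred-¬X w y)))) y))
    ... | inj₂ x | inj₁ y = ⊥-elim (true≢false (X-entry w y)
                            (trans (cong X (trans (sym (pred-X w y)) (trans (sym eq) (pred-¬X v x)))) x))
    ... | inj₂ x | inj₂ y = trans (sym (pred-¬X v x)) (trans eq (pred-¬X w y))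

    -- pred is injective, hence onto: every false dart is the one chosen by false-dart.
    chosen : ∀ e s → N e s ≡ false → ∃ λ v → Σ (X v ≡ true) λ x →
             e ≡ proj₁ (false-dart v x) × s ≡ proj₁ (proj₂ (false-dart v x))
    chosen e s n with injective⇒surjective pred pred-injective (end e (not s))
    ... | v , eq with true⊎false (X v)
    ...   | inj₂ x = ⊥-elim (true≢false (tail-X e s n)
                      (trans (cong X (trans (sym eq) (pred-¬X v x))) x))
    ...   | inj₁ x = v , x , unpack (trans (sym eq) (pred-X v x))
      where
      unpack : end e (not s) ≡ entry v true x →
               e ≡ proj₁ (false-dart v x) × s ≡ proj₁ (proj₂ (false-dart v x))
      unpack eq with false-dart v x
      ... | e′ , s′ , _ , n′ = tail-unique e s e′ s′ n n′ eq

  false⇒X : ∀ e s → N e s ≡ false → X (end e s) ≡ true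
  false⇒X e s n with chosen e s n
  ... | v , x , refl , refl = trans (cong X (proj₁ (proj₂ (proj₂ (false-dart v x))))) x

  false-unique : ∀ e s e′ s′ → end e s ≡ end e′ s′ → N e s ≡ false → N e′ s′ ≡ false →
                 e ≡ e′ × s ≡ s′
  false-unique e s e′ s′ eq n n′ with chosen e s n | chosen e′ s′ n′
  ... | v , x , refl , refl | v′ , x′ , refl , refl = same (trans (sym (at v x)) (trans eq (at v′ x′)))
    where
    at : ∀ v x → end (proj₁ (false-dart v x)) (proj₁ (proj₂ (false-dart v x))) ≡ v
    at v x = proj₁ (proj₂ (proj₂ (false-dart v x)))
    same : v ≡ v′ → proj₁ (false-dart v x) ≡ proj₁ (false-dart v′ x′) ×
           proj₁ (proj₂ (false-dart v x)) ≡ proj₁ (proj₂ (false-dart v′ x′))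
    same refl rewrite uip x x′ = refl , refl

  -- At a vertex of `X` a true dart has a false far end, whose vertex is in `X` by `false⇒X`; for a
  -- false dart `tail-X` applies. On a connected graph `X` is therefore empty or everything.
  X-adjacent : ∀ {u v} → Adjacent ⟦ H ⟧ u v → X u ≡ true → X v ≡ true
  X-adjacent (e , s , refl , refl) x with N e s in n
  ... | true  = false⇒X e (not s) (X⇒mixed e s x n)
  ... | false = tail-X e s n

  X-connected : ∀ {u v} → Star (Adjacent ⟦ H ⟧) u v → X u ≡ true → X v ≡ true
  X-connected ε       x = x
  X-connected (a ◅ p) x = X-connected p (X-adjacent a x)

  -- Exactly one dart at `v` is true, by `true-unique`, and exactly one is false, by `false-unique`.
  X⇒degree-2 : ∀ v → X v ≡ true → degree H v ≡ 2
  X⇒degree-2 v x = card-≡ (degree↔ H v) (card-⊎ Fin1↔⊤ Fin1↔⊤) (mk↔ₛ′ to from to∘from from∘to)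
    where
    to : Dart H everything v → ⊤ ⊎ ⊤
    to (e , s , _) = if N e s then inj₁ tt else inj₂ tt
    from : ⊤ ⊎ ⊤ → Dart H everything v
    from (inj₁ _) = let e , s , p , _ = true-dart v in e , s , refl , p
    from (inj₂ _) = let e , s , p , _ = false-dart v x in e , s , refl , p
    to∘from : ∀ y → to (from y) ≡ y
    to∘from (inj₁ _) with true-dart v
    ... | e , s , p , n rewrite n = refl
    to∘from (inj₂ _) with false-dart v x
    ... | e , s , p , n rewrite n = refl
    from∘to : ∀ d → from (to d) ≡ d
    from∘to (e , s , refl , p) with N e s in n
    ... | true with true-dart v
    ...   | e′ , s′ , p′ , n′ with true-unique e′ s′ e s (trans (cong X p′) x) (trans p′ (sym p)) n′ n
    ...     | q , q′ = dart-≡ H q q′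
    from∘to (e , s , refl , p) | false with false-dart v x
    ...   | e′ , s′ , p′ , n′ with false-unique e′ s′ e s (trans p′ (sym p)) n′ n
    ...     | q , q′ = dart-≡ H q q′

-- From a good subgraph to a labelling

module _ {H : FinGraph} (noiso : NoIsolatedVertex ⟦ H ⟧) {Q : Subgraph H} (good : Good H Q) where
  open FinGraph H
  open Subgraph Q
  open Good good

  private
    Departs : Fin order → Set
    Departs v = ∃ λ e → F e ≡ true × tail e ≡ v

    departs? : ∀ v → Dec (Departs v)
    departs? v = any? λ e → F e ≟ᵇ true ×-dec tail e ≟ v

    Entered : Fin order → Set
    Entered v = ∃ λ e → F e ≡ true × head e ≡ v

    InnerSomewhere : Fin order → Set
    InnerSomewhere v = ∃ λ y → Inner (path y) v

    walk-entered : ∀ {u w x} es → DirectedWalk u es w → Entered u → x ∈ˡ map tail es → Entered x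
    walk-entered (e ∷ es) (f , refl , wk) u (here refl) = u
    walk-entered (e ∷ es) (f , refl , wk) u (there m)   = walk-entered es wk (e , T⇒≡ f , refl) m

    inner-entered : ∀ {u w x} es → DirectedWalk u es w → x ∈ˡ drop 1 (map tail es) → Entered x
    inner-entered (e ∷ es) (f , _ , wk) m = walk-entered es wk (e , T⇒≡ f , refl) m

    walk-tail : ∀ {u w e} es → DirectedWalk u es w → e ∈ˡ es →
                tail e ≡ u ⊎ tail e ∈ˡ drop 1 (map tail es)
    walk-tail (_ ∷ es) (_ , p , _) (here refl) = inj₁ p
    walk-tail (_ ∷ es) _           (there m)   = inj₂ (∈-map⁺ tail m)

    walk-head : ∀ {u w e} es → DirectedWalk u es w → e ∈ˡ es → head e ≡ w ⊎ Departs (head e)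
    walk-head (_ ∷ [])      (_ , _ , p)            (here refl) = inj₁ p
    walk-head (_ ∷ e′ ∷ es) (_ , _ , f′ , p , _)   (here refl) = inj₂ (e′ , T⇒≡ f′ , p)
    walk-head (_ ∷ es)      (_ , _ , wk)           (there m)   = walk-head es wk m

    -- The tail of an arc is the start of the path containing it, hence in `Q`, or an inner vertex
    -- of that path.
    departs⇒ : ∀ {v} → Departs v → v ∈ VQ ⊎ InnerSomewhere v
    departs⇒ (e , f , refl) with partition e (≡⇒T f)
    ... | (y , y∈) , m , _ with walk-tail _ (walk (path (y , y∈))) m
    ...   | inj₁ p = inj₁ (subst (_∈ VQ) (sym p) y∈)
    ...   | inj₂ q = inj₂ ((y , y∈) , q)

    VQ⇒departs : ∀ {v} → v ∈ VQ → Departs v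
    VQ⇒departs {v} q with card-1⇒element (count↔ _) (initial-d⁺ v q)
    ... | e , m = e , proj₁ (∧-split m) , ⌊⌋⇒ (_ ≟ _) (proj₂ (∧-split {F e} m))

    d⁺≡1 : ∀ {v} → Departs v → d⁺ v ≡ 1
    d⁺≡1 {v} d with departs⇒ d
    ... | inj₁ q       = initial-d⁺ v q
    ... | inj₂ (y , i) = inner-d⁺ v y i

    departure-unique : ∀ {e e′} → F e ≡ true → F e′ ≡ true → tail e ≡ tail e′ → e ≡ e′
    departure-unique {e} {e′} f f′ eq = cong proj₁
      (card-1⇒unique (count↔ _) (d⁺≡1 (e′ , f′ , refl))
        (e , ∧-join f (⇒⌊⌋ (_ ≟ _) eq)) (e′ , ∧-join f′ (⇒⌊⌋ (_ ≟ _) refl)))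

    -- At a vertex of `Q` this is `F-lower`. At an inner vertex `d⁻` and `d⁺` already add up to the
    -- degree, so an edge outside `F` would be one dart too many.
    full : ∀ e s → Departs (end e s) → F e ≡ false → EQ e ≡ true
    full e s d ¬f with EQ e in q
    ... | true = refl
    ... | false with departs⇒ d
    ...   | inj₁ v∈ = ⊥-elim (≡⇒¬T ¬f (F-lower e (≡⇒¬T q) (end e s , v∈ , s , refl)))
    ...   | inj₂ (y , i) = ⊥-elim (ℕ.<-irrefl refl
        (subst (_≤ degree H v) (trans (cong (_+ 1) sum≡) (ℕ.+-comm (degree H v) 1))
          (card-≤ (card-⊎ (card-⊎ (count↔ _) (count↔ _)) Fin1↔⊤) (degree↔ H v) f f-inj)))
      where
      v = end e s
      sum≡ : d⁻ v + d⁺ v ≡ degree H v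
      sum≡ = trans (cong (d⁻ v +_) (inner-d⁺ v y i)) (inner-d⁻ v y i)
      In  = ∃ λ e → (F e ∧ ⌊ head e ≟ v ⌋) ≡ true
      Out = ∃ λ e → (F e ∧ ⌊ tail e ≟ v ⌋) ≡ true
      f : (In ⊎ Out) ⊎ ⊤ → Dart H everything v
      f (inj₁ (inj₁ (a , m))) = a , not (o a) , refl , ⌊⌋⇒ (_ ≟ _) (proj₂ (∧-split {F a} m))
      f (inj₁ (inj₂ (a , m))) = a , o a , refl , ⌊⌋⇒ (_ ≟ _) (proj₂ (∧-split {F a} m))
      f (inj₂ _)              = e , s , refl , refl
      inF : ∀ {a b} → (F a ∧ b) ≡ true → a ≡ e → ⊥
      inF {a} m refl = true≢false (proj₁ (∧-split m)) ¬f
      f-inj : ∀ {x y} → f x ≡ f y → x ≡ y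
      f-inj {inj₁ (inj₁ _)} {inj₁ (inj₁ _)} eq = cong (inj₁ ∘ inj₁) (∃true-≡ (cong proj₁ eq))
      f-inj {inj₁ (inj₂ _)} {inj₁ (inj₂ _)} eq = cong (inj₁ ∘ inj₂) (∃true-≡ (cong proj₁ eq))
      f-inj {inj₁ (inj₁ (a , _))} {inj₁ (inj₂ (b , _))} eq = ⊥-elim (s≢not-s (o a)
        (trans (cong o (cong proj₁ eq)) (sym (cong (proj₁ ∘ proj₂) eq))))
      f-inj {inj₁ (inj₂ (a , _))} {inj₁ (inj₁ (b , _))} eq = ⊥-elim (s≢not-s (o a)
        (trans (cong (proj₁ ∘ proj₂) eq) (cong (not ∘ o) (sym (cong proj₁ eq)))))
      f-inj {inj₁ (inj₁ (_ , m))} {inj₂ _} eq = ⊥-elim (inF m (cong proj₁ eq))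
      f-inj {inj₁ (inj₂ (_ , m))} {inj₂ _} eq = ⊥-elim (inF m (cong proj₁ eq))
      f-inj {inj₂ _} {inj₁ (inj₁ (_ , m))} eq = ⊥-elim (inF m (sym (cong proj₁ eq)))
      f-inj {inj₂ _} {inj₁ (inj₂ (_ , m))} eq = ⊥-elim (inF m (sym (cong proj₁ eq)))
      f-inj {inj₂ _} {inj₂ _} eq = refl

    -- The arc leaving `v` marks the partner of the old vertex: it is true at its tail and false at
    -- its head, so the new vertex at the tail can only be matched with `v`.
    X : Fin order → Bool
    X v = ⌊ departs? v ⌋

    N : Fin size → Bool → Bool
    N e s = if EQ e then false else if F e then ⌊ s ≟ᵇ o e ⌋ else true

    -- A view that evaluates the nested conditional in `N` once and for all.
    data Status (e : Fin size) (s : Bool) : Set where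
      inQ    : EQ e ≡ true → (∀ t → N e t ≡ false) → Status e s
      isTail : F e ≡ true → s ≡ o e → N e s ≡ true → N e (not s) ≡ false → Status e s
      isHead : F e ≡ true → s ≡ not (o e) → N e s ≡ false → N e (not s) ≡ true → Status e s
      free   : F e ≡ false → EQ e ≡ false → (∀ t → N e t ≡ true) → Status e s

    status : ∀ e s → Status e s
    status e s with EQ e in q | F e in f
    ... | true  | _ = inQ q λ t → N-Q q
      where
      N-Q : ∀ {t} → EQ e ≡ true → N e t ≡ false
      N-Q q rewrite q = refl
    ... | false | false = free f q λ t → N-free q f
      where
      N-free : ∀ {t} → EQ e ≡ false → F e ≡ false → N e t ≡ true
      N-free q f rewrite q | f = refl
    ... | false | true with ≡⊎≡not s (o e)
    ...   | inj₁ p = isTail f p (trans N-F (⇒⌊⌋ (_ ≟ᵇ _) p))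
                       (trans N-F (⇒⌊⌋-no (_ ≟ᵇ _) λ r → s≢not-s s (trans p (sym r))))
      where
      N-F : ∀ {t} → N e t ≡ ⌊ t ≟ᵇ o e ⌋
      N-F rewrite q | f = refl
    ...   | inj₂ p = isHead f p (trans N-F (⇒⌊⌋-no (_ ≟ᵇ _) λ r → s≢not-s (o e) (trans (sym r) p)))
                       (trans N-F (⇒⌊⌋ (_ ≟ᵇ _) (trans (cong not p) (not-involutive (o e)))))
      where
      N-F : ∀ {t} → N e t ≡ ⌊ t ≟ᵇ o e ⌋
      N-F rewrite q | f = refl

    -- No dart at `v` is a tail or lies on `Q`. If one is the head of an arc, the path through that
    -- arc cannot continue and ends at `v`; by `final-d⁻` some dart at `v` is then not a head, so it
    -- is free and true.
    not-departing : ∀ v → ¬ Departs v → ∃₂ λ e s → end e s ≡ v × N e s ≡ true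
    not-departing v nd with noiso v
    ... | e , s , p with status e s
    ...   | inQ q _ = ⊥-elim (nd (VQ⇒departs (subst (_∈ VQ) p (closed e (≡⇒T q) s))))
    ...   | isTail f t _ _ = ⊥-elim (nd (e , f , trans (cong (end e) (sym t)) p))
    ...   | free _ _ n = e , s , p , n s
    ...   | isHead f h _ _ with partition e (≡⇒T f)
    ...     | y , m , _ with walk-head _ (walk (path y)) m
    ...       | inj₂ d = ⊥-elim (nd (subst Departs (trans (cong (end e) (sym h)) p) d))
    ...       | inj₁ fin with dart? H N v
    ...         | inj₁ found = found
    ...         | inj₂ none = ⊥-elim (ℕ.<⇒≱ (subst (λ v → d⁻ v < degree H v) v≡ (final-d⁻ y))
                    (card-≤ (degree↔ H v) (count↔ _) g g-inj))
      where
      v≡ : final (path y) ≡ v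
      v≡ = trans (sym fin) (trans (cong (end e) (sym h)) p)
      entering : ∀ a t → end a t ≡ v → F a ≡ true × t ≡ not (o a)
      entering a t r with status a t
      ... | inQ q _ = ⊥-elim (nd (VQ⇒departs (subst (_∈ VQ) r (closed a (≡⇒T q) t))))
      ... | isTail f t≡ _ _ = ⊥-elim (nd (a , f , trans (cong (end a) (sym t≡)) r))
      ... | free _ _ n = ⊥-elim (true≢false (n t) (none a t r))
      ... | isHead f h _ _ = f , h
      g : Dart H everything v → ∃ λ a → (F a ∧ ⌊ head a ≟ v ⌋) ≡ true
      g (a , t , _ , r) = a , ∧-join (proj₁ (entering a t r))
        (⇒⌊⌋ (_ ≟ _) (trans (cong (end a) (sym (proj₂ (entering a t r)))) r))
      g-inj : ∀ {x y} → g x ≡ g y → x ≡ y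
      g-inj {a , t , _ , r} {b , t′ , _ , r′} eq with cong proj₁ eq
      ... | refl = dart-≡ H refl (trans (proj₂ (entering a t r)) (sym (proj₂ (entering b t′ r′))))

    true-dart′ : ∀ v → ∃₂ λ e s → end e s ≡ v × N e s ≡ true
    true-dart′ v with departs? v
    ... | no nd = not-departing v nd
    ... | yes (e , f , p) with status e (o e)
    ...   | inQ q _ = ⊥-elim (F-upper e (≡⇒T f) (≡⇒T q))
    ...   | isTail _ _ n _ = e , o e , p , n
    ...   | isHead _ h _ _ = ⊥-elim (s≢not-s _ h)
    ...   | free ¬f _ _ = ⊥-elim (true≢false f ¬f)

    out-of-X : ∀ e s → X (end e s) ≡ true → N e s ≡ true → F e ≡ true × s ≡ o e
    out-of-X e s x n with status e s
    ... | inQ _ n′ = ⊥-elim (true≢false n (n′ s))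
    ... | isTail f p _ _ = f , p
    ... | isHead _ _ n′ _ = ⊥-elim (true≢false n n′)
    ... | free ¬f ¬q _ = ⊥-elim (true≢false (full e s (⌊⌋⇒ (departs? _) x) ¬f) ¬q)

    true-unique′ : ∀ e s e′ s′ → X (end e s) ≡ true → end e s ≡ end e′ s′ →
                   N e s ≡ true → N e′ s′ ≡ true → e ≡ e′ × s ≡ s′
    true-unique′ e s e′ s′ x eq n n′ with out-of-X e s x n | out-of-X e′ s′ (trans (cong X (sym eq)) x) n′
    ... | f , refl | f′ , refl with departure-unique f f′ eq
    ...   | refl = refl , refl

    -- The dart lies on an edge of `Q` if `v` belongs to `Q`; at an inner vertex it is the head of
    -- an arc entering `v`.
    false-dart′ : ∀ v → X v ≡ true → ∃₂ λ e s → end e s ≡ v × N e s ≡ false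
    false-dart′ v x with departs⇒ (⌊⌋⇒ (departs? v) x)
    ... | inj₁ v∈ with no-isolated v v∈
    ...   | e , q , s , p with status e s
    ...     | inQ _ n = e , s , p , n s
    ...     | isTail f _ _ _ = ⊥-elim (F-upper e (≡⇒T f) q)
    ...     | isHead f _ _ _ = ⊥-elim (F-upper e (≡⇒T f) q)
    ...     | free _ ¬q _ = ⊥-elim (≡⇒¬T ¬q q)
    false-dart′ v x | inj₂ (y , i) with inner-entered _ (walk (path y)) i
    ...   | e , f , p with status e (not (o e))
    ...     | inQ _ n = e , not (o e) , p , n _
    ...     | isTail _ t _ _ = ⊥-elim (s≢not-s _ (sym t))
    ...     | isHead _ _ n _ = e , not (o e) , p , n
    ...     | free ¬f _ _ = ⊥-elim (true≢false f ¬f)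

    edge-true′ : ∀ e s → N e s ≡ true → N e (not s) ≡ not (X (end e s))
    edge-true′ e s n with status e s
    ... | inQ _ n′ = ⊥-elim (true≢false n (n′ s))
    ... | isTail f p _ n′ = trans n′ (sym (cong not (⇒⌊⌋ (departs? _) (e , f , cong (end e) (sym p)))))
    ... | isHead _ _ n′ _ = ⊥-elim (true≢false n n′)
    ... | free ¬f ¬q n′ = trans (n′ _) (sym (cong not (⇒⌊⌋-no (departs? _) λ d → true≢false (full e s d ¬f) ¬q)))

    edge-false′ : ∀ e s → N e s ≡ false → N e (not s) ≡ false → X (end e s) ≡ true
    edge-false′ e s n n′ with status e s
    ... | inQ q _ = ⇒⌊⌋ (departs? _) (VQ⇒departs (closed e (≡⇒T q) s))
    ... | isTail _ _ p _ = ⊥-elim (true≢false p n)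
    ... | isHead _ _ _ p = ⊥-elim (true≢false p n′)
    ... | free _ _ p = ⊥-elim (true≢false (p s) n)

  good⇒labelling : Labelling H
  good⇒labelling = record
    { N = N ; X = X ; true-dart = true-dart′ ; true-unique = true-unique′
    ; false-dart = false-dart′ ; edge-true = edge-true′ ; edge-false = edge-false′ }

  good⇒false-edge : HasFalseEdge good⇒labelling
  good⇒false-edge with nonempty
  ... | v , v∈ with no-isolated v v∈
  ...   | e , q , _ = e , λ s → cong (if_then false else (if F e then ⌊ s ≟ᵇ o e ⌋ else true)) (T⇒≡ q)

-- From a labelling to a good subgraph

-- An edge with different labels is an arc from its true to its false end, and the arcs used are
-- those from which Q can be reached.  Each vertex on the way to Q selects one of the arcs entering
-- it, and a path continues through a vertex only along its selected arc.
module _ {H : FinGraph} (L : Labelling H) (ff : HasFalseEdge L) where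
  open FinGraph H
  open Labelling L

  private
    EQ : Sub (Fin size)
    EQ e = not (N e false) ∧ not (N e true)

    EQ⇒ : ∀ e → EQ e ≡ true → ∀ s → N e s ≡ false
    EQ⇒ e q s with N e false in p | N e true in r
    EQ⇒ e q false | false | false = p
    EQ⇒ e q true  | false | false = r

    ⇒EQ : ∀ e s → N e s ≡ false → N e (not s) ≡ false → EQ e ≡ true
    ⇒EQ e false p q = ∧-join (cong not p) (cong not q)
    ⇒EQ e true  p q = ∧-join (cong not q) (cong not p)

    inQ? : ∀ v → Dec (∃ λ e → EQ e ≡ true × (end e false ≡ v ⊎ end e true ≡ v))
    inQ? v = any? λ e → EQ e ≟ᵇ true ×-dec (end e false ≟ v ⊎-dec end e true ≟ v)

    VQ : Sub (Fin order)
    VQ v = ⌊ inQ? v ⌋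

    ⇒VQ : ∀ e s → EQ e ≡ true → VQ (end e s) ≡ true
    ⇒VQ e false q = ⇒⌊⌋ (inQ? _) (e , q , inj₁ refl)
    ⇒VQ e true  q = ⇒⌊⌋ (inQ? _) (e , q , inj₂ refl)

    VQ⇒dart : ∀ v → VQ v ≡ true → ∃₂ λ e s → EQ e ≡ true × end e s ≡ v
    VQ⇒dart v x with ⌊⌋⇒ (inQ? v) x
    ... | e , q , inj₁ p = e , false , q , p
    ... | e , q , inj₂ p = e , true  , q , p

    VQ⇒X : ∀ v → VQ v ≡ true → X v ≡ true
    VQ⇒X v x with VQ⇒dart v x
    ... | e , s , q , refl = edge-false e s (EQ⇒ e q s) (EQ⇒ e q (not s))

    -- On an edge with two different labels this is the side labelled true; `Arc` singles out these
    -- edges.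
    o : Fin size → Bool
    o e = N e true

    tail head : Fin size → Fin order
    tail e = end e (o e)
    head e = end e (not (o e))

    Arc : Fin size → Set
    Arc e = N e (o e) ≡ true × N e (not (o e)) ≡ false

    arc? : ∀ e → Dec (Arc e)
    arc? e = N e (o e) ≟ᵇ true ×-dec N e (not (o e)) ≟ᵇ false

    mixed⇒arc : ∀ e s → N e s ≡ true → N e (not s) ≡ false → Arc e × s ≡ o e
    mixed⇒arc e true  p q = subst (λ b → N e b ≡ true × N e (not b) ≡ false) (sym p) (p , q) , sym p
    mixed⇒arc e false p q = subst (λ b → N e b ≡ true × N e (not b) ≡ false) (sym q) (p , q) , sym q

    arc-X : ∀ e → Arc e → X (tail e) ≡ true
    arc-X e (p , q) = mixed⇒X e (o e) p q

    -- At a vertex of `X` the true dart is unique, and this is the only arc leaving the vertex.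
    out : Fin order → Fin size
    out v = proj₁ (true-dart v)

    next : Fin order → Fin order
    next v = head (out v)

    out-arc : ∀ v → X v ≡ true → Arc (out v) × tail (out v) ≡ v
    out-arc v x with true-dart v
    ... | e , s , refl , n with mixed⇒arc e s n (X⇒mixed e s x n)
    ...   | a , p = a , cong (end e) (sym p)

    out-tail : ∀ e → Arc e → out (tail e) ≡ e
    out-tail e a@(n , _) with true-dart (tail e)
    ... | e′ , s′ , p , n′ = proj₁ (true-unique e′ s′ e (o e) (trans (cong X p) (arc-X e a)) p n′ n)

    -- Following arcs from v, one meets Q for the first time after k steps.
    At : ℕ → Fin order → Set
    At zero    v = VQ v ≡ true
    At (suc k) v = (X v ≡ true × VQ v ≡ false) × At k (next v)

    at? : ∀ k v → Dec (At k v)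
    at? zero    v = VQ v ≟ᵇ true
    at? (suc k) v = (X v ≟ᵇ true ×-dec VQ v ≟ᵇ false) ×-dec at? k (next v)

    at-unique : ∀ {j k v} → At j v → At k v → j ≡ k
    at-unique {zero}  {zero}  _ _ = refl
    at-unique {zero}  {suc k} q ((_ , ¬q) , _) = ⊥-elim (true≢false q ¬q)
    at-unique {suc j} {zero}  ((_ , ¬q) , _) q = ⊥-elim (true≢false q ¬q)
    at-unique {suc j} {suc k} (_ , p) (_ , q) = cong suc (at-unique p q)

    at-chain : ∀ {k v} → At k v → ∀ {j} → j ≤ k → ∃ (At j)
    at-chain {k} a j≤k with ℕ.m≤n⇒m<n∨m≡n j≤k
    at-chain {k} {v} a j≤k | inj₂ refl = v , a
    at-chain {suc k} (_ , a) j≤k | inj₁ (s≤s j≤k′) = at-chain a j≤k′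

    -- The vertices ahead of `v` realise all distances up to `k`, and distances are unique. The
    -- bound makes reachability of `Q` decidable and later terminates the search backwards.
    at-bound : ∀ {k v} → At k v → k < order
    at-bound {k} a = injective⇒≤ {f = f} λ {i} {j} eq →
      toℕ-injective (at-unique (proj₂ (c i)) (subst (At (toℕ j)) (sym eq) (proj₂ (c j))))
      where
      c : (i : Fin (suc k)) → ∃ (At (toℕ i))
      c i = at-chain a (ℕ.≤-pred (toℕ<n i))
      f : Fin (suc k) → Fin order
      f i = proj₁ (c i)

    reaches? : ∀ v → Dec (∃ λ (k : Fin order) → At (toℕ k) v)
    reaches? v = any? λ k → at? (toℕ k) v

    A : Sub (Fin order)
    A v = ⌊ reaches? v ⌋

    A⇒ : ∀ v → A v ≡ true → ∃ λ k → At k v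
    A⇒ v a with ⌊⌋⇒ (reaches? v) a
    ... | k , p = toℕ k , p

    ⇒A : ∀ {k v} → At k v → A v ≡ true
    ⇒A {k} {v} p = ⇒⌊⌋ (reaches? v)
      (fromℕ< (at-bound p) , subst (λ k → At k v) (sym (toℕ-fromℕ< (at-bound p))) p)

    at⇒X : ∀ {k v} → At k v → X v ≡ true
    at⇒X {zero}  q = VQ⇒X _ q
    at⇒X {suc k} ((x , _) , _) = x

    level : Fin order → ℕ
    level v with reaches? v
    ... | yes (k , _) = toℕ k
    ... | no _        = 0

    -- The junk value 0 of level is harmless, as nothing is required at 0.
    At⁺ : ℕ → Fin order → Set
    At⁺ zero    v = ⊤
    At⁺ (suc k) v = At (suc k) v

    at⇒at⁺ : ∀ {k v} → At k v → At⁺ k v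
    at⇒at⁺ {zero}  _ = tt
    at⇒at⁺ {suc k} a = a

    at⁺⇒at : ∀ {j k v} → j < k → At⁺ k v → At k v
    at⁺⇒at {k = suc k} _ a = a

    level-at⁺ : ∀ v → At⁺ (level v) v
    level-at⁺ v with reaches? v
    ... | yes (_ , p) = at⇒at⁺ p
    ... | no _        = tt

    level-at : ∀ {k v} → At k v → level v ≡ k
    level-at {k} {v} a with reaches? v | ⇒A a
    ... | yes (_ , p) | _ = at-unique p a

    -- Against an arc the distance grows by one, unless the tail is in `Q`, where it restarts at 0.
    arc-at : ∀ {k} e → Arc e → At k (head e) → ∃ λ j → At j (tail e) × (VQ (tail e) ≡ false → j ≡ suc k)
    arc-at {k} e a p with VQ (tail e) in q
    ... | true  = 0 , q , λ ()
    ... | false = suc k , ((arc-X e a , q) , subst (λ x → At k (head x)) (sym (out-tail e a)) p) ,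
                  λ _ → refl

    -- The selected entering arc, with `out v` as a default outside `X`. At a vertex of `Q` the
    -- false dart may lie on an edge of `Q`, so `π-arc` excludes these vertices.
    π : Fin order → Fin size
    π v = [ (λ x → proj₁ (false-dart v x)) , (λ _ → out v) ]′ (true⊎false (X v))

    π-arc : ∀ v → X v ≡ true → VQ v ≡ false → Arc (π v) × head (π v) ≡ v
    π-arc v x ¬q with true⊎false (X v)
    ... | inj₂ y = ⊥-elim (true≢false x y)
    ... | inj₁ y with false-dart v y
    ...   | e , s , refl , n with N e (not s) in m
    ...     | false = ⊥-elim (true≢false (⇒VQ e s (⇒EQ e s n m)) ¬q)
    ...     | true with mixed⇒arc e (not s) m (trans (cong (N e) (not-involutive s)) n)
    ...       | a , p = a , cong (end e) (trans (cong not (sym p)) (not-involutive s))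

    F : Sub (Fin size)
    F e = ⌊ arc? e ⌋ ∧ A (tail e)

    F⇒ : ∀ e → F e ≡ true → Arc e × ∃ λ k → At k (tail e)
    F⇒ e f = ⌊⌋⇒ (arc? e) (proj₁ (∧-split f)) , A⇒ _ (proj₂ (∧-split {⌊ arc? e ⌋} f))

    ⇒F : ∀ {k} e → Arc e → At k (tail e) → F e ≡ true
    ⇒F e a p = ∧-join (⇒⌊⌋ (arc? e) a) (⇒A p)

    out∈F : ∀ {k} v → At k v → F (out v) ≡ true
    out∈F {k} v p with out-arc v (at⇒X p)
    ... | a , t = ⇒F (out v) a (subst (At k) (sym t) p)

    open Oriented H F o using (DirectedWalk; OrientedPathFrom; d⁺; d⁻)

    -- The continuation of a path that has entered `w`, at distance `k` from `Q`, by the arc `e`: it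
    -- stops in `Q` or where another arc is selected.
    rest : ℕ → Fin order → Fin size → List (Fin size)
    rest zero    w e = []
    rest (suc k) w e with π w ≟ e
    ... | yes _ = out w ∷ rest k (next w) (out w)
    ... | no _  = []

    last : ℕ → Fin order → Fin size → Fin order
    last zero    w e = w
    last (suc k) w e with π w ≟ e
    ... | yes _ = last k (next w) (out w)
    ... | no _  = w

    rest-walk : ∀ k w e → At⁺ k w → DirectedWalk w (rest k w e) (last k w e)
    rest-walk zero    w e _ = refl
    rest-walk (suc k) w e p@((x , _) , p′) with π w ≟ e
    ... | no _  = refl
    ... | yes _ = ≡⇒T (out∈F w p) , proj₂ (out-arc w x) , rest-walk k (next w) (out w) (at⇒at⁺ p′)

    rest-tails : ∀ k w e {t} → At⁺ k w → t ∈ˡ map tail (rest k w e) → ∃ λ j → suc j ≤ k × At (suc j) t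
    rest-tails (suc k) w e p@((x , _) , p′) m with π w ≟ e
    rest-tails (suc k) w e p@((x , _) , p′) (here refl) | yes _ =
      k , ℕ.≤-refl , subst (At (suc k)) (sym (proj₂ (out-arc w x))) p
    rest-tails (suc k) w e p@((x , _) , p′) (there m) | yes _ with rest-tails k (next w) (out w) (at⇒at⁺ p′) m
    ... | j , j≤ , q = j , ℕ.m≤n⇒m≤1+n j≤ , q

    rest-heads : ∀ k w e {t} → At⁺ k w → t ∈ˡ map head (rest k w e) → ∃ λ j → j < k × At j t
    rest-heads (suc k) w e (_ , p′) m with π w ≟ e
    rest-heads (suc k) w e (_ , p′) (here refl) | yes _ = k , ℕ.≤-refl , p′
    rest-heads (suc k) w e (_ , p′) (there m) | yes _ with rest-heads k (next w) (out w) (at⇒at⁺ p′) m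
    ... | j , j< , q = j , ℕ.m≤n⇒m≤1+n j< , q

    rest-tails-unique : ∀ k w e → At⁺ k w → Unique (map tail (rest k w e))
    rest-tails-unique zero    w e _ = []
    rest-tails-unique (suc k) w e p@((x , _) , p′) with π w ≟ e
    ... | no _  = []
    ... | yes _ = All.tabulate (λ m eq → case rest-tails k (next w) (out w) (at⇒at⁺ p′) m of
        λ { (j , j≤ , q) → ℕ.<⇒≢ (s≤s j≤) (at-unique q
              (subst (At (suc k)) (trans (sym (proj₂ (out-arc w x))) eq) p)) })
      ∷ rest-tails-unique k (next w) (out w) (at⇒at⁺ p′)

    rest-heads-unique : ∀ k w e → At⁺ k w → Unique (map head (rest k w e))
    rest-heads-unique zero    w e _ = []
    rest-heads-unique (suc k) w e p@(_ , p′) with π w ≟ e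
    ... | no _  = []
    ... | yes _ = All.tabulate (λ m eq → case rest-heads k (next w) (out w) (at⇒at⁺ p′) m of
        λ { (j , j< , q) → ℕ.<⇒≢ j< (at-unique q (subst (At k) eq p′)) })
      ∷ rest-heads-unique k (next w) (out w) (at⇒at⁺ p′)

    pathArcs : Fin order → List (Fin size)
    pathArcs v = out v ∷ rest (level (next v)) (next v) (out v)

    path : (x : Σ (Fin order) (_∈ VQ)) → OrientedPathFrom (proj₁ x)
    path (v , v∈) = record
      { arcs  = pathArcs v
      ; final = last (level w) w (out v)
      ; walk  = ≡⇒T (out∈F v q) , t≡ , rest-walk (level w) w (out v) (level-at⁺ w)
      -- The distance to `Q` decreases strictly along the continuation and is positive at its tails,
      -- whereas the start has distance 0.
      ; unique-tails =
          All.tabulate (λ m eq → case rest-tails (level w) w (out v) (level-at⁺ w) m of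
            λ { (j , _ , p) → case at-unique p (subst (At 0) (trans (sym t≡) eq) q) of λ () })
          ∷ rest-tails-unique (level w) w (out v) (level-at⁺ w)
      -- Later heads are strictly closer to `Q` than `next v`. The last head may well be the start:
      -- that is the closed path.
      ; unique-heads =
          All.tabulate (λ m eq → case rest-heads (level w) w (out v) (level-at⁺ w) m of
            λ { (j , j< , p) → ℕ.<⇒≢ j< (at-unique p (subst (At (level w)) eq (at⁺⇒at j< (level-at⁺ w)))) })
          ∷ rest-heads-unique (level w) w (out v) (level-at⁺ w)
      }
      where
      w = next v
      q : At 0 v
      q = T⇒≡ v∈
      t≡ : tail (out v) ≡ v
      t≡ = proj₂ (out-arc v (VQ⇒X v q))

    -- Stepping back from a vertex along selected arcs, one first meets `Q` at its root; the arc
    -- leaving the vertex belongs to the path of that root.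
    data Root : Fin order → Fin order → Set where
      here : ∀ {t} → VQ t ≡ true → Root t t
      step : ∀ {j t x} → At (suc j) t → Root (tail (π t)) x → Root t x

    root-unique : ∀ {t x y} → Root t x → Root t y → x ≡ y
    root-unique (here _)   (here _)   = refl
    root-unique (here q)   (step ((_ , ¬q) , _) _) = ⊥-elim (true≢false q ¬q)
    root-unique (step ((_ , ¬q) , _) _) (here q)   = ⊥-elim (true≢false q ¬q)
    root-unique (step _ r) (step _ s) = root-unique r s

    root-VQ : ∀ {t x} → Root t x → VQ x ≡ true
    root-VQ (here q)   = q
    root-VQ (step _ r) = root-VQ r

    -- Going backwards raises the distance to Q, which is bounded by at-bound.
    root-exists : ∀ n {k t} → At k t → order ≤ n + k → ∃ (Root t)
    root-exists zero    a le = ⊥-elim (ℕ.<⇒≱ (at-bound a) le)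
    root-exists (suc n) {zero}  {t} q le = t , here q
    root-exists (suc n) {suc k} {t} a@((x , ¬q) , _) le with π-arc t x ¬q
    ... | b , h with VQ (tail (π t)) in q
    ...   | true  = tail (π t) , step a (here q)
    ...   | false with arc-at (π t) b (subst (At (suc k)) (sym h) a)
    ...     | j , a′ , j≡ with root-exists n {suc (suc k)} (subst (λ j → At j _) (j≡ q) a′)
                                    (subst (order ≤_) (sym (ℕ.+-suc n (suc k))) le)
    ...       | x′ , r = x′ , step a r

    rest-first : ∀ {j w e} k → At (suc j) w → k ≡ suc j → π w ≡ e → out w ∈ˡ rest k w e
    rest-first {w = w} {e} (suc k) _ _ eq with π w ≟ e
    ... | yes _ = here refl
    ... | no ¬p = ⊥-elim (¬p eq)

    rest-succ : ∀ {j a} k w e → At⁺ k w → a ∈ˡ rest k w e → At (suc j) (head a) → π (head a) ≡ a →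
                out (head a) ∈ˡ rest k w e
    rest-succ (suc k) w e (_ , p′) m q r with π w ≟ e
    rest-succ (suc k) w e (_ , p′) (here refl) q r | yes _ = there (rest-first k q (at-unique p′ q) r)
    rest-succ (suc k) w e (_ , p′) (there m)   q r | yes _ =
      there (rest-succ k (next w) (out w) (at⇒at⁺ p′) m q r)

    path-succ : ∀ {j a} v → a ∈ˡ pathArcs v → At (suc j) (head a) → π (head a) ≡ a →
                out (head a) ∈ˡ pathArcs v
    path-succ v (here refl) q r = there (rest-first (level (next v)) q (level-at q) r)
    path-succ v (there m)   q r = there (rest-succ (level (next v)) (next v) (out v) (level-at⁺ _) m q r)

    root⇒path : ∀ {t x} → Root t x → out t ∈ˡ pathArcs x
    root⇒path (here _) = here refl
    root⇒path {x = x} (step {t = t} a@((y , ¬q) , _) r) with π-arc t y ¬q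
    ... | b , h = subst (λ w → out w ∈ˡ pathArcs x) h
      (path-succ x (subst (_∈ˡ pathArcs x) (out-tail _ b) (root⇒path r))
        (subst (At _) (sym h) a) (cong π h))

    rest-root : ∀ {x a} k w e → At⁺ k w → Root (tail e) x → a ∈ˡ rest k w e → Root (tail a) x
    rest-root (suc k) w e p@((y , _) , p′) r m with π w ≟ e
    rest-root {x} (suc k) w e p@((y , _) , p′) r m | yes eq = go m
      where
      r′ : Root (tail (out w)) x
      r′ = subst (λ t → Root t x) (sym (proj₂ (out-arc w y)))
             (step p (subst (λ e → Root (tail e) x) (sym eq) r))
      go : ∀ {a} → a ∈ˡ out w ∷ rest k (next w) (out w) → Root (tail a) x
      go (here refl) = r′
      go (there m)   = rest-root k (next w) (out w) (at⇒at⁺ p′) r′ m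

    path⇒root : ∀ {x a} → VQ x ≡ true → a ∈ˡ pathArcs x → Root (tail a) x
    path⇒root {x} q m = go m
      where
      r : Root (tail (out x)) x
      r = subst (λ t → Root t x) (sym (proj₂ (out-arc x (VQ⇒X x q)))) (here q)
      go : ∀ {a} → a ∈ˡ pathArcs x → Root (tail a) x
      go (here refl) = r
      go (there m)   = rest-root (level (next x)) (next x) (out x) (level-at⁺ _) r m

    -- An arc lies on the path of the root of its tail, and by `path⇒root` on no other.
    partition : ∀ e → e ∈ F → ∃! _≡_ λ (x : Σ (Fin order) (_∈ VQ)) → e ∈ˡ pathArcs (proj₁ x)
    partition e f with F⇒ e (T⇒≡ f)
    ... | a , k , p with root-exists order p (ℕ.m≤m+n order k)
    ...   | x , r = (x , ≡⇒T (root-VQ r)) , subst (_∈ˡ pathArcs x) (out-tail e a) (root⇒path r) ,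
      λ { {y , y∈} m → Σ-T-≡ {S = VQ} (root-unique r (path⇒root (T⇒≡ y∈) m)) }

    d⁺≡1 : ∀ {k v} → At k v → d⁺ v ≡ 1
    d⁺≡1 {k} {v} p = card-1 (count↔ _)
      (out v , ∧-join (out∈F v p) (⇒⌊⌋ (_ ≟ _) (proj₂ (out-arc v (at⇒X p)))))
      λ { (e , m) → ∃true-≡ (trans (sym (out-tail e (proj₁ (F⇒ e (proj₁ (∧-split m))))))
            (cong out (⌊⌋⇒ (_ ≟ _) (proj₂ (∧-split {F e} m))))) }

    Entering : Fin order → Set
    Entering v = ∃ λ e → (F e ∧ ⌊ head e ≟ v ⌋) ≡ true

    entering-F : ∀ {v} ((e , _) : Entering v) → F e ≡ true
    entering-F (e , m) = proj₁ (∧-split m)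

    entering-head : ∀ {v} ((e , _) : Entering v) → head e ≡ v
    entering-head (e , m) = ⌊⌋⇒ (_ ≟ _) (proj₂ (∧-split {F e} m))

    entering-N : ∀ {v} ((e , _) : Entering v) → N e (not (o e)) ≡ false
    entering-N i = proj₂ (proj₁ (F⇒ _ (entering-F i)))

    -- Heads of arcs are false darts, and `true-dart` supplies a dart that is not.
    d⁻<degree : ∀ v → d⁻ v < degree H v
    d⁻<degree v = subst (_≤ degree H v) (ℕ.+-comm (d⁻ v) 1)
      (card-≤ (card-⊎ (count↔ _) Fin1↔⊤) (degree↔ H v) f f-inj)
      where
      f : Entering v ⊎ ⊤ → Dart H everything v
      f (inj₁ i) = proj₁ i , not (o (proj₁ i)) , refl , entering-head i
      f (inj₂ _) = let e , s , p , _ = true-dart v in e , s , refl , p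
      clash : ∀ i → f (inj₁ i) ≡ f (inj₂ tt) → ⊥
      clash i eq with true-dart v
      clash i refl | e , s , p , n = true≢false n (entering-N i)
      f-inj : ∀ {x y} → f x ≡ f y → x ≡ y
      f-inj {inj₁ _} {inj₁ _} eq = cong inj₁ (∃true-≡ (cong proj₁ eq))
      f-inj {inj₁ i} {inj₂ _} eq = ⊥-elim (clash i eq)
      f-inj {inj₂ _} {inj₁ i} eq = ⊥-elim (clash i (sym eq))
      f-inj {inj₂ _} {inj₂ _} eq = refl

    -- The darts at `v` are the heads of entering arcs, the darts on edges of `Q`, and the tail of
    -- the arc leaving `v`. Every entering arc is in `F`, since its tail reaches `Q` too.
    degree-sum : ∀ {k v} → At k v → d⁻ v + degreeIn H EQ v + 1 ≡ degree H v
    degree-sum {k} {v} p = card-≡ (card-⊎ (card-⊎ (count↔ _) (degreeIn↔ H EQ v)) Fin1↔⊤) (degree↔ H v)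
      (bijective f f-inj f-surj)
      where
      x = at⇒X p
      f : (Entering v ⊎ Dart H EQ v) ⊎ ⊤ → Dart H everything v
      f (inj₁ (inj₁ i)) = proj₁ i , not (o (proj₁ i)) , refl , entering-head i
      f (inj₁ (inj₂ (e , s , _ , q))) = e , s , refl , q
      f (inj₂ _) = out v , o (out v) , refl , proj₂ (out-arc v x)
      label : Dart H everything v → Bool
      label (e , s , _) = N e s
      inQ : Dart H everything v → Bool
      inQ (e , _) = EQ e
      entering-Q : (i : Entering v) → EQ (proj₁ i) ≡ false
      entering-Q i with EQ (proj₁ i) in q
      ... | false = refl
      ... | true  = ⊥-elim (true≢false (proj₁ (proj₁ (F⇒ _ (entering-F i)))) (EQ⇒ _ q (o (proj₁ i))))
      label₁ : (y : Entering v ⊎ Dart H EQ v) → label (f (inj₁ y)) ≡ false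
      label₁ (inj₁ i) = entering-N i
      label₁ (inj₂ (e , s , q , _)) = EQ⇒ e q s
      label₂ : label (f (inj₂ tt)) ≡ true
      label₂ = proj₁ (proj₁ (out-arc v x))
      f-inj : ∀ {y z} → f y ≡ f z → y ≡ z
      f-inj {inj₁ (inj₁ _)} {inj₁ (inj₁ _)} eq = cong (inj₁ ∘ inj₁) (∃true-≡ (cong proj₁ eq))
      f-inj {inj₁ (inj₂ _)} {inj₁ (inj₂ _)} eq =
        cong (inj₁ ∘ inj₂) (dart-≡ H (cong proj₁ eq) (cong (proj₁ ∘ proj₂) eq))
      f-inj {inj₁ (inj₁ i)} {inj₁ (inj₂ (_ , _ , q , _))} eq =
        ⊥-elim (true≢false q (trans (cong inQ (sym eq)) (entering-Q i)))
      f-inj {inj₁ (inj₂ (_ , _ , q , _))} {inj₁ (inj₁ i)} eq =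
        ⊥-elim (true≢false q (trans (cong inQ eq) (entering-Q i)))
      f-inj {inj₁ y} {inj₂ _} eq = ⊥-elim (true≢false label₂ (trans (cong label (sym eq)) (label₁ y)))
      f-inj {inj₂ _} {inj₁ z} eq = ⊥-elim (true≢false label₂ (trans (cong label eq) (label₁ z)))
      f-inj {inj₂ _} {inj₂ _} eq = refl
      f-surj : ∀ d → ∃ λ y → f y ≡ d
      f-surj (e , s , refl , q) with N e s in n | N e (not s) in m
      ... | false | false = inj₁ (inj₂ (e , s , ⇒EQ e s n m , q)) , refl
      ... | false | true with mixed⇒arc e (not s) m (trans (cong (N e) (not-involutive s)) n)
      ...   | a , r with arc-at e a (subst (At k) (trans (sym q) (cong (end e) s≡)) p)
        where
        s≡ : s ≡ not (o e)
        s≡ = trans (sym (not-involutive s)) (cong not r)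
      ...     | _ , p′ , _ = inj₁ (inj₁ (e , ∧-join (⇒F e a p′)
          (⇒⌊⌋ (_ ≟ _) (trans (cong (end e) (sym s≡)) q)))) , dart-≡ H refl (sym s≡)
        where
        s≡ : s ≡ not (o e)
        s≡ = trans (sym (not-involutive s)) (cong not r)
      f-surj (e , s , refl , q) | true | _
        with mixed⇒arc e s n (X⇒mixed e s (trans (cong X q) x) n)
      ... | a , r = inj₂ tt , dart-≡ H out≡ (trans (cong o out≡) (sym r))
        where
        out≡ : out v ≡ e
        out≡ = trans (cong out (trans (sym q) (cong (end e) r))) (out-tail e a)

    inner-degreeIn : ∀ {k v} → At (suc k) v → degreeIn H EQ v ≡ 0
    inner-degreeIn {k} {v} ((_ , ¬q) , _) = card-≡ (degreeIn↔ H EQ v) (↔-id (Fin 0))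
      (mk↔ₛ′ (λ d → ⊥-elim (none d)) (λ ()) (λ ()) (λ d → ⊥-elim (none d)))
      where
      none : Dart H EQ v → ⊥
      none (e , s , q , refl) = true≢false (⇒VQ e s q) ¬q

    inner-at : ∀ {v} (y : Σ (Fin order) (_∈ VQ)) → OrientedPathFrom.Inner (path y) v → ∃ λ j → At (suc j) v
    inner-at (y , _) m with rest-tails (level (next y)) (next y) (out y) (level-at⁺ _) m
    ... | j , _ , p = j , p

    F-lower : ∀ e → e ∉ EQ → (∃ λ v → v ∈ VQ × Incident ⟦ H ⟧ e v) → e ∈ F
    F-lower e ¬q (v , v∈ , s , refl) with N e s in n | N e (not s) in m
    ... | false | false = ⊥-elim (¬q (≡⇒T (⇒EQ e s n m)))
    ... | false | true with mixed⇒arc e (not s) m (trans (cong (N e) (not-involutive s)) n)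
    ...   | a , r with arc-at {0} e a (trans (cong (VQ ∘ end e) (trans (cong not (sym r)) (not-involutive s))) (T⇒≡ v∈))
    ...     | _ , p , _ = ≡⇒T (⇒F e a p)
    F-lower e ¬q (v , v∈ , s , refl) | true | _
      with mixed⇒arc e s n (X⇒mixed e s (VQ⇒X _ (T⇒≡ v∈)) n)
    ... | a , r = ≡⇒T (⇒F {0} e a (trans (cong (VQ ∘ end e) (sym r)) (T⇒≡ v∈)))

    Q : Subgraph H
    Q = record { VQ = VQ ; EQ = EQ ; closed = λ e q s → ≡⇒T (⇒VQ e s (T⇒≡ q)) }

  labelling⇒good : HasGoodSubgraph H
  labelling⇒good = Q , record
    { nonempty    = let e , f = ff in
        end e false , ≡⇒T (⇒VQ e false (⇒EQ e false (f false) (f true)))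
    ; no-isolated = λ v v∈ → let e , s , q , p = VQ⇒dart v (T⇒≡ v∈) in e , ≡⇒T q , s , p
    ; F           = F
    ; F-lower     = F-lower
    ; F-upper     = λ e f q → let a , _ = F⇒ e (T⇒≡ f) in
        true≢false (proj₁ a) (EQ⇒ e (T⇒≡ q) (o e))
    ; o           = o
    ; path        = path
    ; partition   = partition
    ; initial-d⁺  = λ v v∈ → d⁺≡1 {0} (T⇒≡ v∈)
    ; initial-d⁻  = λ v v∈ → degree-sum {0} (T⇒≡ v∈)
    ; inner-d⁺    = λ x y i → d⁺≡1 (proj₂ (inner-at y i))
    ; inner-d⁻    = λ x y i → let p = proj₂ (inner-at y i) in
        trans (cong (_+ 1) (trans (sym (ℕ.+-identityʳ (d⁻ x))) (cong (d⁻ x +_) (sym (inner-degreeIn p)))))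
              (degree-sum p)
    ; final-d⁻    = λ y → d⁻<degree _
    }

-- Edge-minimal DP-pairs and contraction of stars

module _ (G : FinGraph) {F : Sub (Fin (FinGraph.size G))} {P : Sub (Fin (FinGraph.order G))}
         (sp : DPSplit ⟦ G ⟧ F P) (min : MinimalSplit ⟦ G ⟧ F) where
  open FinGraph G
  open DPSplit sp

  private
    Cross : Fin size → Bool → Set
    Cross e s = F e ≡ true × P (end e s) ≡ true × P (end e (not s)) ≡ false

    -- An unmatched edge must be indispensable for domination: otherwise `M` and the other
    -- dominators form a DP-pair on fewer edges.
    remove : ∀ e → F e ≡ true → M e ≡ false →
      (∀ v → P v ≡ true → ∃₂ λ x s → x ≢ e × F x ≡ true × end x s ≡ v × P (end x (not s)) ≡ false) →
      (∀ v → P v ≡ false → ∃₂ λ x s → x ≢ e × F x ≡ true × end x s ≡ v × P (end x (not s)) ≡ true) → ⊥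
    remove e f ¬m domᴰ domᴾ = min F′ (λ x f′ → proj₁ (∧-split f′)) e f removed P (record
      { dominatedᴰ = λ v p → let x , s , ne , f , r = domᴰ v p in x , s , keep ne f , r
      ; dominatedᴾ = λ v p → let x , s , ne , f , r = domᴾ v p in x , s , keep ne f , r
      ; M = M
      ; M⊆F = λ x m → keep (λ { refl → true≢false m ¬m }) (M⊆F x m)
      ; M-ends = M-ends ; M-loopless = M-loopless ; M-covers = M-covers ; M-unique = M-unique })
      where
      F′ : Sub (Fin size)
      F′ x = F x ∧ not ⌊ x ≟ e ⌋
      keep : ∀ {x} → x ≢ e → F x ≡ true → F′ x ≡ true
      keep {x} ne f = ∧-join f (cong not (⇒⌊⌋-no (x ≟ e) ne))
      removed : F′ e ≡ false
      removed = trans (cong (_∧ not ⌊ e ≟ e ⌋) f) (cong not (⇒⌊⌋ (e ≟ e) refl))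

    -- An edge inside `P` or inside the complement dominates nothing, so unless it is in `M` it can
    -- be removed.
    classify : ∀ e → F e ≡ true → M e ≡ true ⊎ ∃ (Cross e)
    classify e f with M e in m | P (end e false) in p | P (end e true) in q
    ... | true  | _     | _     = inj₁ refl
    ... | false | true  | false = inj₂ (false , f , p , q)
    ... | false | false | true  = inj₂ (true , f , q , p)
    ... | false | true  | true  = ⊥-elim (remove e f m
      (λ v Pv → let x , s , f , r , d = dominatedᴰ v Pv in
         x , s , (λ { refl → true≢false (both s) d }) , f , r , d)
      (λ v Pv → let x , s , f , r , d = dominatedᴾ v Pv in
         x , s , (λ { refl → true≢false (trans (sym (cong P r)) (both′ s)) Pv }) , f , r , d))
      where
      both : ∀ s → P (end e (not s)) ≡ true
      both false = q
      both true  = p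
      both′ : ∀ s → P (end e s) ≡ true
      both′ false = p
      both′ true  = q
    ... | false | false | false = ⊥-elim (remove e f m
      (λ v Pv → let x , s , f , r , d = dominatedᴰ v Pv in
         x , s , (λ { refl → true≢false Pv (trans (sym (cong P r)) (both′ s)) }) , f , r , d)
      (λ v Pv → let x , s , f , r , d = dominatedᴾ v Pv in
         x , s , (λ { refl → true≢false d (both s) }) , f , r , d))
      where
      both : ∀ s → P (end e (not s)) ≡ false
      both false = q
      both true  = p
      both′ : ∀ s → P (end e s) ≡ false
      both′ false = p
      both′ true  = q

    -- By `star` every cross edge is the only one at one of its ends, that is, the cross edges form
    -- disjoint stars.
    SoleP SoleD : Fin size → Bool → Set
    SoleP e s = ∀ x t → Cross x t → end x t ≡ end e s → x ≡ e
    SoleD e s = ∀ x t → Cross x t → end x (not t) ≡ end e (not s) → x ≡ e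

    side : ∀ {e s t} → Cross e s → P (end e t) ≡ true → t ≡ s
    side {e} {s} {t} (_ , _ , d) p with ≡⊎≡not t s
    ... | inj₁ eq   = eq
    ... | inj₂ refl = ⊥-elim (true≢false p d)

    side′ : ∀ {e s t} → Cross e s → P (end e t) ≡ false → t ≡ not s
    side′ {e} {s} {t} (_ , p , _) d with ≡⊎≡not t s
    ... | inj₁ refl = ⊥-elim (true≢false p d)
    ... | inj₂ eq   = eq

    -- If both ends had another cross edge, those edges would take over the domination and `e` could
    -- be removed.
    star : ∀ e s → Cross e s → SoleP e s ⊎ SoleD e s
    star e s c@(f , p , d) with dart? G B (end e s) | dart? G B′ (end e (not s))
      where
      B B′ : Fin size → Bool → Bool
      B  x t = (F x ∧ not (P (end x (not t)))) ∧ not ⌊ x ≟ e ⌋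
      B′ x t = (F x ∧ P (end x (not t))) ∧ not ⌊ x ≟ e ⌋
    ... | inj₂ none | _ = inj₁ λ x t (f′ , _ , d′) eq →
      decidable-stable (x ≟ e) λ ne → true≢false
        (∧-join (∧-join f′ (cong not d′)) (cong not (⇒⌊⌋-no (x ≟ e) ne))) (none x t eq)
    ... | inj₁ _ | inj₂ none = inj₂ λ x t (f′ , p′ , _) eq →
      decidable-stable (x ≟ e) λ ne → true≢false
        (∧-join (∧-join f′ (trans (cong (P ∘ end x) (not-involutive t)) p′))
                (cong not (⇒⌊⌋-no (x ≟ e) ne))) (none x (not t) eq)
    ... | inj₁ (x , t , eq , b) | inj₁ (x′ , t′ , eq′ , b′) = ⊥-elim (remove e f ¬m domᴰ domᴾ)
      where
      ¬m : M e ≡ false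
      ¬m = ¬-not λ m → true≢false (M-ends e m (not s)) d
      differs : ∀ {y a} → a ∧ not ⌊ y ≟ e ⌋ ≡ true → y ≢ e
      differs {y} {true} q refl = true≢false (⇒⌊⌋ (y ≟ e) refl) (not-true q)
      domᴰ : ∀ v → P v ≡ true → ∃₂ λ x s → x ≢ e × F x ≡ true × end x s ≡ v × P (end x (not s)) ≡ false
      domᴰ v Pv with dominatedᴰ v Pv
      ... | y , u , fy , r , dy with y ≟ e
      ...   | no ne    = y , u , ne , fy , r , dy
      ...   | yes refl with side {t = u} c (trans (cong P r) Pv)
      ...     | refl = x , t , differs {a = F x ∧ not (P (end x (not t)))} b ,
        proj₁ (∧-split (proj₁ (∧-split b))) , trans eq r ,
        not-true (proj₂ (∧-split {F x} (proj₁ (∧-split b))))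
      domᴾ : ∀ v → P v ≡ false → ∃₂ λ x s → x ≢ e × F x ≡ true × end x s ≡ v × P (end x (not s)) ≡ true
      domᴾ v Pv with dominatedᴾ v Pv
      ... | y , u , fy , r , dy with y ≟ e
      ...   | no ne    = y , u , ne , fy , r , dy
      ...   | yes refl with side′ {t = u} c (trans (cong P r) Pv)
      ...     | refl = x′ , t′ , differs {a = F x′ ∧ P (end x′ (not t′))} b′ ,
        proj₁ (∧-split (proj₁ (∧-split b′))) , trans eq′ r ,
        proj₂ (∧-split {F x′} (proj₁ (∧-split b′)))

    abstract
      neighbour : ∀ v → ∃₂ λ e s → F e ≡ true × end e s ≡ v × P (end e (not s)) ≡ not (P v)
      neighbour v = go (P v) refl
        where
        go : ∀ b → P v ≡ b → ∃₂ λ e s → F e ≡ true × end e s ≡ v × P (end e (not s)) ≡ not b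
        go true  = dominatedᴰ v
        go false = dominatedᴾ v

    nE : Fin order → Fin size
    nE v = proj₁ (neighbour v)

    nS : Fin order → Bool
    nS v = proj₁ (proj₂ (neighbour v))

    nb : Fin order → Fin order
    nb v = end (nE v) (not (nS v))

    nE∈F : ∀ v → F (nE v) ≡ true
    nE∈F v = proj₁ (proj₂ (proj₂ (neighbour v)))

    nE-end : ∀ v → end (nE v) (nS v) ≡ v
    nE-end v = proj₁ (proj₂ (proj₂ (proj₂ (neighbour v))))

    P-nb : ∀ v → P (nb v) ≡ not (P v)
    P-nb v = proj₂ (proj₂ (proj₂ (proj₂ (neighbour v))))

    cross-P : ∀ v → P v ≡ true → Cross (nE v) (nS v)
    cross-P v p = nE∈F v , trans (cong P (nE-end v)) p , trans (P-nb v) (cong not p)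

    cross-D : ∀ v → P v ≡ false → Cross (nE v) (not (nS v))
    cross-D v p = nE∈F v , trans (P-nb v) (cong not p) ,
      trans (cong (P ∘ end (nE v)) (not-involutive (nS v))) (trans (cong P (nE-end v)) p)

    nb-P : ∀ {e s} → Cross e s → nE (end e s) ≡ e → nb (end e s) ≡ end e (not s)
    nb-P {e} {s} c eq = trans (cong (λ t → end (nE (end e s)) (not t)) nS≡) (cong (λ x → end x (not s)) eq)
      where
      nS≡ : nS (end e s) ≡ s
      nS≡ = side c (trans (cong P (trans (cong (λ x → end x (nS (end e s))) (sym eq)) (nE-end _)))
                     (proj₁ (proj₂ c)))

    nb-D : ∀ {e s} → Cross e s → nE (end e (not s)) ≡ e → nb (end e (not s)) ≡ end e s
    nb-D {e} {s} c eq = trans (cong (λ t → end (nE (end e (not s))) (not t)) nS≡)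
      (trans (cong (λ x → end x (not (not s))) eq) (cong (end e) (not-involutive s)))
      where
      nS≡ : nS (end e (not s)) ≡ not s
      nS≡ = side′ c (trans (cong P (trans (cong (λ x → end x (nS (end e (not s)))) (sym eq)) (nE-end _)))
                     (proj₂ (proj₂ c)))

    end-D : ∀ v → end (nE v) (not (not (nS v))) ≡ v
    end-D v = trans (cong (end (nE v)) (not-involutive (nS v))) (nE-end v)

    abstract
      -- A canonical vertex outside `P` in the star of `v`: the middle of a star around a vertex
      -- outside `P`, and the neighbour chosen at the middle, hence a tip, if the middle is in `P`.
      centre : Fin order → Fin order
      centre v = if P v then nb v else nb (nb v)

      centre-P : ∀ v → P v ≡ true → centre v ≡ nb v
      centre-P v p = cong (if_then nb v else nb (nb v)) p

      centre-D : ∀ v → P v ≡ false → centre v ≡ nb (nb v)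
      centre-D v p = cong (if_then nb v else nb (nb v)) p

    P-centre : ∀ v → P (centre v) ≡ false
    P-centre v with true⊎false (P v)
    ... | inj₁ p = trans (cong P (centre-P v p)) (trans (P-nb v) (cong not p))
    ... | inj₂ p = trans (cong P (centre-D v p)) (trans (P-nb _) (cong not (trans (P-nb v) (cong not p))))

    -- If `e` is the only cross edge at its end `v` outside `P`, then `nb v` is the other end.
    -- Otherwise `e` is the only one at its end in `P`, so `nb` leads from there to `v`; whichever
    -- alternative holds for the edge chosen at `v`, applying `nb` twice returns to `v`.
    cross-centre : ∀ e s → Cross e s → centre (end e s) ≡ centre (end e (not s))
    cross-centre e s c@(f , p , d) = trans (centre-P _ p) (trans (go (star e s c)) (sym (centre-D _ d)))
      where
      v = end e (not s)
      go : SoleP e s ⊎ SoleD e s → nb (end e s) ≡ nb (nb v)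
      go (inj₂ sole) = cong nb (sym (nb-D c (sole (nE v) (not (nS v)) (cross-D v d) (end-D v))))
      go (inj₁ sole) = trans nb≡v (sym (back (star (nE v) (not (nS v)) (cross-D v d))))
        where
        nb≡v : nb (end e s) ≡ v
        nb≡v = nb-P c (sole (nE (end e s)) (nS (end e s)) (cross-P _ p) (nE-end _))
        back : SoleP (nE v) (not (nS v)) ⊎ SoleD (nE v) (not (nS v)) → nb (nb v) ≡ v
        back (inj₁ sole′) = trans (nb-P (cross-D v d)
          (sole′ (nE (nb v)) (nS (nb v)) (cross-P _ (proj₁ (proj₂ (cross-D v d)))) (nE-end _))) (end-D v)
        back (inj₂ sole′) = trans (cong nb (nb-D c (sym (sole′ e s c (sym (end-D v)))))) nb≡v

    centre-nb : ∀ v → centre (nb v) ≡ centre v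
    centre-nb v with true⊎false (P v)
    ... | inj₁ p = trans (sym (cross-centre _ _ (cross-P v p))) (cong centre (nE-end v))
    ... | inj₂ p = trans (cross-centre _ _ (cross-D v p)) (cong centre (end-D v))

    centre-centre : ∀ v → centre (centre v) ≡ centre v
    centre-centre v with true⊎false (P v)
    ... | inj₁ p = trans (cong centre (centre-P v p)) (centre-nb v)
    ... | inj₂ p = trans (cong centre (centre-D v p)) (trans (centre-nb _) (centre-nb v))

    abstract
      isCentre? : ∀ d → Dec (∃ λ v → centre v ≡ d)
      isCentre? d = any? λ v → centre v ≟ d

      centres : Sub (Fin order)
      centres d = ⌊ isCentre? d ⌋

      stars : ℕ
      stars = # centres

      root : Fin stars → Fin order
      root h = proj₁ (Inverse.to (count↔ centres) h)

      index : Fin order → Fin stars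
      index v = Inverse.from (count↔ centres) (centre v , ⇒⌊⌋ (isCentre? _) (v , refl))

      root-index : ∀ v → root (index v) ≡ centre v
      root-index v = cong proj₁ (Inverse.strictlyInverseˡ (count↔ centres) _)

      root-injective : ∀ {h h′} → root h ≡ root h′ → h ≡ h′
      root-injective eq = to-injective (count↔ centres) (∃true-≡ eq)

      root-centre : ∀ h → ∃ λ v → centre v ≡ root h
      root-centre h = ⌊⌋⇒ (isCentre? _) (proj₂ (Inverse.to (count↔ centres) h))

      links : ℕ
      links = # M

      edge : Fin links → Fin size
      edge i = proj₁ (Inverse.to (count↔ M) i)

      edge∈M : ∀ i → M (edge i) ≡ true
      edge∈M i = proj₂ (Inverse.to (count↔ M) i)

      edge-injective : ∀ {i j} → edge i ≡ edge j → i ≡ j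
      edge-injective eq = to-injective (count↔ M) (∃true-≡ eq)

      edge-surjective : ∀ e → M e ≡ true → ∃ λ i → edge i ≡ e
      edge-surjective e m = Inverse.from (count↔ M) (e , m) , cong proj₁ (Inverse.strictlyInverseˡ (count↔ M) _)

    index-cong : ∀ {v w} → centre v ≡ centre w → index v ≡ index w
    index-cong {v} {w} eq = root-injective (trans (root-index v) (trans eq (sym (root-index w))))

    index⇒centre : ∀ {v w} → index v ≡ index w → centre v ≡ centre w
    index⇒centre {v} {w} eq = trans (sym (root-index v)) (trans (cong root eq) (root-index w))

    centre-root : ∀ h → centre (root h) ≡ root h
    centre-root h with root-centre h
    ... | v , eq = trans (cong centre (sym eq)) (trans (centre-centre v) eq)

    P-root : ∀ h → P (root h) ≡ false
    P-root h = trans (cong P (sym (centre-root h))) (P-centre (root h))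

    index-root : ∀ h → index (root h) ≡ h
    index-root h = root-injective (trans (root-index _) (centre-root h))

    -- Stars become vertices and matching edges become edges. Each vertex of `P` is one dart, so the
    -- degree of a star is the number of its vertices in `P`.
    H : FinGraph
    H = record { order = stars ; size = links ; end = λ i s → index (end (edge i) s) }

    module H = FinGraph H

    P-edge : ∀ i s → P (end (edge i) s) ≡ true
    P-edge i s = M-ends (edge i) (edge∈M i) s

    dart-injective : ∀ {i s j t} → end (edge i) s ≡ end (edge j) t → i ≡ j × s ≡ t
    dart-injective {i} {s} {j} {t} eq
      with edge-injective {i} {j} (M-unique _ _ s t (edge∈M i) (edge∈M j) eq)
    ... | refl = refl , same s t eq
      where
      same : ∀ s t → end (edge i) s ≡ end (edge i) t → s ≡ t
      same false false _  = refl
      same true  true  _  = refl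
      same false true  eq = ⊥-elim (M-loopless _ (edge∈M i) eq)
      same true  false eq = ⊥-elim (M-loopless _ (edge∈M i) (sym eq))

    dart-at : ∀ v → P v ≡ true → ∃₂ λ i s → end (edge i) s ≡ v
    dart-at v p with M-covers v p
    ... | e , s , m , eq with edge-surjective e m
    ...   | i , refl = i , s , eq

    leaf-P : ∀ {h v w} → Leaf H h → P v ≡ true → P w ≡ true → index v ≡ h → index w ≡ h → v ≡ w
    leaf-P {h} {v} {w} ℓ p q a b with dart-at v p | dart-at w q
    ... | i , s , refl | j , t , refl with leaf⇒unique-dart H ℓ {i} {s} {j} {t} a b
    ...   | refl , refl = refl

    index-nb : ∀ v → index (nb v) ≡ index v
    index-nb v = index-cong (centre-nb v)

    -- The star has two vertices in `P`, and the edges chosen at both meet in the root. The one at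
    -- `u = nb v` is thus not alone at the root, so it is alone at `u`, and `v` is the root.
    ¬leaf-D : ∀ {h v} → ¬ Leaf H h → P v ≡ false → index v ≡ h → v ≡ root h
    ¬leaf-D {h} {v} ¬ℓ p refl with dart-at (nb v) (trans (P-nb v) (cong not p))
    ... | i , s , eq with ¬leaf⇒other-dart H ¬ℓ i s (trans (cong index eq) (index-nb v))
    ...   | j , t , at , ne = go (star (nE u) (nS u) (cross-P u Pu))
      where
      u = nb v
      w = end (edge j) t
      Pu : P u ≡ true
      Pu = trans (P-nb v) (cong not p)
      nb-u : nb u ≡ root (index v)
      nb-u = trans (sym (centre-P u Pu)) (trans (centre-nb v) (sym (root-index v)))
      nb-w : nb w ≡ root (index v)
      nb-w = trans (sym (centre-P w (P-edge j t))) (trans (index⇒centre at) (sym (root-index v)))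
      go : SoleP (nE u) (nS u) ⊎ SoleD (nE u) (nS u) → v ≡ root (index v)
      go (inj₁ sole) with sole (nE v) (not (nS v)) (cross-D v p) (sym (nE-end u))
      ... | same = trans (sym (end-D v)) (trans (sym (nb-P (cross-D v p) (sym same))) nb-u)
      go (inj₂ sole) with sole (nE w) (nS w) (cross-P w (P-edge j t)) (trans nb-w (sym nb-u))
      ... | same = ⊥-elim (ne (dart-injective (trans (sym (nE-end w)) (trans (cong₂ end same nS≡)
                     (trans (nE-end u) (sym eq))))))
        where
        nS≡ : nS w ≡ nS u
        nS≡ = side (cross-P u Pu) (trans (cong (λ x → P (end x (nS w))) (sym same))
                (trans (cong P (nE-end w)) (P-edge j t)))

    abstract
      members : Fin stars → Sub (Fin order)
      members h v = not (P v) ∧ ⌊ index v ≟ h ⌋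

      member⇒ : ∀ h v → members h v ≡ true → P v ≡ false × index v ≡ h
      member⇒ h v m = not-true (proj₁ (∧-split m)) , ⌊⌋⇒ (_ ≟ _) (proj₂ (∧-split {not (P v)} m))

      ⇒member : ∀ {h v} → P v ≡ false → index v ≡ h → members h v ≡ true
      ⇒member p q = ∧-join (cong not p) (⇒⌊⌋ (_ ≟ _) q)

      members# : Fin stars → ℕ
      members# h = # members h

      member : ∀ h → Fin (members# h) → Fin order
      member h i = proj₁ (Inverse.to (count↔ (members h)) i)

      P-member : ∀ h i → P (member h i) ≡ false
      P-member h i = proj₁ (member⇒ h _ (proj₂ (Inverse.to (count↔ (members h)) i)))

      index-member : ∀ h i → index (member h i) ≡ h
      index-member h i = proj₂ (member⇒ h (member h i) (proj₂ (Inverse.to (count↔ (members h)) i)))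

      member-surjective : ∀ h v → P v ≡ false → index v ≡ h → ∃ λ i → member h i ≡ v
      member-surjective h v p q = Inverse.from (count↔ (members h)) (v , ⇒member p q) ,
        cong proj₁ (Inverse.strictlyInverseˡ (count↔ (members h)) _)

      member-injective : ∀ h {i j} → member h i ≡ member h j → i ≡ j
      member-injective h eq = to-injective (count↔ (members h)) (∃true-≡ eq)

    -- For a star that is a leaf of `H` its vertices outside `P` are the copies; the root is one of
    -- them, so their number is positive.
    α : LeafFunction H
    α h _ = members# h , positive (proj₁ (member-surjective h (root h) (P-root h) (index-root h)))
      where
      positive : ∀ {n} → Fin n → 1 ≤ n
      positive {suc n} _ = s≤s z≤n

    fV : S₂-Vertex H α → Fin order
    fV (old h _)    = root h
    fV (copy h _ i) = member h i
    fV (new i s)    = end (edge i) s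

    fV-injective : ∀ {x y} → fV x ≡ fV y → x ≡ y
    fV-injective {old h _} {old h′ _} eq with root-injective {h} {h′} eq
    ... | refl = refl
    fV-injective {old h n} {copy h′ ℓ i} eq
      with trans (sym (index-root h)) (trans (cong index eq) (index-member h′ i))
    ... | refl = Irr.⊥-elim (n ℓ)
    fV-injective {old h _} {new i s} eq = ⊥-elim (true≢false (P-edge i s) (trans (cong P (sym eq)) (P-root h)))
    fV-injective {copy h′ ℓ i} {old h n} eq
      with trans (sym (index-root h)) (trans (cong index (sym eq)) (index-member h′ i))
    ... | refl = Irr.⊥-elim (n ℓ)
    fV-injective {copy h _ i} {copy h′ _ j} eq
      with trans (sym (index-member h i)) (trans (cong index eq) (index-member h′ j))
    ... | refl = cong (copy h _) (member-injective h eq)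
    fV-injective {copy h _ j} {new i s} eq = ⊥-elim (true≢false (P-edge i s) (trans (cong P (sym eq)) (P-member h j)))
    fV-injective {new i s} {old h _} eq = ⊥-elim (true≢false (P-edge i s) (trans (cong P eq) (P-root h)))
    fV-injective {new i s} {copy h _ j} eq = ⊥-elim (true≢false (P-edge i s) (trans (cong P eq) (P-member h j)))
    fV-injective {new i s} {new j t} eq with dart-injective {i} {s} {j} {t} eq
    ... | refl , refl = refl

    fV-surjective : ∀ v → ∃ λ x → fV x ≡ v
    fV-surjective v with true⊎false (P v)
    ... | inj₁ p = let i , s , eq = dart-at v p in new i s , eq
    ... | inj₂ p with leaf? H (index v)
    ...   | yes ℓ = let i , eq = member-surjective (index v) v p refl in copy (index v) ℓ i , eq
    ...   | no ¬ℓ = old (index v) ¬ℓ , sym (¬leaf-D ¬ℓ p refl)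

    -- Outside the matching all edges of `F` are cross edges: in a leaf star each is the one chosen
    -- at its end outside `P`, in any other star the one chosen at its end in `P`.
    fE : S₂-Edge H α → Fin size
    fE (middle i)        = edge i
    fE (outer i s _)     = nE (end (edge i) s)
    fE (pendant i s _ j) = nE (member (H.end i s) j)

    fE∈F : ∀ x → F (fE x) ≡ true
    fE∈F (middle i)        = M⊆F _ (edge∈M i)
    fE∈F (outer i s _)     = nE∈F _
    fE∈F (pendant i s _ j) = nE∈F _

    edge≢nE : ∀ i v → edge i ≢ nE v
    edge≢nE i v eq with true⊎false (P v)
    ... | inj₁ p = true≢false (P-edge i (not (nS v)))
                     (trans (cong (λ e → P (end e (not (nS v)))) eq) (trans (P-nb v) (cong not p)))
    ... | inj₂ p = true≢false (P-edge i (nS v))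
                     (trans (cong (λ e → P (end e (nS v))) eq) (trans (cong P (nE-end v)) p))

    nE-same-side : ∀ {v w} → P v ≡ P w → nE v ≡ nE w → v ≡ w
    nE-same-side {v} {w} p eq = trans (sym (nE-end v)) (trans (cong₂ end eq nS≡) (nE-end w))
      where
      nS≡ : nS v ≡ nS w
      nS≡ with ≡⊎≡not (nS v) (nS w)
      ... | inj₁ q = q
      ... | inj₂ q = ⊥-elim (s≢not-s (P v) (trans (sym (cong P (trans (sym (cong₂ end eq q)) (nE-end v))))
                       (trans (P-nb w) (cong not (sym p)))))

    nE-other-side : ∀ {v w} → P v ≡ true → P w ≡ false → nE v ≡ nE w → v ≡ nb w
    nE-other-side {v} {w} p q eq = trans (sym (nE-end v)) (cong₂ end eq
      (side (cross-D w q) (trans (cong (λ e → P (end e (nS v))) (sym eq)) (trans (cong P (nE-end v)) p))))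

    outer-pendant : ∀ i s j t k → .(¬ Leaf H (H.end i s)) → .(Leaf H (H.end j t)) →
                    nE (end (edge i) s) ≢ nE (member (H.end j t) k)
    outer-pendant i s j t k n ℓ eq = Irr.⊥-elim (n (trans (cong (degree H) same) ℓ))
      where
      same : H.end i s ≡ H.end j t
      same = trans (cong index (nE-other-side (P-edge i s) (P-member _ k) eq))
               (trans (index-nb _) (index-member _ k))

    fE-injective : ∀ {x y} → fE x ≡ fE y → x ≡ y
    fE-injective {middle i} {middle j} eq = cong middle (edge-injective eq)
    fE-injective {middle i} {outer _ _ _} eq = ⊥-elim (edge≢nE i _ eq)
    fE-injective {middle i} {pendant _ _ _ _} eq = ⊥-elim (edge≢nE i _ eq)
    fE-injective {outer _ _ _} {middle i} eq = ⊥-elim (edge≢nE i _ (sym eq))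
    fE-injective {pendant _ _ _ _} {middle i} eq = ⊥-elim (edge≢nE i _ (sym eq))
    fE-injective {outer i s _} {outer j t _} eq
      with dart-injective {i} {s} {j} {t} (nE-same-side (trans (P-edge i s) (sym (P-edge j t))) eq)
    ... | refl , refl = refl
    fE-injective {outer i s n} {pendant j t ℓ k} eq = ⊥-elim (outer-pendant i s j t k n ℓ eq)
    fE-injective {pendant j t ℓ k} {outer i s n} eq = ⊥-elim (outer-pendant i s j t k n ℓ (sym eq))
    fE-injective {pendant i s ℓ j} {pendant i′ s′ _ j′} eq = same-pendant
      (nE-same-side (trans (P-member _ j) (sym (P-member _ j′))) eq)
      where
      same-pendant : member (H.end i s) j ≡ member (H.end i′ s′) j′ →
                     pendant i s _ j ≡ pendant i′ s′ _ j′
      same-pendant eq with leaf⇒unique-dart H (recompute (leaf? H _) ℓ) {i} {s} {i′} {s′} refl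
        (trans (sym (index-member _ j′)) (trans (cong index (sym eq)) (index-member _ j)))
      ... | refl , refl = cong (pendant i s _) (member-injective _ eq)

    fE-surjective : ∀ e → F e ≡ true → ∃ λ x → fE x ≡ e
    fE-surjective e f with classify e f
    ... | inj₁ m = let i , eq = edge-surjective e m in middle i , eq
    ... | inj₂ (s , c@(_ , p , d)) with dart-at (end e s) p
    ...   | i , t , at with leaf? H (H.end i t)
    ...     | no ¬ℓ = outer i t ¬ℓ , trans (cong nE at) (go (star e s c))
      where
      go : SoleP e s ⊎ SoleD e s → nE (end e s) ≡ e
      go (inj₁ sole) = sole _ (nS (end e s)) (cross-P _ p) (nE-end _)
      go (inj₂ sole) = sole _ (nS (end e s)) (cross-P _ p)
        (trans (sym (centre-P _ p)) (trans (cong centre (sym at)) (trans (sym (root-index _))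
          (sym (¬leaf-D ¬ℓ d (trans (index-cong (sym (cross-centre e s c))) (cong index (sym at))))))))
    ...     | yes ℓ with member-surjective (H.end i t) (end e (not s)) d
                          (trans (index-cong (sym (cross-centre e s c))) (cong index (sym at)))
    ...       | j , eq = pendant i t ℓ j , trans (cong nE eq) (go (star e s c))
      where
      v = end e (not s)
      go : SoleP e s ⊎ SoleD e s → nE v ≡ e
      go (inj₂ sole) = sole _ (not (nS v)) (cross-D v d) (end-D v)
      go (inj₁ sole) = sole _ (not (nS v)) (cross-D v d)
        (leaf-P ℓ (trans (P-nb v) (cong not d)) p
          (trans (index-nb v) (trans (index-cong (sym (cross-centre e s c))) (cong index (sym at))))
          (cong index (sym at)))

    align : (f g : Bool → Fin order) (b : Bool) → f b ≡ g false → f (not b) ≡ g true →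
            (∀ t → f t ≡ g t) ⊎ (∀ t → f t ≡ g (not t))
    align f g false p q = inj₁ λ { false → p ; true → q }
    align f g true  p q = inj₂ λ { false → q ; true → p }

    f-ends : ∀ x → (∀ t → end (fE x) t ≡ fV (Multigraph.end (S₂ H α) x t)) ⊎
                   (∀ t → end (fE x) t ≡ fV (Multigraph.end (S₂ H α) x (not t)))
    f-ends (middle i) = inj₁ λ _ → refl
    f-ends x@(outer i s _) = align (end (fE x)) (fV ∘ Multigraph.end (S₂ H α) x) (nS v)
        (nE-end v) (trans (sym (centre-P v (P-edge i s))) (sym (root-index v)))
      where v = end (edge i) s
    f-ends x@(pendant i s ℓ j) = align (end (fE x)) (fV ∘ Multigraph.end (S₂ H α) x) (not (nS v))
        (leaf-P (recompute (leaf? H _) ℓ) (trans (P-nb v) (cong not (P-member _ j))) (P-edge i s)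
          (trans (index-nb v) (index-member _ j)) refl)
        (end-D v)
      where
      v = member (H.end i s) j

    no-isolated-H : NoIsolatedVertex ⟦ H ⟧
    no-isolated-H h with dart-at (nb (root h)) (trans (P-nb _) (cong not (P-root h)))
    ... | i , s , eq = i , s , trans (cong index eq) (trans (index-nb _) (index-root h))

  abstract
    minimalSplit⇒twoSubdivided : TwoSubdivided (spanning ⟦ G ⟧ F)
    minimalSplit⇒twoSubdivided = H , no-isolated-H , α , ≅-sym (record
      { onV = bijective fV fV-injective fV-surjective
      ; onE = bijective (λ x → fE x , ≡⇒T (fE∈F x)) (λ eq → fE-injective (cong proj₁ eq))
                (λ { (e , f) → let x , eq = fE-surjective e (T⇒≡ f) in x , Σ-T-≡ {S = F} eq })
      ; preserves-ends = f-ends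
      })

-- Connectedness and the original DP-pair of S₂(H)

module _ {H : FinGraph} (α : LeafFunction H) where
  open FinGraph H

  -- Contracting outer and pendant edges turns a walk of S₂(H) into a walk of `H`.
  S₂-connected⇒ : NoIsolatedVertex ⟦ H ⟧ → Connected (S₂ H α) → Connected ⟦ H ⟧
  S₂-connected⇒ noiso con u v with noiso u | noiso v
  ... | e , s , refl | e′ , s′ , refl = project (con (new e s) (new e′ s′))
    where
    project : ∀ {x y} → Star (Adjacent (S₂ H α)) x y → Star (Adjacent ⟦ H ⟧) (projection α x) (projection α y)
    project ε = ε
    project ((middle e , s , refl , refl) ◅ p) = (e , s , refl , refl) ◅ project p
    project ((outer _ _ _ , false , refl , refl) ◅ p) = project p
    project ((outer _ _ _ , true , refl , refl) ◅ p) = project p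
    project ((pendant _ _ _ _ , false , refl , refl) ◅ p) = project p
    project ((pendant _ _ _ _ , true , refl , refl) ◅ p) = project p

  trivial-labelling : NoIsolatedVertex ⟦ H ⟧ → Labelling H
  trivial-labelling noiso = record
    { N = λ _ _ → true ; X = λ _ → false
    ; true-dart = λ v → let e , s , p = noiso v in e , s , p , refl
    ; true-unique = λ _ _ _ _ () ; false-dart = λ _ () ; edge-true = λ _ _ _ → refl
    ; edge-false = λ _ _ () }

  S₂-DPSplit : NoIsolatedVertex ⟦ H ⟧ → DPSplit (S₂ H α) everything (Vⁿ H α)
  S₂-DPSplit noiso = record
    { dominatedᴰ = λ v p → let e , s , _ , q , d = dominatedᴰ v (trans (same v) p) in
        e , s , refl , q , trans (sym (same _)) d
    ; dominatedᴾ = λ v p → let e , s , _ , q , d = dominatedᴾ v (trans (same v) p) in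
        e , s , refl , q , trans (sym (same _)) d
    ; M = M ; M⊆F = λ _ _ → refl
    ; M-ends = λ e m s → trans (sym (same _)) (M-ends e m s)
    ; M-loopless = M-loopless
    ; M-covers = λ v p → M-covers v (trans (same v) p) ; M-unique = M-unique }
    where
    open DPSplit (labelling⇒DPSplit α (trivial-labelling noiso))
    same : ∀ x → labelled α (trivial-labelling noiso) x ≡ Vⁿ H α x
    same (old _ _)    = refl
    same (copy _ _ _) = refl
    same (new _ _)    = refl

-- Connected 2-regular H

cycle-step : ∀ n → .{{NonZero n}} → Fin n → Fin n
cycle-step n i = suc (toℕ i) mod n

flip : ∀ {E : Set} → E × Bool → E × Bool
flip (e , s) = e , not s

flip-flip : ∀ {E : Set} (d : E × Bool) → flip (flip d) ≡ d
flip-flip (e , s) = cong (e ,_) (not-involutive s)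

flip-≢ : ∀ {E : Set} (d : E × Bool) → d ≢ flip d
flip-≢ (e , s) eq = s≢not-s s (cong proj₂ eq)

flip-swap : ∀ {E : Set} {d d′ : E × Bool} → flip d ≡ d′ → d ≡ flip d′
flip-swap {d = d} eq = trans (sym (flip-flip d)) (cong flip eq)

-- Position 3i + r on a cycle of length 3k is the pair (i, r) given by `remQuot 3`: for r = 0 the
-- old vertex at the start of the `i`-th dart, for r = 1 and 2 the new vertices on its edge.
triangle-step : ∀ {k} → (Fin k → Fin k) → Fin k × Fin 3 → Fin k × Fin 3
triangle-step next (i , zero)           = i , suc zero
triangle-step next (i , suc zero)       = i , suc (suc zero)
triangle-step next (i , suc (suc zero)) = next i , zero

module _ {H : FinGraph} (α : LeafFunction H) (con : Connected ⟦ H ⟧) (nl : ∀ v → ¬ Leaf H v)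
         (k : ℕ) .{{_ : NonZero (k * 3)}} (next : Fin k → Fin k)
         (step : ∀ x → remQuot {k} 3 (cycle-step (k * 3) x) ≡ triangle-step next (remQuot 3 x))
         (start : Fin k) (d : Fin k → Fin (FinGraph.size H) × Bool) where
  open FinGraph H
  private
    at : Fin size × Bool → Fin order
    at (e , s) = end e s

  -- The third hypothesis makes the visited vertices closed under adjacency, so by connectedness the
  -- closed trail exhausts `H`; each of its edges contributes three edges to the cycle.
  closed-trail⇒cycle :
    (∀ i j → at (d i) ≡ at (d j) → i ≡ j) →
    (∀ i → at (flip (d i)) ≡ at (d (next i))) →
    (∀ x i → at x ≡ at (d i) → ∃ λ j → x ≡ d j ⊎ x ≡ flip (d j)) →
    (∀ i j → d i ≢ flip (d j)) →
    S₂ H α ≅ cycle (k * 3)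
  closed-trail⇒cycle at-inj at-next cover no-flip = ≅-sym (record
    { onV = bijective tV tV-inj tV-surj ↔-∘ *↔×
    ; onE = bijective tE tE-inj tE-surj ↔-∘ *↔×
    ; preserves-ends = λ x → preserve x (remQuot 3 x) refl
    })
    where
    e : Fin k → Fin size
    e i = proj₁ (d i)
    s : Fin k → Bool
    s i = proj₂ (d i)

    tV : Fin k × Fin 3 → S₂-Vertex H α
    tV (i , zero)           = old (at (d i)) (nl _)
    tV (i , suc zero)       = new (e i) (s i)
    tV (i , suc (suc zero)) = new (e i) (not (s i))

    tE : Fin k × Fin 3 → S₂-Edge H α
    tE (i , zero)           = outer (e i) (s i) (nl _)
    tE (i , suc zero)       = middle (e i)
    tE (i , suc (suc zero)) = outer (e i) (not (s i)) (nl _)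

    e-inj : ∀ {i j} → e i ≡ e j → i ≡ j
    e-inj {i} {j} eq with ≡⊎≡not (s i) (s j)
    ... | inj₁ q = at-inj i j (cong₂ end eq q)
    ... | inj₂ q = ⊥-elim (no-flip i j (cong₂ _,_ eq q))

    new-inj : ∀ {x y s t} → new {H} {α} x s ≡ new y t → x ≡ y × s ≡ t
    new-inj refl = refl , refl

    outer-inj : ∀ {x y s t} .{p : ¬ Leaf H (end x s)} .{q : ¬ Leaf H (end y t)} →
                outer {H} {α} x s p ≡ outer y t q → x ≡ y × s ≡ t
    outer-inj refl = refl , refl

    clash : ∀ {i j} → e i ≡ e j × s i ≡ not (s j) → ⊥
    clash {i} {j} (p , q) = no-flip i j (cong₂ _,_ p q)

    tV-inj : ∀ {x y} → tV x ≡ tV y → x ≡ y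
    tV-inj {i , zero} {j , zero} eq = cong (_, zero) (at-inj i j (cong (projection α) eq))
    tV-inj {i , suc zero} {j , suc zero} eq = cong (_, _) (e-inj (proj₁ (new-inj eq)))
    tV-inj {i , suc zero} {j , suc (suc zero)} eq = ⊥-elim (clash (new-inj eq))
    tV-inj {i , suc (suc zero)} {j , suc zero} eq = ⊥-elim (clash (new-inj (sym eq)))
    tV-inj {i , suc (suc zero)} {j , suc (suc zero)} eq = cong (_, _) (e-inj (proj₁ (new-inj eq)))
    tV-inj {i , zero} {j , suc zero} ()
    tV-inj {i , zero} {j , suc (suc zero)} ()
    tV-inj {i , suc zero} {j , zero} ()
    tV-inj {i , suc (suc zero)} {j , zero} ()

    tE-inj : ∀ {x y} → tE x ≡ tE y → x ≡ y
    tE-inj {i , zero} {j , zero} eq = cong (_, _) (e-inj (proj₁ (outer-inj eq)))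
    tE-inj {i , suc zero} {j , suc zero} eq = cong (_, _) (e-inj (middle-inj eq))
      where
      middle-inj : ∀ {x y} → middle {H} {α} x ≡ middle y → x ≡ y
      middle-inj refl = refl
    tE-inj {i , zero} {j , suc (suc zero)} eq = ⊥-elim (clash (outer-inj eq))
    tE-inj {i , suc (suc zero)} {j , zero} eq = ⊥-elim (clash (outer-inj (sym eq)))
    tE-inj {i , suc (suc zero)} {j , suc (suc zero)} eq = cong (_, _) (e-inj (proj₁ (outer-inj eq)))
    tE-inj {i , zero} {j , suc zero} ()
    tE-inj {i , suc zero} {j , zero} ()
    tE-inj {i , suc zero} {j , suc (suc zero)} ()
    tE-inj {i , suc (suc zero)} {j , suc zero} ()

    visited : ∀ {u v} → Star (Adjacent ⟦ H ⟧) u v → (∃ λ i → at (d i) ≡ u) → ∃ λ i → at (d i) ≡ v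
    visited ε i = i
    visited ((x , t , refl , refl) ◅ p) (i , q) with cover (x , t) i (sym q)
    ... | j , inj₁ r = visited p (next j , sym (trans (cong (at ∘ flip) r) (at-next j)))
    ... | j , inj₂ r = visited p (j , sym (cong at (trans (cong flip r) (flip-flip (d j)))))

    vertex : ∀ v → ∃ λ i → at (d i) ≡ v
    vertex v = visited (con (at (d start)) v) (start , refl)

    dart : ∀ x t → ∃ λ j → (x , t) ≡ d j ⊎ (x , t) ≡ flip (d j)
    dart x t with vertex (end x t)
    ... | i , q = cover (x , t) i (sym q)

    tV-surj : ∀ x → ∃ λ y → tV y ≡ x
    tV-surj (old v _) with vertex v
    ... | i , refl = (i , zero) , refl
    tV-surj (copy v ℓ _) = Irr.⊥-elim (nl v ℓ)
    tV-surj (new x t) with dart x t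
    ... | j , inj₁ refl = (j , suc zero) , refl
    ... | j , inj₂ refl = (j , suc (suc zero)) , refl

    tE-surj : ∀ x → ∃ λ y → tE y ≡ x
    tE-surj (middle x) with dart x true
    ... | j , inj₁ eq = (j , suc zero) , cong (middle ∘ proj₁) (sym eq)
    ... | j , inj₂ eq = (j , suc zero) , cong (middle ∘ proj₁) (sym eq)
    tE-surj (outer x t _) with dart x t
    ... | j , inj₁ refl = (j , zero) , refl
    ... | j , inj₂ refl = (j , suc (suc zero)) , refl
    tE-surj (pendant x t ℓ _) = Irr.⊥-elim (nl _ ℓ)

    old-cong : ∀ {v w} → v ≡ w → old {H} {α} v (nl _) ≡ old w (nl _)
    old-cong refl = refl

    stepV : ∀ x y → remQuot 3 x ≡ y → tV (remQuot 3 (cycle-step (k * 3) x)) ≡ tV (triangle-step next y)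
    stepV x y eq = cong tV (trans (step x) (cong (triangle-step next) eq))

    preserve : ∀ x y → remQuot 3 x ≡ y →
      (∀ t → Multigraph.end (S₂ H α) (tE y) t ≡ tV (remQuot 3 (Multigraph.end (cycle (k * 3)) x t))) ⊎
      (∀ t → Multigraph.end (S₂ H α) (tE y) t ≡ tV (remQuot 3 (Multigraph.end (cycle (k * 3)) x (not t))))
    preserve x y@(i , zero) eq = inj₂ λ
      { false → sym (stepV x y eq)
      ; true  → sym (cong tV eq) }
    preserve x y@(i , suc (suc zero)) eq = inj₁ λ
      { false → sym (cong tV eq)
      ; true  → trans (old-cong (at-next i)) (sym (stepV x y eq)) }
    preserve x y@(i , suc zero) eq with ≡⊎≡not (s i) false
    ... | inj₁ p = inj₁ λ
      { false → trans (cong (new (e i)) (sym p)) (sym (cong tV eq))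
      ; true  → trans (cong (new (e i)) (sym (cong not p))) (sym (stepV x y eq)) }
    ... | inj₂ p = inj₂ λ
      { false → trans (cong (new (e i)) (sym (cong not p))) (sym (stepV x y eq))
      ; true  → trans (cong (new (e i)) (sym p)) (sym (cong tV eq)) }

other-element : ∀ {n} {A : Set} → Fin n ↔ A → n ≡ 2 → (a : A) →
                ∃ λ b → b ≢ a × (∀ c → c ≡ a ⊎ c ≡ b)
other-element {A = A} i refl a = to (proj₁ o) , (λ eq → proj₁ (proj₂ o) (trans (sym (from∘to _)) (cong from eq))) ,
  λ c → [ (λ eq → inj₁ (from-injective i eq)) , (λ eq → inj₂ (trans (sym (to∘from c)) (cong to eq))) ]′
        (proj₂ (proj₂ o) (from c))
  where
  open Inverse i using (to; from) renaming (strictlyInverseˡ to to∘from; strictlyInverseʳ to from∘to)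
  otherFin : (x : Fin 2) → ∃ λ y → y ≢ x × (∀ z → z ≡ x ⊎ z ≡ y)
  otherFin zero       = suc zero , (λ ()) , λ { zero → inj₁ refl ; (suc zero) → inj₂ refl }
  otherFin (suc zero) = zero , (λ ()) , λ { zero → inj₂ refl ; (suc zero) → inj₁ refl }
  o = otherFin (from a)

-- Only k = 1, 2, 3 occur, so the compatibility of `remQuot` with the cyclic successor is decided by
-- evaluation.
triangle-step-1 : ∀ x → remQuot {1} 3 (cycle-step 3 x) ≡ triangle-step id (remQuot 3 x)
triangle-step-1 = toWitness {a? = all? λ x → ≡-dec _≟_ _≟_ (remQuot {1} 3 (cycle-step 3 x))
  (triangle-step id (remQuot 3 x))} tt

triangle-step-2 : ∀ x → remQuot {2} 3 (cycle-step 6 x) ≡ triangle-step (cycle-step 2) (remQuot 3 x)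
triangle-step-2 = toWitness {a? = all? λ x → ≡-dec _≟_ _≟_ (remQuot {2} 3 (cycle-step 6 x))
  (triangle-step (cycle-step 2) (remQuot 3 x))} tt

triangle-step-3 : ∀ x → remQuot {3} 3 (cycle-step 9 x) ≡ triangle-step (cycle-step 3) (remQuot 3 x)
triangle-step-3 = toWitness {a? = all? λ x → ≡-dec _≟_ _≟_ (remQuot {3} 3 (cycle-step 9 x))
  (triangle-step (cycle-step 3) (remQuot 3 x))} tt

module _ {H : FinGraph} (two : ∀ v → degree H v ≡ 2) where
  open FinGraph H

  private
    D : Set
    D = Fin size × Bool

    at : D → Fin order
    at (e , s) = end e s

    asDart : ∀ {v} (d : D) → at d ≡ v → Dart H everything v
    asDart (e , s) p = e , s , refl , p

    abstract
      other-dart : ∀ d → ∃ λ d′ → at d′ ≡ at d × d′ ≢ d × (∀ x → at x ≡ at d → x ≡ d ⊎ x ≡ d′)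
      other-dart d with other-element (degree↔ H (at d)) (two (at d)) (asDart d refl)
      ... | (e , s , r , p) , ne , all = (e , s) , p , (λ { refl → ne (dart-≡ H refl refl) }) ,
        λ x q → [ (λ eq → inj₁ (strip eq)) , (λ eq → inj₂ (strip eq)) ]′ (all (asDart x q))
        where
        strip : ∀ {v} {d d′ : Dart H everything v} → d ≡ d′ →
                (proj₁ d , proj₁ (proj₂ d)) ≡ (proj₁ d′ , proj₁ (proj₂ d′))
        strip refl = refl

    other : D → D
    other d = proj₁ (other-dart d)

    at-other : ∀ d → at (other d) ≡ at d
    at-other d = proj₁ (proj₂ (other-dart d))

    other-≢ : ∀ d → other d ≢ d
    other-≢ d = proj₁ (proj₂ (proj₂ (other-dart d)))

    dart-cases : ∀ {x} d → at x ≡ at d → x ≡ d ⊎ x ≡ other d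
    dart-cases {x} d = proj₂ (proj₂ (proj₂ (other-dart d))) x

  -- On a path v₀ v₁ v₂ v₃ of H the edge v₁v₂ is a good subgraph with paths v₁v₀ and v₂v₃.
  module _ (d₀ d₁ d₂ : D) (a₁ : at d₁ ≡ at (flip d₀)) (a₂ : at d₂ ≡ at (flip d₁))
           (n₁ : d₁ ≢ flip d₀) (n₂ : d₂ ≢ flip d₁)
           (v₁≢v₀ : at d₁ ≢ at d₀) (v₂≢v₀ : at d₂ ≢ at d₀) (v₂≢v₁ : at d₂ ≢ at d₁)
           (v₃≢v₀ : at (flip d₂) ≢ at d₀) (v₃≢v₁ : at (flip d₂) ≢ at d₁) (v₃≢v₂ : at (flip d₂) ≢ at d₂) where
    private
      f₀ = flip d₀
      f₁ = flip d₁
      f₂ = flip d₂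
      v₀ = at d₀
      v₁ = at d₁
      v₂ = at d₂
      v₃ = at f₂

      -- Both darts of the edge v₁v₂, and the heads of the two arcs, from v₁ to v₀ and from v₂ to
      -- v₃.
      False : D → Set
      False x = (x ≡ d₀ ⊎ x ≡ d₁) ⊎ (x ≡ f₁ ⊎ x ≡ f₂)

      false? : ∀ x → Dec (False x)
      false? x = (x ≟ᴰ d₀ ⊎-dec x ≟ᴰ d₁) ⊎-dec (x ≟ᴰ f₁ ⊎-dec x ≟ᴰ f₂)
        where _≟ᴰ_ = ≡-dec _≟_ _≟ᵇ_

      inX? : ∀ v → Dec (v ≡ v₁ ⊎ v ≡ v₂)
      inX? v = v ≟ v₁ ⊎-dec v ≟ v₂

      N : Fin size → Bool → Bool
      N e s = not ⌊ false? (e , s) ⌋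

      X : Fin order → Bool
      X v = ⌊ inX? v ⌋

      N-true : ∀ x → ¬ False x → N (proj₁ x) (proj₂ x) ≡ true
      N-true x n = cong not (⇒⌊⌋-no (false? x) n)

      N-false : ∀ x → False x → N (proj₁ x) (proj₂ x) ≡ false
      N-false x p = cong not (⇒⌊⌋ (false? x) p)

      N-true⇒ : ∀ x → N (proj₁ x) (proj₂ x) ≡ true → ¬ False x
      N-true⇒ x n p = true≢false n (N-false x p)

      N-false⇒ : ∀ x → N (proj₁ x) (proj₂ x) ≡ false → False x
      N-false⇒ x n with false? x
      ... | yes p = p

      off : ∀ {v} x → at x ≡ v → v ≢ v₀ → v ≢ v₁ → v ≢ v₂ → v ≢ v₃ → ¬ False x
      off x p a b c d (inj₁ (inj₁ refl)) = a (sym p)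
      off x p a b c d (inj₁ (inj₂ refl)) = b (sym p)
      off x p a b c d (inj₂ (inj₁ refl)) = c (trans (sym p) (sym a₂))
      off x p a b c d (inj₂ (inj₂ refl)) = d (sym p)

      ¬F-f₀ : ¬ False f₀
      ¬F-f₀ (inj₁ (inj₁ eq)) = flip-≢ d₀ (sym eq)
      ¬F-f₀ (inj₁ (inj₂ eq)) = n₁ (sym eq)
      ¬F-f₀ (inj₂ (inj₁ eq)) = v₂≢v₁ (trans a₂ (trans (cong at (sym eq)) (sym a₁)))
      ¬F-f₀ (inj₂ (inj₂ eq)) = v₃≢v₁ (trans (cong at (sym eq)) (sym a₁))

      ¬F-d₂ : ¬ False d₂
      ¬F-d₂ (inj₁ (inj₁ eq)) = v₂≢v₀ (cong at eq)
      ¬F-d₂ (inj₁ (inj₂ eq)) = v₂≢v₁ (cong at eq)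
      ¬F-d₂ (inj₂ (inj₁ eq)) = n₂ eq
      ¬F-d₂ (inj₂ (inj₂ eq)) = flip-≢ d₂ eq

      -- Here v₃ must differ from v₀: on a triangle the second dart at v₀ is `f₂`, and v₀ would have
      -- no true dart. This is where length three is the limit.
      ¬F-o₀ : ¬ False (other d₀)
      ¬F-o₀ (inj₁ (inj₁ eq)) = other-≢ d₀ eq
      ¬F-o₀ (inj₁ (inj₂ eq)) = v₁≢v₀ (trans (cong at (sym eq)) (at-other d₀))
      ¬F-o₀ (inj₂ (inj₁ eq)) = v₂≢v₀ (trans a₂ (trans (cong at (sym eq)) (at-other d₀)))
      ¬F-o₀ (inj₂ (inj₂ eq)) = v₃≢v₀ (trans (cong at (sym eq)) (at-other d₀))

      ¬F-o₃ : ¬ False (other f₂)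
      ¬F-o₃ (inj₁ (inj₁ eq)) = v₃≢v₀ (trans (sym (at-other f₂)) (cong at eq))
      ¬F-o₃ (inj₁ (inj₂ eq)) = v₃≢v₁ (trans (sym (at-other f₂)) (cong at eq))
      ¬F-o₃ (inj₂ (inj₁ eq)) = v₃≢v₂ (trans (sym (at-other f₂)) (trans (cong at eq) (sym a₂)))
      ¬F-o₃ (inj₂ (inj₂ eq)) = other-≢ f₂ eq

      at-v₁ : ∀ x → at x ≡ v₁ → ¬ False x → x ≡ f₀
      at-v₁ x p n with dart-cases d₁ p | dart-cases {f₀} d₁ (sym a₁)
      ... | inj₁ eq | _       = ⊥-elim (n (inj₁ (inj₂ eq)))
      ... | inj₂ _  | inj₁ eq = ⊥-elim (n₁ (sym eq))
      ... | inj₂ eq | inj₂ q  = trans eq (sym q)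

      at-v₂ : ∀ x → at x ≡ v₂ → ¬ False x → x ≡ d₂
      at-v₂ x p n with dart-cases {x} f₁ (trans p a₂) | dart-cases {d₂} f₁ a₂
      ... | inj₁ eq | _       = ⊥-elim (n (inj₂ (inj₁ eq)))
      ... | inj₂ _  | inj₁ eq = ⊥-elim (n₂ eq)
      ... | inj₂ eq | inj₂ q  = trans eq (sym q)

      true-dart′ : NoIsolatedVertex ⟦ H ⟧ → ∀ v → ∃₂ λ e s → end e s ≡ v × N e s ≡ true
      true-dart′ noiso v with v ≟ v₀ | v ≟ v₁ | v ≟ v₂ | v ≟ v₃
      ... | yes refl | _ | _ | _ = _ , _ , at-other d₀ , N-true _ ¬F-o₀
      ... | no _ | yes refl | _ | _ = _ , _ , sym a₁ , N-true f₀ ¬F-f₀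
      ... | no _ | no _ | yes refl | _ = _ , _ , refl , N-true d₂ ¬F-d₂
      ... | no _ | no _ | no _ | yes refl = _ , _ , at-other f₂ , N-true _ ¬F-o₃
      ... | no a | no b | no c | no d = let e , s , p = noiso v in
        e , s , p , N-true (e , s) (off (e , s) p a b c d)

      true-unique′ : ∀ e s e′ s′ → X (end e s) ≡ true → end e s ≡ end e′ s′ →
                     N e s ≡ true → N e′ s′ ≡ true → e ≡ e′ × s ≡ s′
      true-unique′ e s e′ s′ x eq n n′ with ⌊⌋⇒ (inX? _) x
      ... | inj₁ p = ,-injective (trans (at-v₁ _ p (N-true⇒ _ n)) (sym (at-v₁ _ (trans (sym eq) p) (N-true⇒ _ n′))))
      ... | inj₂ p = ,-injective (trans (at-v₂ _ p (N-true⇒ _ n)) (sym (at-v₂ _ (trans (sym eq) p) (N-true⇒ _ n′))))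

      false-dart′ : ∀ v → X v ≡ true → ∃₂ λ e s → end e s ≡ v × N e s ≡ false
      false-dart′ v x with ⌊⌋⇒ (inX? v) x
      ... | inj₁ refl = _ , _ , refl , N-false d₁ (inj₁ (inj₂ refl))
      ... | inj₂ refl = _ , _ , sym a₂ , N-false f₁ (inj₂ (inj₁ refl))

      edge-true′ : ∀ e s → N e s ≡ true → N e (not s) ≡ not (X (end e s))
      edge-true′ e s n with inX? (end e s)
      ... | yes (inj₁ p) = N-false _ (inj₁ (inj₁ (trans (cong flip (at-v₁ (e , s) p (N-true⇒ _ n))) (flip-flip d₀))))
      ... | yes (inj₂ p) = N-false _ (inj₂ (inj₂ (cong flip (at-v₂ (e , s) p (N-true⇒ _ n)))))
      ... | no ¬x = N-true _ λ
        { (inj₁ (inj₁ eq)) → ¬x (inj₁ (trans (cong at (flip-swap {d = e , s} eq)) (sym a₁)))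
        ; (inj₁ (inj₂ eq)) → N-true⇒ _ n (inj₂ (inj₁ (flip-swap eq)))
        ; (inj₂ (inj₁ eq)) → N-true⇒ _ n (inj₁ (inj₂ (trans (flip-swap eq) (flip-flip d₁))))
        ; (inj₂ (inj₂ eq)) → ¬x (inj₂ (cong at (trans (flip-swap {d = e , s} eq) (flip-flip d₂)))) }

      edge-false′ : ∀ e s → N e s ≡ false → N e (not s) ≡ false → X (end e s) ≡ true
      edge-false′ e s n n′ with N-false⇒ (e , s) n
      ... | inj₁ (inj₁ refl) = ⊥-elim (¬F-f₀ (N-false⇒ _ n′))
      ... | inj₁ (inj₂ refl) = ⇒⌊⌋ (inX? _) (inj₁ refl)
      ... | inj₂ (inj₁ refl) = ⇒⌊⌋ (inX? _) (inj₂ (sym a₂))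
      ... | inj₂ (inj₂ eq) = ⊥-elim (¬F-d₂ (subst False (trans (cong flip eq) (flip-flip d₂)) (N-false⇒ _ n′)))

    path⇒labelling : NoIsolatedVertex ⟦ H ⟧ → ∃ λ (L : Labelling H) → HasFalseEdge L
    path⇒labelling noiso = record
      { N = N ; X = X ; true-dart = true-dart′ noiso ; true-unique = true-unique′
      ; false-dart = false-dart′ ; edge-true = edge-true′ ; edge-false = edge-false′ } ,
      proj₁ d₁ , both (proj₂ d₁) (N-false d₁ (inj₁ (inj₂ refl))) (N-false f₁ (inj₂ (inj₁ refl)))
      where
      both : ∀ t → N (proj₁ d₁) t ≡ false → N (proj₁ d₁) (not t) ≡ false → ∀ s → N (proj₁ d₁) s ≡ false
      both t p q s with ≡⊎≡not s t
      ... | inj₁ refl = p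
      ... | inj₂ refl = q

  two-regular⇒cycle : (α : LeafFunction H) → Connected ⟦ H ⟧ → NoIsolatedVertex ⟦ H ⟧ →
    (∀ (L : Labelling H) → ¬ HasFalseEdge L) → Fin order →
    S₂ H α ≅ cycle 3 ⊎ S₂ H α ≅ cycle 6 ⊎ S₂ H α ≅ cycle 9
  two-regular⇒cycle α con noiso none v with noiso v
  ... | e , s , _ = walk₁
    where
    nl : ∀ v → ¬ Leaf H v
    nl v ℓ with trans (sym (two v)) ℓ
    ... | ()
    d₀ d₁ d₂ : D
    d₀ = e , s
    d₁ = other (flip d₀)
    d₂ = other (flip d₁)
    a₁ = at-other (flip d₀)
    a₂ = at-other (flip d₁)
    n₁ = other-≢ (flip d₀)
    n₂ = other-≢ (flip d₁)

    at-v₀ : ∀ {f x} → at f ≡ at d₀ → f ≢ d₀ → at x ≡ at d₀ → x ≡ d₀ ⊎ x ≡ f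
    at-v₀ {f} {x} p ne q with dart-cases d₀ p | dart-cases {x} d₀ q
    ... | inj₁ eq | _       = ⊥-elim (ne eq)
    ... | inj₂ _  | inj₁ eq = inj₁ eq
    ... | inj₂ eq | inj₂ r  = inj₂ (trans r (sym eq))

    flip-inj : ∀ {x y : D} → flip x ≡ flip y → x ≡ y
    flip-inj {x} {y} eq = trans (flip-swap eq) (flip-flip y)

    three : at d₁ ≢ at d₀ → at d₂ ≢ at d₀ → at d₂ ≢ at d₁ → at (flip d₂) ≡ at d₀ → S₂ H α ≅ cycle 9
    three v₁≢v₀ v₂≢v₀ v₂≢v₁ p = closed-trail⇒cycle α con nl 3 (cycle-step 3) triangle-step-3
      zero d inj nxt cover no-flip
      where
      d : Fin 3 → D
      d zero             = d₀
      d (suc zero)       = d₁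
      d (suc (suc zero)) = d₂
      f₂≢d₀ : flip d₂ ≢ d₀
      f₂≢d₀ eq = v₂≢v₁ (trans (cong at (flip-swap eq)) (sym a₁))
      inj : ∀ i j → at (d i) ≡ at (d j) → i ≡ j
      inj zero zero _ = refl
      inj (suc zero) (suc zero) _ = refl
      inj (suc (suc zero)) (suc (suc zero)) _ = refl
      inj zero (suc zero) eq = ⊥-elim (v₁≢v₀ (sym eq))
      inj zero (suc (suc zero)) eq = ⊥-elim (v₂≢v₀ (sym eq))
      inj (suc zero) zero eq = ⊥-elim (v₁≢v₀ eq)
      inj (suc zero) (suc (suc zero)) eq = ⊥-elim (v₂≢v₁ (sym eq))
      inj (suc (suc zero)) zero eq = ⊥-elim (v₂≢v₀ eq)
      inj (suc (suc zero)) (suc zero) eq = ⊥-elim (v₂≢v₁ eq)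
      nxt : ∀ i → at (flip (d i)) ≡ at (d (cycle-step 3 i))
      nxt zero             = sym a₁
      nxt (suc zero)       = sym a₂
      nxt (suc (suc zero)) = p
      cover : ∀ x i → at x ≡ at (d i) → ∃ λ j → x ≡ d j ⊎ x ≡ flip (d j)
      cover x zero q = [ (λ eq → zero , inj₁ eq) , (λ eq → suc (suc zero) , inj₂ eq) ]′ (at-v₀ p f₂≢d₀ q)
      cover x (suc zero) q = [ (λ eq → zero , inj₂ eq) , (λ eq → suc zero , inj₁ eq) ]′
        (dart-cases (flip d₀) (trans q a₁))
      cover x (suc (suc zero)) q = [ (λ eq → suc zero , inj₂ eq) , (λ eq → suc (suc zero) , inj₁ eq) ]′
        (dart-cases (flip d₁) (trans q a₂))
      no-flip : ∀ i j → d i ≢ flip (d j)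
      no-flip zero zero eq = flip-≢ d₀ eq
      no-flip zero (suc zero) eq = v₂≢v₀ (trans a₂ (cong at (sym eq)))
      no-flip zero (suc (suc zero)) eq = f₂≢d₀ (sym eq)
      no-flip (suc zero) zero eq = n₁ eq
      no-flip (suc zero) (suc zero) eq = flip-≢ d₁ eq
      no-flip (suc zero) (suc (suc zero)) eq = v₁≢v₀ (trans (cong at eq) p)
      no-flip (suc (suc zero)) zero eq = v₂≢v₁ (trans (cong at eq) (sym a₁))
      no-flip (suc (suc zero)) (suc zero) eq = n₂ eq
      no-flip (suc (suc zero)) (suc (suc zero)) eq = flip-≢ d₂ eq

    twoCycle : at d₁ ≢ at d₀ → at (flip d₁) ≡ at d₀ → S₂ H α ≅ cycle 6
    twoCycle v₁≢v₀ p = closed-trail⇒cycle α con nl 2 (cycle-step 2) triangle-step-2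
      zero d inj nxt cover no-flip
      where
      d : Fin 2 → D
      d zero       = d₀
      d (suc zero) = d₁
      f₁≢d₀ : flip d₁ ≢ d₀
      f₁≢d₀ eq = n₁ (flip-swap eq)
      inj : ∀ i j → at (d i) ≡ at (d j) → i ≡ j
      inj zero zero _ = refl
      inj (suc zero) (suc zero) _ = refl
      inj zero (suc zero) eq = ⊥-elim (v₁≢v₀ (sym eq))
      inj (suc zero) zero eq = ⊥-elim (v₁≢v₀ eq)
      nxt : ∀ i → at (flip (d i)) ≡ at (d (cycle-step 2 i))
      nxt zero       = sym a₁
      nxt (suc zero) = p
      cover : ∀ x i → at x ≡ at (d i) → ∃ λ j → x ≡ d j ⊎ x ≡ flip (d j)
      cover x zero q = [ (λ eq → zero , inj₁ eq) , (λ eq → suc zero , inj₂ eq) ]′ (at-v₀ p f₁≢d₀ q)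
      cover x (suc zero) q = [ (λ eq → zero , inj₂ eq) , (λ eq → suc zero , inj₁ eq) ]′
        (dart-cases (flip d₀) (trans q a₁))
      no-flip : ∀ i j → d i ≢ flip (d j)
      no-flip zero zero eq = flip-≢ d₀ eq
      no-flip zero (suc zero) eq = f₁≢d₀ (sym eq)
      no-flip (suc zero) zero eq = n₁ eq
      no-flip (suc zero) (suc zero) eq = flip-≢ d₁ eq

    one : at (flip d₀) ≡ at d₀ → S₂ H α ≅ cycle 3
    one p = closed-trail⇒cycle α con nl 1 id triangle-step-1
      zero (λ _ → d₀) (λ { zero zero _ → refl }) (λ _ → p)
      (λ x _ q → zero , at-v₀ p (flip-≢ d₀ ∘ sym) q)
      (λ _ _ → flip-≢ d₀)

    -- Both darts at v₁ and both at v₂ are already on the walk, so its fourth vertex can repeat only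
    -- the first; if it does not, the four vertices form a path and yield a false edge.
    walk₃ : at d₁ ≢ at d₀ → at d₂ ≢ at d₀ → at d₂ ≢ at d₁ → S₂ H α ≅ cycle 9
    walk₃ v₁≢v₀ v₂≢v₀ v₂≢v₁ with at (flip d₂) ≟ at d₀
    ... | yes p = three v₁≢v₀ v₂≢v₀ v₂≢v₁ p
    ... | no v₃≢v₀ = ⊥-elim
      (let L , ff = path⇒labelling d₀ d₁ d₂ a₁ a₂ n₁ n₂
                      v₁≢v₀ v₂≢v₀ v₂≢v₁ v₃≢v₀ v₃≢v₁ v₃≢v₂ noiso
       in none L ff)
      where
      v₃≢v₁ : at (flip d₂) ≢ at d₁
      v₃≢v₁ p with dart-cases (flip d₀) (trans p a₁)
      ... | inj₁ eq = v₂≢v₀ (cong at (flip-inj eq))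
      ... | inj₂ eq = n₂ (flip-swap eq)
      v₃≢v₂ : at (flip d₂) ≢ at d₂
      v₃≢v₂ p with dart-cases (flip d₁) (trans p a₂)
      ... | inj₁ eq = v₂≢v₁ (cong at (flip-inj eq))
      ... | inj₂ eq = flip-≢ d₂ (sym eq)

    walk₂ : at d₁ ≢ at d₀ → S₂ H α ≅ cycle 6 ⊎ S₂ H α ≅ cycle 9
    walk₂ v₁≢v₀ with at (flip d₁) ≟ at d₀
    ... | yes p = inj₁ (twoCycle v₁≢v₀ p)
    ... | no n  = inj₂ (walk₃ v₁≢v₀ (λ p → n (trans (sym a₂) p)) v₂≢v₁)
      where
      v₂≢v₁ : at d₂ ≢ at d₁
      v₂≢v₁ p with dart-cases (flip d₀) (trans (sym a₂) (trans p a₁))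
      ... | inj₁ eq = v₁≢v₀ (cong at (flip-inj eq))
      ... | inj₂ eq = flip-≢ d₁ (sym eq)

    walk₁ : S₂ H α ≅ cycle 3 ⊎ S₂ H α ≅ cycle 6 ⊎ S₂ H α ≅ cycle 9
    walk₁ with at (flip d₀) ≟ at d₀
    ... | yes p = inj₁ (one p)
    ... | no n  = inj₂ (walk₂ (λ p → n (trans (sym a₁) p)))

-- Minimality of the cycles of length 3, 6 and 9

-- The condition at the middle of three consecutive labels: a vertex of `P` has one neighbour in
-- `P`, its partner, and one outside; a vertex outside `P` has at least one neighbour in it.
locally-valid : Bool → Bool → Bool → Bool
locally-valid a b c = if b then a xor c else a ∨ c

module _ (n : ℕ) .{{_ : NonZero n}} (step-inj : ∀ {x y} → cycle-step n x ≡ cycle-step n y → x ≡ y)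
         {F : Sub (Fin n)} {P : Sub (Fin n)} (sp : DPSplit (cycle n) F P) where
  open DPSplit sp
  private
    next : Fin n → Fin n
    next = cycle-step n

    -- The two neighbours serve as partner and as dominator, so both incident edges are present.
    in-P : ∀ a → P (next a) ≡ true →
           F a ≡ true × F (next a) ≡ true × locally-valid (P a) (P (next a)) (P (next (next a))) ≡ true
    in-P a p with dominatedᴰ _ p | M-covers _ p
    ... | x , false , f , refl , d | y , false , m , refl = ⊥-elim (true≢false (M-ends y m true) d)
    ... | x , false , f , refl , d | y , true  , m , eq with step-inj {y} {a} eq
    ...   | refl = M⊆F y m , f , valid p (M-ends y m false) d
      where
      valid : ∀ {a b c} → b ≡ true → a ≡ true → c ≡ false → locally-valid a b c ≡ true
      valid refl refl refl = refl
    in-P a p | x , true , f , eq , d | y , true , m , eq′ with step-inj {x} {a} eq | step-inj {y} {a} eq′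
    ...   | refl | refl = ⊥-elim (true≢false (M-ends y m false) d)
    in-P a p | x , true , f , eq , d | y , false , m , refl with step-inj {x} {a} eq
    ...   | refl = f , M⊆F y m , valid p d (M-ends y m true)
      where
      valid : ∀ {a b c} → b ≡ true → a ≡ false → c ≡ true → locally-valid a b c ≡ true
      valid refl refl refl = refl

    in-D : ∀ a → P (next a) ≡ false →
           (F a ≡ true × P a ≡ true) ⊎ (F (next a) ≡ true × P (next (next a)) ≡ true)
    in-D a p with dominatedᴾ _ p
    ... | x , false , f , refl , d = inj₂ (f , d)
    ... | x , true  , f , eq , d with step-inj {x} {a} eq
    ...   | refl = inj₁ (f , d)

  valid-at : ∀ a → locally-valid (P a) (P (next a)) (P (next (next a))) ≡ true
  valid-at a with true⊎false (P (next a))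
  ... | inj₁ p = proj₂ (proj₂ (in-P a p))
  ... | inj₂ p with in-D a p
  ...   | inj₁ (_ , q) = valid p q
    where
    valid : ∀ {a b c} → b ≡ false → a ≡ true → locally-valid a b c ≡ true
    valid refl refl = refl
  ...   | inj₂ (_ , q) = valid p q
    where
    valid : ∀ {a b c} → b ≡ false → c ≡ true → locally-valid a b c ≡ true
    valid {false} refl refl = refl
    valid {true}  refl refl = refl

  -- Edge `i` of the cycle joins `i` to `next i`. By `in-P` both ends of a missing edge are outside
  -- `P`, so each is dominated from its other side.
  missing-edge : ∀ a → F (next a) ≡ false →
    (P a ≡ true × P (next a) ≡ false) × (P (next (next a)) ≡ false × P (next (next (next a))) ≡ true)
  missing-edge a ¬f = ([ proj₂ , (λ (f , _) → ⊥-elim (true≢false f ¬f)) ]′ (in-D a ¬p) , ¬p) ,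
                      (¬q , [ (λ (f , _) → ⊥-elim (true≢false f ¬f)) , proj₂ ]′ (in-D (next a) ¬q))
    where
    ¬p : P (next a) ≡ false
    ¬p = ¬-not λ p → true≢false (proj₁ (proj₂ (in-P a p))) ¬f
    ¬q : P (next (next a)) ≡ false
    ¬q = ¬-not λ p → true≢false (proj₁ (in-P (next a) p)) ¬f

-- From a missing edge on, the labels along the cycle are forced: blocks D P P, each possibly
-- followed by an extra D; none of these patterns closes up after 3, 6 or 9 steps.
module _ {A : Set} (n : A → A) (F P : A → Bool)
         (valid : ∀ a → locally-valid (P a) (P (n a)) (P (n (n a))) ≡ true)
         (missing : ∀ a → F (n a) ≡ false →
           (P a ≡ true × P (n a) ≡ false) × (P (n (n a)) ≡ false × P (n (n (n a))) ≡ true)) where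

  no-missing-3 : (∀ x → n (n (n x)) ≡ x) → ∀ e → F e ≢ false
  no-missing-3 period e ¬f with missing (n (n e)) (trans (cong F (period e)) ¬f)
  ... | (_ , p) , (q , r) = absurd q r (trans (cong P (period a₁)) p) (valid (n a₁))
    where
    a₁ = n (n (n e))
    absurd : ∀ {x y z} → x ≡ false → y ≡ true → z ≡ false → locally-valid x y z ≢ true
    absurd refl refl refl ()

  no-missing-6 : (∀ x → n (n (n (n (n (n x))))) ≡ x) → ∀ e → F e ≢ false
  no-missing-6 period e ¬f with missing (n (n (n (n (n e))))) (trans (cong F (period e)) ¬f)
  ... | (o , p) , (q , r) = absurd q r (trans (cong P (period a)) o) (trans (cong P (period (n a))) p)
      (valid (n (n a))) (valid (n (n (n a)))) (valid (n (n (n (n (n a))))))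
    where
    a = n (n (n (n (n e))))
    -- The labels run once around the cycle, from the far end `a₀` of the missing edge to its near
    -- end `a₅`; only `a₂` and `a₃` are open.
    absurd : ∀ {a₀ a₁ a₂ a₃ a₄ a₅} → a₀ ≡ false → a₁ ≡ true → a₄ ≡ true → a₅ ≡ false →
      locally-valid a₀ a₁ a₂ ≡ true → locally-valid a₁ a₂ a₃ ≡ true → locally-valid a₃ a₄ a₅ ≡ true → ⊥
    absurd {a₂ = true}  {true}  refl refl refl refl _ () _
    absurd {a₂ = true}  {false} refl refl refl refl _ _ ()
    absurd {a₂ = false} refl refl refl refl () _ _

  no-missing-9 : (∀ x → n (n (n (n (n (n (n (n (n x)))))))) ≡ x) → ∀ e → F e ≢ false
  no-missing-9 period e ¬f with missing (n (n (n (n (n (n (n (n e)))))))) (trans (cong F (period e)) ¬f)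
  ... | (o , p) , (q , r) = absurd q r (trans (cong P (period a)) o) (trans (cong P (period (n a))) p)
      (valid (n (n a))) (valid (n (n (n a)))) (valid (n (n (n (n a))))) (valid (n (n (n (n (n a))))))
      (valid (n (n (n (n (n (n a))))))) (valid (n (n (n (n (n (n (n a))))))))
      (valid (n (n (n (n (n (n (n (n a)))))))))
    where
    a = n (n (n (n (n (n (n (n e)))))))
    absurd : ∀ {a₀ a₁ a₂ a₃ a₄ a₅ a₆ a₇ a₈} → a₀ ≡ false → a₁ ≡ true → a₇ ≡ true → a₈ ≡ false →
      locally-valid a₀ a₁ a₂ ≡ true → locally-valid a₁ a₂ a₃ ≡ true → locally-valid a₂ a₃ a₄ ≡ true →
      locally-valid a₃ a₄ a₅ ≡ true → locally-valid a₄ a₅ a₆ ≡ true → locally-valid a₅ a₆ a₇ ≡ true →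
      locally-valid a₆ a₇ a₈ ≡ true → ⊥
    absurd {a₂ = false} refl refl refl refl () _ _ _ _ _ _
    absurd {a₂ = true} {true} refl refl refl refl _ () _ _ _ _ _
    absurd {a₂ = true} {false} {true} {false} refl refl refl refl _ _ _ () _ _ _
    absurd {a₂ = true} {false} {true} {true} {true} refl refl refl refl _ _ _ _ () _ _
    absurd {a₂ = true} {false} {true} {true} {false} refl refl refl refl _ _ _ _ _ _ ()
    absurd {a₂ = true} {false} {false} {false} refl refl refl refl _ _ _ () _ _ _
    absurd {a₂ = true} {false} {false} {true} {false} refl refl refl refl _ _ _ _ () _ _
    absurd {a₂ = true} {false} {false} {true} {true} refl refl refl refl _ _ _ _ _ () _

left-inverse⇒injective : ∀ {A : Set} (f g : A → A) → (∀ x → g (f x) ≡ x) → ∀ {x y} → f x ≡ f y → x ≡ y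
left-inverse⇒injective f g inv {x} {y} eq = trans (sym (inv x)) (trans (cong g eq) (inv y))

cycle-3-minimal : MinimalSplit (cycle 3) everything
cycle-3-minimal F _ e _ ¬f P sp =
  no-missing-3 next F P (valid-at 3 inj sp) (missing-edge 3 inj sp) period e ¬f
  where
  next = cycle-step 3
  period : ∀ x → next (next (next x)) ≡ x
  period = toWitness {a? = all? λ x → next (next (next x)) ≟ x} tt
  inj : ∀ {x y} → next x ≡ next y → x ≡ y
  inj = left-inverse⇒injective next (λ x → next (next x)) period

cycle-6-minimal : MinimalSplit (cycle 6) everything
cycle-6-minimal F _ e _ ¬f P sp =
  no-missing-6 next F P (valid-at 6 inj sp) (missing-edge 6 inj sp) period e ¬f
  where
  next = cycle-step 6
  period : ∀ x → next (next (next (next (next (next x))))) ≡ x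
  period = toWitness {a? = all? λ x → next (next (next (next (next (next x))))) ≟ x} tt
  inj : ∀ {x y} → next x ≡ next y → x ≡ y
  inj = left-inverse⇒injective next (λ x → next (next (next (next (next x))))) period

cycle-9-minimal : MinimalSplit (cycle 9) everything
cycle-9-minimal F _ e _ ¬f P sp =
  no-missing-9 next F P (valid-at 9 inj sp) (missing-edge 9 inj sp) period e ¬f
  where
  next = cycle-step 9
  period : ∀ x → next (next (next (next (next (next (next (next (next x)))))))) ≡ x
  period = toWitness {a? = all? λ x → next (next (next (next (next (next (next (next (next x)))))))) ≟ x} tt
  inj : ∀ {x y} → next x ≡ next y → x ≡ y
  inj = left-inverse⇒injective next (λ x → next (next (next (next (next (next (next (next x)))))))) period

-- The implications between the statements

module _ {H : FinGraph} (α : LeafFunction H) where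

  no-good⇒minimal : ¬ HasGoodSubgraph H → MinimalSplit (S₂ H α) everything
  no-good⇒minimal ¬good F _ e _ ¬f P sp with false-edge? (DPSplit⇒labelling α sp)
  ... | inj₁ ff    = ¬good (labelling⇒good (DPSplit⇒labelling α sp) ff)
  ... | inj₂ no-ff = true≢false
    (spans-everything α sp no-ff (false⇒X L no-ff) (false-unique L no-ff) e) ¬f
    where L = DPSplit⇒labelling α sp

  minimal⇒no-good : NoIsolatedVertex ⟦ H ⟧ → MinimalSplit (S₂ H α) everything → ¬ HasGoodSubgraph H
  minimal⇒no-good noiso min (Q , good) =
    false-edge⇒¬minimal α (good⇒labelling noiso good) (good⇒false-edge noiso good) min

  S₂-DPPair : NoIsolatedVertex ⟦ H ⟧ → DPPair (S₂ H α) (Vᵒ H α) (Vⁿ H α)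
  S₂-DPPair noiso = DPSplit⇒DPPair (S₂-DPSplit α noiso)

  -- Uniqueness puts every new vertex into `P`, so the conditions on false darts in
  -- `spans-everything` hold vacuously.
  unique⇒minimal : UniqueDPPair (S₂ H α) (Vᵒ H α) (Vⁿ H α) → MinimalSplit (S₂ H α) everything
  unique⇒minimal (_ , unique) F _ e _ ¬f P sp = true≢false
    (spans-everything α sp (λ e s n → absurd e s n) (λ e s n → absurd e s n)
      (λ e s _ _ _ n _ → absurd e s n) e) ¬f
    where
    absurd : ∀ e s {A : Set} → P (new e s) ≡ false → A
    absurd e s n = ⊥-elim (≡⇒¬T n (proj₂ (proj₂ (unique _ P
      (DPSplit⇒DPPair (weaken-DPSplit (λ _ _ → refl) sp)))) (new e s) tt))

  -- False darts sit at vertices of `X`, so a pair with `X` empty is the original one; a nonempty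
  -- `X` would spread to `v` and give it degree 2.
  minimal⇒unique : Connected ⟦ H ⟧ → NoIsolatedVertex ⟦ H ⟧ → ∀ v → degree H v ≢ 2 →
                   MinimalSplit (S₂ H α) everything → UniqueDPPair (S₂ H α) (Vᵒ H α) (Vⁿ H α)
  minimal⇒unique con noiso v ≢2 min = S₂-DPPair noiso , unique
    where
    unique : ∀ D P → DPPair (S₂ H α) D P → D ≐ Vᵒ H α × P ≐ Vⁿ H α
    unique D P dp = (⇒ D≡ , ⇒ (sym ∘ D≡)) , (⇒ P≡ , ⇒ (sym ∘ P≡))
      where
      sp = DPPair⇒DPSplit dp
      L = DPSplit⇒labelling α sp
      open Labelling L
      no-ff : ∀ e s → N e s ≡ false → N e (not s) ≡ true
      no-ff = [ (λ ff → ⊥-elim (false-edge⇒¬minimal α L ff min)) , id ]′ (false-edge? L)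
      ¬X : ∀ u → X u ≡ false
      ¬X u = ¬-not λ x → ≢2 (X⇒degree-2 L no-ff v (X-connected L no-ff (con u v) x))
      P≡ : ∀ x → P x ≡ Vⁿ H α x
      P≡ (old u n)    = trans (sym (labelling-X α sp n)) (¬X u)
      P≡ (copy u ℓ i) = labelling-copy α sp u ℓ i
      P≡ (new e s)    = [ id , (λ n → ⊥-elim (true≢false (false⇒X L no-ff e s n) (¬X _))) ]′ (true⊎false _)
      D≡ : ∀ x → D x ≡ Vᵒ H α x
      D≡ x = trans (DPPair⇒complement dp x) (cong not (P≡ x))
      ⇒ : ∀ {A : Set} {S S′ : Sub A} → (∀ x → S x ≡ S′ x) → S ⊆ S′
      ⇒ eq x = subst T (eq x)

  minimal⇒unique-or-cycle : Connected ⟦ H ⟧ → NoIsolatedVertex ⟦ H ⟧ → Fin (FinGraph.order H) →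
    MinimalSplit (S₂ H α) everything →
    UniqueDPPair (S₂ H α) (Vᵒ H α) (Vⁿ H α) ⊎ (S₂ H α ≅ cycle 3 ⊎ S₂ H α ≅ cycle 6 ⊎ S₂ H α ≅ cycle 9)
  minimal⇒unique-or-cycle con noiso v₀ min with any? (λ v → ¬? (degree H v ℕ.≟ 2))
  ... | yes (v , ≢2) = inj₁ (minimal⇒unique con noiso v ≢2 min)
  ... | no none = inj₂ (two-regular⇒cycle
    (λ v → decidable-stable (degree H v ℕ.≟ 2) λ ≢2 → none (v , ≢2))
    α con noiso (λ L ff → false-edge⇒¬minimal α L ff min) v₀)

module _ (G : FinGraph) where

  minimal⇒S₂ : Connected ⟦ G ⟧ → MinimalDPDP ⟦ G ⟧ →
    ∃ λ H → Connected ⟦ H ⟧ × NoIsolatedVertex ⟦ H ⟧ × ∃ λ (α : LeafFunction H) →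
      ⟦ G ⟧ ≅ S₂ H α × MinimalSplit (S₂ H α) everything
  minimal⇒S₂ con min@((_ , P , dp) , _) =
    let min′ = minimalDPDP⇒minimalSplit min
        H , noiso , α , ψ = minimalSplit⇒twoSubdivided G (DPPair⇒DPSplit dp) min′
        φ = ≅-trans ≅-spanning-everything ψ
    in H , S₂-connected⇒ α noiso (≅-connected φ con) , noiso , α , φ , ≅-minimalSplit φ min′

  S₂-minimal⇒ : ∀ {H} {α : LeafFunction H} → NoIsolatedVertex ⟦ H ⟧ → ⟦ G ⟧ ≅ S₂ H α →
                MinimalSplit ⟦ G ⟧ everything → MinimalDPDP ⟦ G ⟧
  S₂-minimal⇒ {α = α} noiso φ = minimalSplit⇒minimalDPDP (≅-DPSplit (≅-sym φ) (S₂-DPSplit α noiso))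

  NoSubdividedSubgraph : Set
  NoSubdividedSubgraph = ∀ F → Proper ⟦ G ⟧ F → NoIsolatedVertex (spanning ⟦ G ⟧ F) →
                         ¬ TwoSubdivided (spanning ⟦ G ⟧ F)

  minimal⇒no-subdivided : MinimalDPDP ⟦ G ⟧ → NoSubdividedSubgraph
  minimal⇒no-subdivided (_ , min) F proper _ (H , noiso , α , φ) = min F proper
    (_ , _ , DPSplit⇒DPPair (≅-DPSplit (≅-sym φ) (S₂-DPSplit α noiso)))

  -- A DP-pair of a proper spanning subgraph would survive in an edge-minimal subgraph of it.
  no-subdivided⇒minimal : NoSubdividedSubgraph → MinimalSplit ⟦ G ⟧ everything
  no-subdivided⇒minimal none F _ e _ ¬f P = descend (suc (# F)) F e ¬f P ℕ.≤-refl
    where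
    open FinGraph G
    descend : ∀ n F e → F e ≡ false → ∀ P → # F < n → ¬ DPSplit ⟦ G ⟧ F P
    descend (suc n) F e ¬f P (s≤s #F≤n) sp = none F (e , ≡⇒¬T ¬f) nonisolated
      -- The induction hypothesis for smaller edge sets is exactly the minimality of `F`.
      (minimalSplit⇒twoSubdivided G sp λ F′ sub x f ¬f′ P′ →
        descend n F′ x ¬f′ P′ (ℕ.≤-trans (#-strict F′ F sub x ¬f′ f) #F≤n))
      where
      open DPSplit sp
      nonisolated : NoIsolatedVertex (spanning ⟦ G ⟧ F)
      nonisolated v with true⊎false (P v)
      ... | inj₁ p = let x , s , f , q , _ = dominatedᴰ v p in (x , ≡⇒T f) , s , q
      ... | inj₂ p = let x , s , f , q , _ = dominatedᴾ v p in (x , ≡⇒T f) , s , q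

theorem3p1 : (G : FinGraph) → Connected ⟦ G ⟧ → 3 ≤ FinGraph.order G →
    (MinimalDPDP ⟦ G ⟧
    ⇔ (∃ λ H → Connected ⟦ H ⟧ × NoIsolatedVertex ⟦ H ⟧ × ∃ λ (α : LeafFunction H) → ⟦ G ⟧ ≅ S₂ H α
    × (UniqueDPPair (S₂ H α) (Vᵒ H α) (Vⁿ H α) ⊎ (⟦ G ⟧ ≅ cycle 3 ⊎ ⟦ G ⟧ ≅ cycle 6 ⊎ ⟦ G ⟧ ≅ cycle 9))))
    × (MinimalDPDP ⟦ G ⟧
    ⇔ (∃ λ H → Connected ⟦ H ⟧ × NoIsolatedVertex ⟦ H ⟧ × ∃ λ (α : LeafFunction H) → ⟦ G ⟧ ≅ S₂ H α
    × ¬ HasGoodSubgraph H))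
    × (MinimalDPDP ⟦ G ⟧
    ⇔ (∃ λ H → Connected ⟦ H ⟧ × NoIsolatedVertex ⟦ H ⟧ × ∃ λ (α : LeafFunction H) → ⟦ G ⟧ ≅ S₂ H α
    × (∀ F → Proper ⟦ G ⟧ F → NoIsolatedVertex (spanning ⟦ G ⟧ F) → ¬ TwoSubdivided (spanning ⟦ G ⟧ F))))
theorem3p1 G con 3≤order =
    mk⇔ (λ min → let H , conH , noiso , α , φ , minS = minimal⇒S₂ G con min in
           H , conH , noiso , α , φ ,
           [ inj₁ , inj₂ ∘ [ inj₁ ∘ ≅-trans φ , inj₂ ∘ [ inj₁ ∘ ≅-trans φ , inj₂ ∘ ≅-trans φ ]′ ]′ ]′
             (minimal⇒unique-or-cycle α conH noiso
               -- The bound on the order, read as `2 < order`, provides a vertex of `G` and hence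
               -- one of `H`, from which a walk around `H` can start.
               (projection α (Inverse.to (_≅_.onV φ) (fromℕ< 3≤order))) minS))
        (λ { (H , _ , noiso , α , φ , inj₁ unique) →
               S₂-minimal⇒ G noiso φ (≅-minimalSplit (≅-sym φ) (unique⇒minimal α unique))
           ; (H , _ , noiso , α , φ , inj₂ (inj₁ ψ)) →
               S₂-minimal⇒ G noiso φ (≅-minimalSplit (≅-sym ψ) cycle-3-minimal)
           ; (H , _ , noiso , α , φ , inj₂ (inj₂ (inj₁ ψ))) →
               S₂-minimal⇒ G noiso φ (≅-minimalSplit (≅-sym ψ) cycle-6-minimal)
           ; (H , _ , noiso , α , φ , inj₂ (inj₂ (inj₂ ψ))) →
               S₂-minimal⇒ G noiso φ (≅-minimalSplit (≅-sym ψ) cycle-9-minimal) })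
  , mk⇔ (λ min → let H , conH , noiso , α , φ , minS = minimal⇒S₂ G con min in
           H , conH , noiso , α , φ , minimal⇒no-good α noiso minS)
        (λ (H , _ , noiso , α , φ , ¬good) →
           S₂-minimal⇒ G noiso φ (≅-minimalSplit (≅-sym φ) (no-good⇒minimal α ¬good)))
  , mk⇔ (λ min → let H , conH , noiso , α , φ , _ = minimal⇒S₂ G con min in
           H , conH , noiso , α , φ , minimal⇒no-subdivided G min)
        (λ (H , _ , noiso , α , φ , none) →
           S₂-minimal⇒ G noiso φ (no-subdivided⇒minimal G none))
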